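{- Let $d\ge1$, let $p\in(0,1)$ and let $n$ be a positive integer such that $pn$ is an integer. Let $D_p$ be the uniform distribution on all $x\in\{\pm1\}^n$ with $\sum_{i=1}^n x_i=(1-2p)n$, and put $$K=12\cdot d^{3/2}\cdot\left(256\cdot\Big(\big(\tfrac{1-p}{p}\big)^2+\big(\tfrac{p}{1-p}\big)^2\Big)^2\right)^d .$$ For every multilinear polynomial $f$ of degree at most $d$ in $\phi_1,\dots,\phi_n$, $$\mathbb E_{D_p}[f(\phi_1,\dots,\phi_n)^4]\le K\cdot\big(\mathbb E_{D_p}[f(\phi_1,\dots,\phi_n)^2]\big)^2 .$$ Also, for every multilinear polynomial $g$ of degree at most $d$ in $x_1,\dots,x_n$, $$\mathbb E_{D_p}[g(x_1,\dots,x_n)^4]\le K\cdot\big(\mathbb E_{D_p}[g(x_1,\dots,x_n)^2]\big)^2 .$$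
   Context: For $x\in\{\pm1\}^n$ and $i\in[n]$, $\phi_i=\phi_i(x)$ equals $\sqrt{p/(1-p)}$ if $x_i=1$ and $-\sqrt{(1-p)/p}$ if $x_i=-1$. Polynomials have real coefficients. -}

module Defs where

open import Data.Bool.Base using (true; false; if_then_else_)
open import Data.Fin.Subset using (Subset; ∣_∣)
open import Data.Integer.Base as ℤ using (ℤ)
import Data.Integer.Properties as ℤₚ
open import Data.List.Base as List using (List; []; _∷_)
open import Data.Nat.Base as ℕ using (ℕ; zero; suc)
import Data.Nat.DivMod as ℕ
import Data.Nat.Properties as ℕₚ
open import Data.Nat.Tactic.RingSolver using (solve-∀)
open import Data.Product.Base using (∃; _×_; _,_; proj₁; proj₂)
open import Data.Rational.Base as ℚ using (ℚ; 0ℚ; 1ℚ)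
import Data.Rational.Properties as ℚₚ
open import Data.Rational.Solver using (module +-*-Solver)
import Data.Rational.Unnormalised.Base as ℚᵘ
import Data.Rational.Unnormalised.Properties as ℚᵘₚ
open import Data.Sign.Base as Sign using (Sign)
open import Data.Sum.Base using (inj₁; inj₂)
open import Data.Vec.Base as Vec using (Vec; []; _∷_)
open import Relation.Binary.PropositionalEquality
open import Relation.Nullary.Decidable using (yes; no)

ℕ→ℚ : ℕ → ℚ
ℕ→ℚ n = ℤ.+ n ℚ./ 1

p<1⇒0<1-p : ∀ {p} → p ℚ.< 1ℚ → 0ℚ ℚ.< 1ℚ ℚ.- p
p<1⇒0<1-p {p} p<1 =
  subst (ℚ._< 1ℚ ℚ.- p) (ℚₚ.+-inverseʳ p) (ℚₚ.+-monoˡ-< (ℚ.- p) p<1)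

private
  half : ℚ → ℚ
  half ε = ε ℚ.* ℚ.½

  half-pos : ∀ {ε} → 0ℚ ℚ.< ε → 0ℚ ℚ.< half ε
  half-pos {ε} 0<ε =
    subst (ℚ._< half ε) (ℚₚ.*-zeroˡ ℚ.½) (ℚₚ.*-monoˡ-<-pos ℚ.½ 0<ε)

  half+half : ∀ ε → half ε ℚ.+ half ε ≡ ε
  half+half ε = trans (sym (ℚₚ.*-distribˡ-+ ε ℚ.½ ℚ.½)) (ℚₚ.*-identityʳ ε)

  abs-< : ∀ {x y ε} → x ℚ.< y ℚ.+ ε → y ℚ.< x ℚ.+ ε → ℚ.∣ x ℚ.- y ∣ ℚ.< ε
  abs-< {x} {y} {ε} x< y< with ℚₚ.∣p∣≡p∨∣p∣≡-p (x ℚ.- y)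
  ... | inj₁ eq = subst₂ ℚ._<_ (sym eq) (cancel y ε) (ℚₚ.+-monoˡ-< (ℚ.- y) x<)
    where
    open +-*-Solver
    cancel : ∀ y ε → y ℚ.+ ε ℚ.- y ≡ ε
    cancel = solve 2 (λ y ε → y :+ ε :- y := ε) refl
  ... | inj₂ eq = subst₂ ℚ._<_ (trans (flip x y) (sym eq)) (cancel x ε)
                    (ℚₚ.+-monoˡ-< (ℚ.- x) y<)
    where
    open +-*-Solver
    cancel : ∀ x ε → x ℚ.+ ε ℚ.- x ≡ ε
    cancel = solve 2 (λ x ε → x :+ ε :- x := ε) refl
    flip : ∀ x y → y ℚ.- x ≡ ℚ.- (x ℚ.- y)
    flip = solve 2 (λ x y → y :- x := :- (x :- y)) refl

  /-mono-< : ∀ a b m n → a ℕ.* suc n ℕ.< b ℕ.* suc m →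
             ℤ.+ a ℚ./ suc m ℚ.< ℤ.+ b ℚ./ suc n
  /-mono-< a b m n lt = ℚₚ.toℚᵘ-cancel-<
    (ℚᵘₚ.<-respˡ-≃ (ℚᵘₚ.≃-sym (ℚₚ.toℚᵘ-fromℚᵘ (ℚᵘ.mkℚᵘ (ℤ.+ a) m)))
    (ℚᵘₚ.<-respʳ-≃ (ℚᵘₚ.≃-sym (ℚₚ.toℚᵘ-fromℚᵘ (ℚᵘ.mkℚᵘ (ℤ.+ b) n)))
    (ℚᵘ.*<* (subst₂ ℤ._<_ (ℤₚ.pos-* a (suc n)) (ℤₚ.pos-* b (suc m))
              (ℤ.+<+ lt)))))

  /-split : ∀ a n → ℤ.+ (suc a) ℚ./ suc n ≡ ℤ.+ a ℚ./ suc n ℚ.+ ℤ.+ 1 ℚ./ suc n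
  /-split a n = ℚₚ.toℚᵘ-injective
    (ℚᵘₚ.≃-trans (ℚₚ.toℚᵘ-fromℚᵘ (ℚᵘ.mkℚᵘ (ℤ.+ suc a) n))
    (ℚᵘₚ.≃-trans (ℚᵘ.*≡* eq)
    (ℚᵘₚ.≃-sym
    (ℚᵘₚ.≃-trans (ℚₚ.toℚᵘ-homo-+ (ℤ.+ a ℚ./ suc n) (ℤ.+ 1 ℚ./ suc n))
      (ℚᵘₚ.+-cong (ℚₚ.toℚᵘ-fromℚᵘ (ℚᵘ.mkℚᵘ (ℤ.+ a) n))
                  (ℚₚ.toℚᵘ-fromℚᵘ (ℚᵘ.mkℚᵘ (ℤ.+ 1) n)))))))
    where
    nat : ∀ a s → suc a ℕ.* (s ℕ.* s) ≡ (a ℕ.* s ℕ.+ 1 ℕ.* s) ℕ.* s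
    nat = solve-∀
    s = suc n
    eq : ℤ.+ suc a ℤ.* ℤ.+ (s ℕ.* s) ≡
         (ℤ.+ a ℤ.* ℤ.+ s ℤ.+ ℤ.+ 1 ℤ.* ℤ.+ s) ℤ.* ℤ.+ s
    eq = trans (sym (ℤₚ.pos-* (suc a) (s ℕ.* s)))
         (trans (cong ℤ.+_ (nat a s))
         (trans (ℤₚ.pos-* (a ℕ.* s ℕ.+ 1 ℕ.* s) s)
           (cong (ℤ._* ℤ.+ s)
             (trans (ℤₚ.pos-+ (a ℕ.* s) (1 ℕ.* s))
               (cong₂ ℤ._+_ (ℤₚ.pos-* a s) (ℤₚ.pos-* 1 s))))))

  archimedean : ∀ ε → 0ℚ ℚ.< ε → ∃ λ N → ∀ n → N ℕ.≤ n → ℤ.+ 1 ℚ./ suc n ℚ.< ε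
  archimedean (ℚ.mkℚ ℤ.+0 d c) (ℚ.*<* (ℤ.+<+ ()))
  archimedean (ℚ.mkℚ (ℤ.-[1+ a ]) d c) (ℚ.*<* ())
  archimedean ε@(ℚ.mkℚ (ℤ.+[1+ a ]) d c) _ = suc d , λ n N≤n →
    subst (ℤ.+ 1 ℚ./ suc n ℚ.<_) (ℚₚ.↥p/↧p≡p ε)
      (/-mono-< 1 (suc a) n d
        (ℕₚ.≤-trans
          (ℕ.s≤s (subst (ℕ._≤ n) (sym (ℕₚ.*-identityˡ (suc d))) N≤n))
          (ℕₚ.m≤n*m (suc n) (suc a))))

Cauchy : (ℕ → ℚ) → Set
Cauchy s = ∀ ε → 0ℚ ℚ.< ε →
  ∃ λ N → ∀ m n → N ℕ.≤ m → N ℕ.≤ n → ℚ.∣ s m ℚ.- s n ∣ ℚ.< ε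

-- A real number is a Cauchy sequence of rationals (with an explicit modulus).
-- Equality of reals is _≃_, not _≡_.
record ℝ : Set where
  constructor mkℝ
  field
    seq    : ℕ → ℚ
    cauchy : Cauchy seq

open ℝ public

infix 4 _≃_ _≤_

_≃_ : ℝ → ℝ → Set
x ≃ y = ∀ ε → 0ℚ ℚ.< ε →
  ∃ λ N → ∀ n → N ℕ.≤ n → ℚ.∣ seq x n ℚ.- seq y n ∣ ℚ.< ε

_≤_ : ℝ → ℝ → Set
x ≤ y = ∀ ε → 0ℚ ℚ.< ε →
  ∃ λ N → ∀ n → N ℕ.≤ n → seq x n ℚ.≤ seq y n ℚ.+ ε

private
  +-cauchy : ∀ x y → Cauchy (λ n → seq x n ℚ.+ seq y n)
  +-cauchy x y ε 0<ε
    with cauchy x (half ε) (half-pos 0<ε) | cauchy y (half ε) (half-pos 0<ε)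
  ... | N , hx | M , hy = N ℕ.⊔ M , λ m n ≤m ≤n → begin-strict
      ℚ.∣ (seq x m ℚ.+ seq y m) ℚ.- (seq x n ℚ.+ seq y n) ∣
        ≡⟨ cong ℚ.∣_∣ (rearrange (seq x m) (seq y m) (seq x n) (seq y n)) ⟩
      ℚ.∣ (seq x m ℚ.- seq x n) ℚ.+ (seq y m ℚ.- seq y n) ∣
        ≤⟨ ℚₚ.∣p+q∣≤∣p∣+∣q∣ (seq x m ℚ.- seq x n) (seq y m ℚ.- seq y n) ⟩
      ℚ.∣ seq x m ℚ.- seq x n ∣ ℚ.+ ℚ.∣ seq y m ℚ.- seq y n ∣
        <⟨ ℚₚ.+-mono-< (hx m n (ℕₚ.m⊔n≤o⇒m≤o N M ≤m) (ℕₚ.m⊔n≤o⇒m≤o N M ≤n))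
                       (hy m n (ℕₚ.m⊔n≤o⇒n≤o N M ≤m) (ℕₚ.m⊔n≤o⇒n≤o N M ≤n)) ⟩
      half ε ℚ.+ half ε
        ≡⟨ half+half ε ⟩
      ε ∎
    where
    open ℚₚ.≤-Reasoning
    open +-*-Solver
    rearrange : ∀ a b c d →
      (a ℚ.+ b) ℚ.- (c ℚ.+ d) ≡ (a ℚ.- c) ℚ.+ (b ℚ.- d)
    rearrange = solve 4 (λ a b c d →
      (a :+ b) :- (c :+ d) := (a :- c) :+ (b :- d)) refl

  neg-cauchy : ∀ x → Cauchy (λ n → ℚ.- seq x n)
  neg-cauchy x ε 0<ε with cauchy x ε 0<ε
  ... | N , hx = N , λ m n ≤m ≤n → subst (ℚ._< ε)
      (trans (sym (ℚₚ.∣-p∣≡∣p∣ (seq x m ℚ.- seq x n)))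
             (cong ℚ.∣_∣ (rearrange (seq x m) (seq x n))))
      (hx m n ≤m ≤n)
    where
    open +-*-Solver
    rearrange : ∀ a b → ℚ.- (a ℚ.- b) ≡ (ℚ.- a) ℚ.- (ℚ.- b)
    rearrange = solve 2 (λ a b → :- (a :- b) := (:- a) :- (:- b)) refl

  eventually-bounded : ∀ x → ∃ λ N → ∃ λ B → 0ℚ ℚ.< B ×
    (∀ n → N ℕ.≤ n → ℚ.∣ seq x n ∣ ℚ.≤ B)
  eventually-bounded x with cauchy x 1ℚ (ℚₚ.positive⁻¹ 1ℚ)
  ... | N , hx = N , 1ℚ ℚ.+ ℚ.∣ seq x N ∣ ,
      ℚₚ.+-mono-<-≤ (ℚₚ.positive⁻¹ 1ℚ) (ℚₚ.0≤∣p∣ (seq x N)) , λ n N≤n → begin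
        ℚ.∣ seq x n ∣
          ≡⟨ cong ℚ.∣_∣ (rearrange (seq x n) (seq x N)) ⟩
        ℚ.∣ (seq x n ℚ.- seq x N) ℚ.+ seq x N ∣
          ≤⟨ ℚₚ.∣p+q∣≤∣p∣+∣q∣ (seq x n ℚ.- seq x N) (seq x N) ⟩
        ℚ.∣ seq x n ℚ.- seq x N ∣ ℚ.+ ℚ.∣ seq x N ∣
          ≤⟨ ℚₚ.+-monoˡ-≤ ℚ.∣ seq x N ∣ (ℚₚ.<⇒≤ (hx n N N≤n ℕₚ.≤-refl)) ⟩
        1ℚ ℚ.+ ℚ.∣ seq x N ∣ ∎
    where
    open ℚₚ.≤-Reasoning
    open +-*-Solver
    rearrange : ∀ a b → a ≡ (a ℚ.- b) ℚ.+ b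
    rearrange = solve 2 (λ a b → a := (a :- b) :+ b) refl

  quotient : ∀ B ε → 0ℚ ℚ.< B → 0ℚ ℚ.< ε →
    ∃ λ δ → 0ℚ ℚ.< δ × B ℚ.* δ ≡ ε
  quotient B ε 0<B 0<ε = ε ℚ.* B⁻¹ , 0<δ , eq
    where
    instance
      B-pos : ℚ.Positive B
      B-pos = ℚ.positive 0<B
      B-nz : ℚ.NonZero B
      B-nz = ℚₚ.pos⇒nonZero B
    B⁻¹ = ℚ.1/ B
    0<δ : 0ℚ ℚ.< ε ℚ.* B⁻¹
    0<δ = subst (ℚ._< ε ℚ.* B⁻¹) (ℚₚ.*-zeroˡ B⁻¹)
            (ℚₚ.*-monoˡ-<-pos B⁻¹ {{ℚₚ.1/pos⇒pos B}} 0<ε)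
    eq : B ℚ.* (ε ℚ.* B⁻¹) ≡ ε
    eq = trans (cong (B ℚ.*_) (ℚₚ.*-comm ε B⁻¹))
         (trans (sym (ℚₚ.*-assoc B B⁻¹ ε))
         (trans (cong (ℚ._* ε) (ℚₚ.*-inverseʳ B)) (ℚₚ.*-identityˡ ε)))

  *-rearrange : ∀ a b c d →
    a ℚ.* b ℚ.- c ℚ.* d ≡ a ℚ.* (b ℚ.- d) ℚ.+ d ℚ.* (a ℚ.- c)
  *-rearrange = solve 4 (λ a b c d →
    a :* b :- c :* d := a :* (b :- d) :+ d :* (a :- c)) refl
    where open +-*-Solver

  *-close : ∀ {B C δ η ε} a b c d → 0ℚ ℚ.< B → 0ℚ ℚ.< C →
    B ℚ.* δ ≡ half ε → C ℚ.* η ≡ half ε →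
    ℚ.∣ a ∣ ℚ.≤ B → ℚ.∣ d ∣ ℚ.≤ C →
    ℚ.∣ b ℚ.- d ∣ ℚ.< δ → ℚ.∣ a ℚ.- c ∣ ℚ.< η →
    ℚ.∣ a ℚ.* b ℚ.- c ℚ.* d ∣ ℚ.< ε
  *-close {B} {C} {δ} {η} {ε} a b c d 0<B 0<C Bδ Cη a≤B d≤C hb ha = begin-strict
    ℚ.∣ a ℚ.* b ℚ.- c ℚ.* d ∣
      ≡⟨ cong ℚ.∣_∣ (*-rearrange a b c d) ⟩
    ℚ.∣ a ℚ.* (b ℚ.- d) ℚ.+ d ℚ.* (a ℚ.- c) ∣
      ≤⟨ ℚₚ.∣p+q∣≤∣p∣+∣q∣ (a ℚ.* (b ℚ.- d)) (d ℚ.* (a ℚ.- c)) ⟩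
    ℚ.∣ a ℚ.* (b ℚ.- d) ∣ ℚ.+ ℚ.∣ d ℚ.* (a ℚ.- c) ∣
      ≡⟨ cong₂ ℚ._+_ (ℚₚ.∣p*q∣≡∣p∣*∣q∣ a (b ℚ.- d)) (ℚₚ.∣p*q∣≡∣p∣*∣q∣ d (a ℚ.- c)) ⟩
    ℚ.∣ a ∣ ℚ.* ℚ.∣ b ℚ.- d ∣ ℚ.+ ℚ.∣ d ∣ ℚ.* ℚ.∣ a ℚ.- c ∣
      ≤⟨ ℚₚ.+-mono-≤
           (ℚₚ.*-monoʳ-≤-nonNeg ℚ.∣ b ℚ.- d ∣ {{ℚₚ.∣-∣-nonNeg (b ℚ.- d)}} a≤B)
           (ℚₚ.*-monoʳ-≤-nonNeg ℚ.∣ a ℚ.- c ∣ {{ℚₚ.∣-∣-nonNeg (a ℚ.- c)}} d≤C) ⟩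
    B ℚ.* ℚ.∣ b ℚ.- d ∣ ℚ.+ C ℚ.* ℚ.∣ a ℚ.- c ∣
      <⟨ ℚₚ.+-mono-<
           (ℚₚ.*-monoʳ-<-pos B {{ℚ.positive 0<B}} hb)
           (ℚₚ.*-monoʳ-<-pos C {{ℚ.positive 0<C}} ha) ⟩
    B ℚ.* δ ℚ.+ C ℚ.* η
      ≡⟨ cong₂ ℚ._+_ Bδ Cη ⟩
    half ε ℚ.+ half ε
      ≡⟨ half+half ε ⟩
    ε ∎
    where open ℚₚ.≤-Reasoning

  *-cauchy : ∀ x y → Cauchy (λ n → seq x n ℚ.* seq y n)
  *-cauchy x y ε 0<ε =
    let
      N₁ , B , 0<B , hB = eventually-bounded x
      N₂ , C , 0<C , hC = eventually-bounded y
      δ , 0<δ , Bδ = quotient B (half ε) 0<B (half-pos 0<ε)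
      η , 0<η , Cη = quotient C (half ε) 0<C (half-pos 0<ε)
      N₃ , hy = cauchy y δ 0<δ
      N₄ , hx = cauchy x η 0<η
    in (N₁ ℕ.⊔ N₂) ℕ.⊔ (N₃ ℕ.⊔ N₄) , λ m n ≤m ≤n →
      let
        l : ∀ {k} → _ → N₁ ℕ.⊔ N₂ ℕ.≤ k
        l = ℕₚ.m⊔n≤o⇒m≤o (N₁ ℕ.⊔ N₂) (N₃ ℕ.⊔ N₄)
        r : ∀ {k} → _ → N₃ ℕ.⊔ N₄ ℕ.≤ k
        r = ℕₚ.m⊔n≤o⇒n≤o (N₁ ℕ.⊔ N₂) (N₃ ℕ.⊔ N₄)
      in *-close (seq x m) (seq y m) (seq x n) (seq y n) 0<B 0<C Bδ Cη
           (hB m (ℕₚ.m⊔n≤o⇒m≤o N₁ N₂ (l ≤m)))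
           (hC n (ℕₚ.m⊔n≤o⇒n≤o N₁ N₂ (l ≤n)))
           (hy m n (ℕₚ.m⊔n≤o⇒m≤o N₃ N₄ (r ≤m)) (ℕₚ.m⊔n≤o⇒m≤o N₃ N₄ (r ≤n)))
           (hx m n (ℕₚ.m⊔n≤o⇒n≤o N₃ N₄ (r ≤m)) (ℕₚ.m⊔n≤o⇒n≤o N₃ N₄ (r ≤n)))

fromℚ : ℚ → ℝ
fromℚ q = mkℝ (λ _ → q) λ ε 0<ε → 0 , λ _ _ _ _ →
  subst (ℚ._< ε) (cong ℚ.∣_∣ (sym (ℚₚ.+-inverseʳ q))) 0<ε

fromℕ : ℕ → ℝ
fromℕ n = fromℚ (ℕ→ℚ n)

0ℝ 1ℝ : ℝ
0ℝ = fromℚ 0ℚ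
1ℝ = fromℚ 1ℚ

infix  8 -_
infixl 7 _*_
infixl 6 _+_
infixr 8 _^_

_+_ : ℝ → ℝ → ℝ
x + y = mkℝ (λ n → seq x n ℚ.+ seq y n) (+-cauchy x y)

-_ : ℝ → ℝ
- x = mkℝ (λ n → ℚ.- seq x n) (neg-cauchy x)

_*_ : ℝ → ℝ → ℝ
x * y = mkℝ (λ n → seq x n ℚ.* seq y n) (*-cauchy x y)

_^_ : ℝ → ℕ → ℝ
x ^ zero  = 1ℝ
x ^ suc n = x * x ^ n

∑ : ∀ {A : Set} → List A → (A → ℝ) → ℝ
∑ xs F = List.foldr (λ x s → F x + s) 0ℝ xs

⌊√_⌋ : ℕ → ℕ
⌊√ zero  ⌋ = zero
⌊√ suc n ⌋ with suc ⌊√ n ⌋ ℕ.* suc ⌊√ n ⌋ ℕₚ.≤? suc n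
... | yes _ = suc ⌊√ n ⌋
... | no  _ = ⌊√ n ⌋

⌊√⌋-lower : ∀ n → ⌊√ n ⌋ ℕ.* ⌊√ n ⌋ ℕ.≤ n
⌊√⌋-lower zero = ℕ.z≤n
⌊√⌋-lower (suc n) with suc ⌊√ n ⌋ ℕ.* suc ⌊√ n ⌋ ℕₚ.≤? suc n
... | yes le = le
... | no  _  = ℕₚ.m≤n⇒m≤1+n (⌊√⌋-lower n)

⌊√⌋-upper : ∀ n → n ℕ.< suc ⌊√ n ⌋ ℕ.* suc ⌊√ n ⌋
⌊√⌋-upper zero = ℕ.s≤s ℕ.z≤n
⌊√⌋-upper (suc n) with suc ⌊√ n ⌋ ℕ.* suc ⌊√ n ⌋ ℕₚ.≤? suc n
... | no  ≰ = ℕₚ.≰⇒> ≰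
... | yes _ = ℕₚ.≤-<-trans (⌊√⌋-upper n)
  (ℕₚ.*-mono-< (ℕₚ.n<1+n (suc ⌊√ n ⌋)) (ℕₚ.n<1+n (suc ⌊√ n ⌋)))

-- With M = m + 1, the m-th approximation is r / M for the greatest r with
-- (r / M)² ≤ q.  The sign of q is discarded, so √ q is √∣q∣ for negative q.
√-numerator : ℚ → ℕ → ℕ
√-numerator q m = ⌊√ ℤ.∣ ℚ.↥ q ∣ ℕ.* (suc m ℕ.* suc m) ℕ./ ℚ.↧ₙ q ⌋

√-approx : ℚ → ℕ → ℚ
√-approx q m = ℤ.+ √-numerator q m ℚ./ suc m

private
  *-square : ∀ a b → (a ℕ.* a) ℕ.* (b ℕ.* b) ≡ (a ℕ.* b) ℕ.* (a ℕ.* b)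
  *-square = solve-∀

  square-cancel-< : ∀ {a b} → a ℕ.* a ℕ.< b ℕ.* b → a ℕ.< b
  square-cancel-< {a} {b} lt =
    ℕₚ.≰⇒> λ b≤a → ℕₚ.<⇒≱ lt (ℕₚ.*-mono-≤ b≤a b≤a)

√-lower : ∀ q m → let r = √-numerator q m in
  r ℕ.* r ℕ.* ℚ.↧ₙ q ℕ.≤ ℤ.∣ ℚ.↥ q ∣ ℕ.* (suc m ℕ.* suc m)
√-lower q m =
  ℕₚ.≤-trans (ℕₚ.*-monoˡ-≤ (ℚ.↧ₙ q) (⌊√⌋-lower (a ℕ./ ℚ.↧ₙ q)))
    (ℕ.m/n*n≤m a (ℚ.↧ₙ q))
  where a = ℤ.∣ ℚ.↥ q ∣ ℕ.* (suc m ℕ.* suc m)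

√-upper : ∀ q m → let r = √-numerator q m in
  ℤ.∣ ℚ.↥ q ∣ ℕ.* (suc m ℕ.* suc m) ℕ.< suc r ℕ.* suc r ℕ.* ℚ.↧ₙ q
√-upper q m = begin-strict
  a                                 ≡⟨ ℕ.m≡m%n+[m/n]*n a b ⟩
  a ℕ.% b ℕ.+ a ℕ./ b ℕ.* b         <⟨ ℕₚ.+-monoˡ-< (a ℕ./ b ℕ.* b) (ℕ.m%n<n a b) ⟩
  suc (a ℕ./ b) ℕ.* b               ≤⟨ ℕₚ.*-monoˡ-≤ b (⌊√⌋-upper (a ℕ./ b)) ⟩
  suc ⌊√ a ℕ./ b ⌋ ℕ.* suc ⌊√ a ℕ./ b ⌋ ℕ.* b ∎
  where
  open ℕₚ.≤-Reasoning
  a = ℤ.∣ ℚ.↥ q ∣ ℕ.* (suc m ℕ.* suc m)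
  b = ℚ.↧ₙ q

private
  √-compare : ∀ q m n →
    √-approx q m ℚ.< √-approx q n ℚ.+ ℤ.+ 1 ℚ./ suc n
  √-compare q m n = subst (√-approx q m ℚ.<_) (/-split s n)
    (/-mono-< r (suc s) m n (square-cancel-< (ℕₚ.*-cancelʳ-< b _ _ bound)))
    where
    open ℕₚ.≤-Reasoning
    a = ℤ.∣ ℚ.↥ q ∣
    b = ℚ.↧ₙ q
    r = √-numerator q m
    s = √-numerator q n
    M = suc m
    N = suc n
    e₁ : ∀ r N b → r ℕ.* N ℕ.* (r ℕ.* N) ℕ.* b ≡ r ℕ.* r ℕ.* b ℕ.* (N ℕ.* N)
    e₁ = solve-∀
    e₂ : ∀ a M N → a ℕ.* (M ℕ.* M) ℕ.* (N ℕ.* N) ≡ a ℕ.* (N ℕ.* N) ℕ.* (M ℕ.* M)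
    e₂ = solve-∀
    bound : r ℕ.* N ℕ.* (r ℕ.* N) ℕ.* b ℕ.< suc s ℕ.* M ℕ.* (suc s ℕ.* M) ℕ.* b
    bound = begin-strict
      r ℕ.* N ℕ.* (r ℕ.* N) ℕ.* b           ≡⟨ e₁ r N b ⟩
      r ℕ.* r ℕ.* b ℕ.* (N ℕ.* N)           ≤⟨ ℕₚ.*-monoˡ-≤ (N ℕ.* N) (√-lower q m) ⟩
      a ℕ.* (M ℕ.* M) ℕ.* (N ℕ.* N)         ≡⟨ e₂ a M N ⟩
      a ℕ.* (N ℕ.* N) ℕ.* (M ℕ.* M)         <⟨ ℕₚ.*-monoˡ-< (M ℕ.* M) (√-upper q n) ⟩
      suc s ℕ.* suc s ℕ.* b ℕ.* (M ℕ.* M)   ≡⟨ e₁ (suc s) M b ⟨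
      suc s ℕ.* M ℕ.* (suc s ℕ.* M) ℕ.* b   ∎

  √-cauchy : ∀ q → Cauchy (√-approx q)
  √-cauchy q ε 0<ε with archimedean ε 0<ε
  ... | N , h = N , λ m n N≤m N≤n → abs-<
    (ℚₚ.<-trans (√-compare q m n) (ℚₚ.+-monoʳ-< (√-approx q n) (h n N≤n)))
    (ℚₚ.<-trans (√-compare q n m) (ℚₚ.+-monoʳ-< (√-approx q m) (h m N≤m)))

√ : ℚ → ℝ
√ q = mkℝ (√-approx q) (√-cauchy q)

allVec : ∀ {A : Set} → List A → ∀ n → List (Vec A n)
allVec xs zero    = [] ∷ []
allVec xs (suc n) = List.cartesianProductWith _∷_ xs (allVec xs n)

subsets : ∀ n → List (Subset n)
subsets = allVec (true ∷ false ∷ [])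

-- A multilinear polynomial in y₁,…,yₙ is given by its coefficients: f S is
-- the coefficient of ∏_{i∈S} yᵢ.
MultilinearPoly : ℕ → Set
MultilinearPoly n = Subset n → ℝ

DegreeAtMost : ∀ {n} → ℕ → MultilinearPoly n → Set
DegreeAtMost d f = ∀ S → d ℕ.< ∣ S ∣ → f S ≃ 0ℝ

monomial : ∀ {n} → Subset n → Vec ℝ n → ℝ
monomial []          []       = 1ℝ
monomial (true  ∷ S) (y ∷ ys) = y * monomial S ys
monomial (false ∷ S) (y ∷ ys) = monomial S ys

eval : ∀ {n} → MultilinearPoly n → Vec ℝ n → ℝ
eval {n} f ys = ∑ (subsets n) λ S → f S * monomial S ys

Cube : ℕ → Set
Cube = Vec Sign

±1 : Sign → ℚ
±1 Sign.+ = 1ℚ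
±1 Sign.- = ℚ.- 1ℚ

cube : ∀ n → List (Cube n)
cube = allVec (Sign.+ ∷ Sign.- ∷ [])

coordinateSum : ∀ {n} → Cube n → ℚ
coordinateSum x = Vec.foldr _ (λ s t → ±1 s ℚ.+ t) 0ℚ x

slice : ℚ → ∀ n → List (Cube n)
slice p n = List.filter
  (λ x → coordinateSum x ℚₚ.≟ (1ℚ ℚ.- ℕ→ℚ 2 ℚ.* p) ℚ.* ℕ→ℚ n) (cube n)

-- The value on [] is a convention; slice p n is nonempty whenever 0 < p < 1
-- and p n is an integer.
mean : ∀ {A : Set} → List A → (A → ℝ) → ℝ
mean []         F = 0ℝ
mean xs@(_ ∷ _) F = fromℚ (ℤ.+ 1 ℚ./ List.length xs) * ∑ xs F

𝔼 : (p : ℚ) (n : ℕ) → (Cube n → ℝ) → ℝ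
𝔼 p n = mean (slice p n)

IsInteger : ℚ → Set
IsInteger q = ∃ λ (k : ℤ) → q ≡ k ℚ./ 1

-- The bias p is rational: this is no restriction, since p n is required to be
-- an integer.
module Bias (p : ℚ) (0<p : 0ℚ ℚ.< p) (p<1 : p ℚ.< 1ℚ) where

  p/[1-p] : ℚ
  p/[1-p] = (p ℚ.÷ (1ℚ ℚ.- p)) {{ℚ.>-nonZero (p<1⇒0<1-p p<1)}}

  [1-p]/p : ℚ
  [1-p]/p = ((1ℚ ℚ.- p) ℚ.÷ p) {{ℚ.>-nonZero 0<p}}

  φ : Sign → ℝ
  φ Sign.+ = √ p/[1-p]
  φ Sign.- = - √ [1-p]/p

  -- √ (d ^ 3) is d^{3/2}.
  K : ℕ → ℝ
  K d = fromℕ 12 * √ (ℕ→ℚ (d ℕ.^ 3))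
      * (fromℕ 256 * (fromℚ [1-p]/p ^ 2 + fromℚ p/[1-p] ^ 2) ^ 2) ^ d

-- The coefficients above degree d, which are only ≃ 0, are replaced by 0. After that the inequality
-- holds termwise: the t-th approximations of both sides are rational numbers, and f becomes a
-- function of degree at most d on the slice of the x with k = p n coordinates −1.
--
-- Let (U f)(x) be the sum of f over the points obtained from x by turning a −1 into +1, and
-- (D f)(x) the sum over the points obtained by turning a +1 into −1. Then U and D are adjoint,
-- DU − UD is the scalar n − 2k on the slice k, and the functions of degree at most d on the slice k
-- are the U^(k − d) c. Write c = c′ + U b with D c′ = 0. Then U^(k − d) c = g + h, where
-- g = U^(k − d) c′ is an eigenvector of UD orthogonal to h = U^(k − d + 1) b, of degree d − 1.
--
-- UD is, up to scalars, the generator of the transposition walk, so the eigenvalue equation gives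
-- E g⁴ as the energy of g and g³. As (a − b)(a³ − b³) ≤ 3/2 (a − b)² (a² + b²), the Cauchy–Schwarz
-- inequality bounds it by the fourth moments of the differences Δ g over transposed pairs of
-- coordinates. Since Δ U = U Δ, these have degree d − 1 on a slice of dimension n − 2, and
-- induction on d applies to them and to h. This yields the constant (256 n² / (k (n − k)))^d, and
-- n² / (k (n − k)) = 1 / (p (1 − p)) ≤ (r² + r⁻²)² for r = (1 − p)/p. The factor 12 d^(3/2) ≥ 1 is
-- only slack. When d ≥ min(k, n − k), the size of the slice is itself at most the constant, and
-- E f⁴ ≤ size · (E f²)² suffices.

module Submission where

open import Data.Bool.Base using (true; false; if_then_else_)
open import Data.Fin.Base as Fin using (Fin)
open import Data.Fin.Subset using (Subset; ∣_∣)
open import Data.Integer.Base as ℤ using (ℤ)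
import Data.Integer.Properties as ℤₚ
open import Data.List.Base as List using (List; []; _∷_; _++_)
import Data.List.Properties as Listₚ
open import Data.Nat.Base as ℕ using (ℕ; zero; suc; _≡ᵇ_)
import Data.Nat.Properties as ℕₚ
open import Data.Product.Base using (∃; _×_; _,_; proj₁; proj₂)
open import Data.Rational.Base as ℚ using (ℚ; 0ℚ; 1ℚ)
import Data.Rational.Properties as ℚₚ
import Data.Rational.Unnormalised.Base as ℚᵘ
import Data.Rational.Unnormalised.Properties as ℚᵘₚ
open import Data.Sign.Base as Sign using (Sign)
open import Data.Sum.Base using (_⊎_; inj₁; inj₂)
open import Data.Vec.Base as Vec using (Vec; []; _∷_; insertAt)
open import Function.Base using (_∘_)
open import Relation.Binary.Definitions using (tri<; tri≈; tri>)
open import Relation.Binary.PropositionalEquality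
open import Relation.Nullary.Decidable using (yes; no; dec⇒maybe)
open import Relation.Nullary.Negation.Core using (contradiction)
open import Relation.Unary using (Decidable)
open import Tactic.RingSolver using (solve-∀)
open import Tactic.RingSolver.Core.AlmostCommutativeRing using (AlmostCommutativeRing; fromCommutativeRing)

ℚ-ring : AlmostCommutativeRing _ _
ℚ-ring = fromCommutativeRing ℚₚ.+-*-commutativeRing (λ x → dec⇒maybe (0ℚ ℚₚ.≟ x))

module Rational where

  open import Data.Rational.Base using (_+_; _*_; -_; _-_; _≤_; _<_)
  open import Defs using (ℕ→ℚ; Cube; cube; subsets; coordinateSum; slice; IsInteger; √-numerator; √-upper;
    √-approx)

  -- Ordered field arithmetic

  ≤-by : ∀ {a b} e → 0ℚ ≤ e → b ≡ a + e → a ≤ b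
  ≤-by {a} {b} e 0≤e eq =
    subst₂ _≤_ (ℚₚ.+-identityʳ a) (sym eq) (ℚₚ.+-monoʳ-≤ a 0≤e)

  ≤⇒0≤- : ∀ {a b} → a ≤ b → 0ℚ ≤ b - a
  ≤⇒0≤- {a} {b} a≤b = subst (_≤ b - a) (ℚₚ.+-inverseʳ a) (ℚₚ.+-monoˡ-≤ (- a) a≤b)

  *-monoˡ : ∀ {a b} c → 0ℚ ≤ c → a ≤ b → c * a ≤ c * b
  *-monoˡ c 0≤c a≤b = ℚₚ.*-monoˡ-≤-nonNeg c {{ℚ.nonNegative 0≤c}} a≤b

  *-monoʳ : ∀ {a b} c → 0ℚ ≤ c → a ≤ b → a * c ≤ b * c
  *-monoʳ c 0≤c a≤b = ℚₚ.*-monoʳ-≤-nonNeg c {{ℚ.nonNegative 0≤c}} a≤b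

  *-nonneg : ∀ {a b} → 0ℚ ≤ a → 0ℚ ≤ b → 0ℚ ≤ a * b
  *-nonneg {a} {b} 0≤a 0≤b = subst (_≤ a * b) (ℚₚ.*-zeroʳ a) (*-monoˡ a 0≤a 0≤b)

  *-mono : ∀ {a b c d} → 0ℚ ≤ a → 0ℚ ≤ d → a ≤ b → c ≤ d → a * c ≤ b * d
  *-mono {a} {d = d} 0≤a 0≤d a≤b c≤d = ℚₚ.≤-trans (*-monoˡ a 0≤a c≤d) (*-monoʳ d 0≤d a≤b)

  *-pos : ∀ {a b} → 0ℚ < a → 0ℚ < b → 0ℚ < a * b
  *-pos {a} {b} 0<a 0<b =
    ℚₚ.positive⁻¹ (a * b) {{ℚₚ.pos*pos⇒pos a {{ℚ.positive 0<a}} b {{ℚ.positive 0<b}}}}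

  +-nonneg : ∀ {a b} → 0ℚ ≤ a → 0ℚ ≤ b → 0ℚ ≤ a + b
  +-nonneg = ℚₚ.+-mono-≤

  *-cancelˡ : ∀ {a b} c → 0ℚ < c → c * a ≤ c * b → a ≤ b
  *-cancelˡ c 0<c = ℚₚ.*-cancelˡ-≤-pos c {{ℚ.positive 0<c}}

  sq-nonneg : ∀ a → 0ℚ ≤ a * a
  sq-nonneg a with ℚₚ.≤-total 0ℚ a
  ... | inj₁ 0≤a = *-nonneg 0≤a 0≤a
  ... | inj₂ a≤0 = subst (0ℚ ≤_) (neg² a) (*-nonneg 0≤-a 0≤-a)
    where
    0≤-a : 0ℚ ≤ - a
    0≤-a = ℚₚ.neg-antimono-≤ a≤0
    neg² : ∀ x → (- x) * (- x) ≡ x * x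
    neg² = solve-∀ ℚ-ring

  sq-cancel-≤ : ∀ {a b} → 0ℚ ≤ b → a * a ≤ b * b → a ≤ b
  sq-cancel-≤ {a} {b} 0≤b a²≤b² = ℚₚ.≮⇒≥ λ b<a →
    ℚₚ.<-irrefl refl (ℚₚ.<-≤-trans (ℚₚ.≤-<-trans (*-monoˡ b 0≤b (ℚₚ.<⇒≤ b<a))
             (ℚₚ.*-monoˡ-<-pos a {{ℚ.positive (ℚₚ.≤-<-trans 0≤b b<a)}} b<a)) a²≤b²)

  inverse : ∀ {t} → 0ℚ < t → ∃ λ s → t * s ≡ 1ℚ
  inverse {t} 0<t = (ℚ.1/ t) {{nz}} , ℚₚ.*-inverseʳ t {{nz}}
    where nz = ℚ.>-nonZero 0<t

  inverse-pos : ∀ {t s} → 0ℚ < t → t * s ≡ 1ℚ → 0ℚ < s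
  inverse-pos {t} {s} 0<t ts≡1 = ℚₚ.*-cancelˡ-<-nonNeg t {{ℚ.nonNegative (ℚₚ.<⇒≤ 0<t)}}
    (subst₂ _<_ (sym (ℚₚ.*-zeroʳ t)) (sym ts≡1) (ℚₚ.positive⁻¹ 1ℚ))

  0<1ℚ : 0ℚ < 1ℚ
  0<1ℚ = ℚₚ.positive⁻¹ 1ℚ

  -- Unlike ℕ→ℚ, whose gcd computation unfolds on open terms, ι reduces one successor at a time.
  ι : ℕ → ℚ
  ι zero    = 0ℚ
  ι (suc n) = 1ℚ + ι n

  ι-+ : ∀ m n → ι (m ℕ.+ n) ≡ ι m + ι n
  ι-+ zero    n = sym (ℚₚ.+-identityˡ (ι n))
  ι-+ (suc m) n = trans (cong (1ℚ +_) (ι-+ m n)) (sym (ℚₚ.+-assoc 1ℚ (ι m) (ι n)))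

  ι-nonneg : ∀ n → 0ℚ ≤ ι n
  ι-nonneg zero    = ℚₚ.≤-refl
  ι-nonneg (suc n) = +-nonneg (ℚₚ.<⇒≤ 0<1ℚ) (ι-nonneg n)

  ι-pos : ∀ n → 0ℚ < ι (suc n)
  ι-pos n = ℚₚ.+-mono-<-≤ 0<1ℚ (ι-nonneg n)

  ι-mono : ∀ {m n} → m ℕ.≤ n → ι m ≤ ι n
  ι-mono {n = n} ℕ.z≤n = ι-nonneg n
  ι-mono (ℕ.s≤s m≤n) = ℚₚ.+-monoʳ-≤ 1ℚ (ι-mono m≤n)

  -- Finite sums

  ∑ : ∀ {A : Set} → List A → (A → ℚ) → ℚ
  ∑ []       F = 0ℚ
  ∑ (x ∷ xs) F = F x + ∑ xs F

  ∑-cong : ∀ {A : Set} (xs : List A) {F G} → (∀ x → F x ≡ G x) → ∑ xs F ≡ ∑ xs G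
  ∑-cong []       F≡G = refl
  ∑-cong (x ∷ xs) F≡G = cong₂ _+_ (F≡G x) (∑-cong xs F≡G)

  ∑-mono : ∀ {A : Set} (xs : List A) {F G} → (∀ x → F x ≤ G x) → ∑ xs F ≤ ∑ xs G
  ∑-mono []       F≤G = ℚₚ.≤-refl
  ∑-mono (x ∷ xs) F≤G = ℚₚ.+-mono-≤ (F≤G x) (∑-mono xs F≤G)

  ∑-nonneg : ∀ {A : Set} (xs : List A) {F} → (∀ x → 0ℚ ≤ F x) → 0ℚ ≤ ∑ xs F
  ∑-nonneg []       0≤F = ℚₚ.≤-refl
  ∑-nonneg (x ∷ xs) 0≤F = +-nonneg (0≤F x) (∑-nonneg xs 0≤F)

  ∑-+ : ∀ {A : Set} (xs : List A) F G → ∑ xs (λ x → F x + G x) ≡ ∑ xs F + ∑ xs G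
  ∑-+ []       F G = refl
  ∑-+ (x ∷ xs) F G = trans (cong ((F x + G x) +_) (∑-+ xs F G))
    (interchange (F x) (G x) (∑ xs F) (∑ xs G))
    where
    interchange : ∀ a b c d → (a + b) + (c + d) ≡ (a + c) + (b + d)
    interchange = solve-∀ ℚ-ring

  ∑-*ˡ : ∀ {A : Set} (xs : List A) c F → ∑ xs (λ x → c * F x) ≡ c * ∑ xs F
  ∑-*ˡ []       c F = sym (ℚₚ.*-zeroʳ c)
  ∑-*ˡ (x ∷ xs) c F = trans (cong (c * F x +_) (∑-*ˡ xs c F)) (sym (ℚₚ.*-distribˡ-+ c (F x) (∑ xs F)))

  ∑-++ : ∀ {A : Set} (xs ys : List A) F → ∑ (xs ++ ys) F ≡ ∑ xs F + ∑ ys F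
  ∑-++ []       ys F = sym (ℚₚ.+-identityˡ _)
  ∑-++ (x ∷ xs) ys F = trans (cong (F x +_) (∑-++ xs ys F)) (sym (ℚₚ.+-assoc (F x) _ _))

  ∑-map : ∀ {A B : Set} (g : A → B) (xs : List A) F → ∑ (List.map g xs) F ≡ ∑ xs (F ∘ g)
  ∑-map g []       F = refl
  ∑-map g (x ∷ xs) F = cong (F (g x) +_) (∑-map g xs F)

  cauchy-schwarz : ∀ {A : Set} (xs : List A) (u v : A → ℚ) →
    ∑ xs (λ x → u x * v x) * ∑ xs (λ x → u x * v x) ≤
    ∑ xs (λ x → u x * u x) * ∑ xs (λ x → v x * v x)
  cauchy-schwarz []       u v = ℚₚ.≤-refl
  cauchy-schwarz (x ∷ xs) u v = ≤-by _
    (+-nonneg (≤⇒0≤- (cauchy-schwarz xs u v)) (≤⇒0≤- cross))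
    (expand (u x) (v x) P A B)
    where
    P = ∑ xs (λ x → u x * v x)
    A = ∑ xs (λ x → u x * u x)
    B = ∑ xs (λ x → v x * v x)
    0≤A : 0ℚ ≤ A
    0≤A = ∑-nonneg xs (λ x → sq-nonneg (u x))
    0≤B : 0ℚ ≤ B
    0≤B = ∑-nonneg xs (λ x → sq-nonneg (v x))
    expand : ∀ a b P A B → (a * a + A) * (b * b + B) ≡
      (a * b + P) * (a * b + P) + ((A * B - P * P) + ((a * a * B + b * b * A) - (a * b * P + a * b * P)))
    expand = solve-∀ ℚ-ring
    discriminant : ∀ a b P A B → (a * a * B + b * b * A) * (a * a * B + b * b * A) ≡
      (a * b * P + a * b * P) * (a * b * P + a * b * P) +
      ((a * a * B - b * b * A) * (a * a * B - b * b * A) + ι 4 * ((a * b) * (a * b)) * (A * B - P * P))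
    discriminant = solve-∀ ℚ-ring
    -- The arithmetic-geometric mean inequality without roots: by `discriminant` the squares of the
    -- two sides differ by a square plus 4 (u v)² (A B - P²), and the last factor is nonnegative by
    -- induction.
    cross : u x * v x * P + u x * v x * P ≤ u x * u x * B + v x * v x * A
    cross = sq-cancel-≤ (+-nonneg (*-nonneg (sq-nonneg (u x)) 0≤B) (*-nonneg (sq-nonneg (v x)) 0≤A))
      (≤-by _ (+-nonneg (sq-nonneg (u x * u x * B - v x * v x * A))
                (*-nonneg (*-nonneg (ι-nonneg 4) (sq-nonneg (u x * v x))) (≤⇒0≤- (cauchy-schwarz xs u v))))
        (discriminant (u x) (v x) P A B))

  -- The square-root-free form of: T ≤ √c E termwise implies ∑ T ≤ √c ∑ E.
  ∑-square-≤ : ∀ {A : Set} (xs : List A) (w c : ℚ) (T E : A → ℚ) → 0ℚ ≤ w → 0ℚ ≤ c → (∀ x → 0ℚ ≤ T x) →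
      (∀ x → 0ℚ ≤ E x) →
    (∀ x → w * (T x * T x) ≤ c * (E x * E x)) → w * (∑ xs T * ∑ xs T) ≤ c * (∑ xs E * ∑ xs E)
  ∑-square-≤ []       w c T E 0≤w 0≤c 0≤T 0≤E T≤E = ℚₚ.≤-reflexive (trans (ℚₚ.*-zeroʳ w) (sym (ℚₚ.*-zeroʳ c)))
  ∑-square-≤ (x ∷ xs) w c T E 0≤w 0≤c 0≤T 0≤E T≤E =
    subst₂ _≤_ (square w (T x) (∑ xs T)) (square c (E x) (∑ xs E))
      (ℚₚ.+-mono-≤ (T≤E x) (ℚₚ.+-mono-≤ IH (ℚₚ.+-mono-≤ cross cross)))
    where
    IH = ∑-square-≤ xs w c T E 0≤w 0≤c 0≤T 0≤E T≤E
    square : ∀ w t s → w * (t * t) + (w * (s * s) + (w * (t * s) + w * (t * s))) ≡ w * ((t + s) * (t + s))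
    square = solve-∀ ℚ-ring
    product : ∀ w t s → (w * (t * t)) * (w * (s * s)) ≡ w * (t * s) * (w * (t * s))
    product = solve-∀ ℚ-ring
    -- The product of the inequality at x and the inequality for the tail is the square of this one.
    cross : w * (T x * ∑ xs T) ≤ c * (E x * ∑ xs E)
    cross = sq-cancel-≤ (*-nonneg 0≤c (*-nonneg (0≤E x) (∑-nonneg xs 0≤E)))
      (subst₂ _≤_ (product w (T x) (∑ xs T)) (product c (E x) (∑ xs E))
        (*-mono (*-nonneg 0≤w (sq-nonneg (T x))) (*-nonneg 0≤c (sq-nonneg (∑ xs E))) (T≤E x) IH))

  infixr 5 +∷_ -∷_
  pattern +∷_ x = Sign.+ ∷ x
  pattern -∷_ x = Sign.- ∷ x

  -- Sums over the cube are only split by ∑-cube; otherwise they would unfold whenever the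
  -- dimension is a successor, which defeats unification.
  abstract

    points : ∀ n → List (Cube n)
    points = cube

    points≡cube : ∀ n → points n ≡ cube n
    points≡cube n = refl

    ∑-cube₀ : ∀ F → ∑ (points 0) F ≡ F [] + 0ℚ
    ∑-cube₀ F = refl

    ∑-cube : ∀ n F → ∑ (points (suc n)) F ≡ ∑ (points n) (λ x → F (+∷ x)) + ∑ (points n) (λ x → F (-∷ x))
    ∑-cube n F = trans (∑-++ (List.map (Sign.+ ∷_) (cube n)) _ F)
      (cong₂ _+_ (∑-map (Sign.+ ∷_) (cube n) F)
        (trans (cong (λ xs → ∑ xs F) (Listₚ.++-identityʳ (List.map (Sign.- ∷_) (cube n))))
          (∑-map (Sign.- ∷_) (cube n) F)))

  -- Sums over one level of the cube

  minuses : ∀ {n} → Cube n → ℕ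
  minuses []       = 0
  minuses (+∷ x) = minuses x
  minuses (-∷ x) = suc (minuses x)

  δ : ℕ → ℕ → ℚ
  δ a b = if a ≡ᵇ b then 1ℚ else 0ℚ

  δ-nonneg : ∀ a b → 0ℚ ≤ δ a b
  δ-nonneg a b with a ≡ᵇ b
  ... | true  = ℚₚ.<⇒≤ 0<1ℚ
  ... | false = ℚₚ.≤-refl

  δ-cong : ∀ a b {x y} → (a ≡ b → x ≡ y) → δ a b * x ≡ δ a b * y
  δ-cong a b {x} {y} h with a ≡ᵇ b | ℕₚ.≡ᵇ⇒≡ a b
  ... | true  | e = cong (1ℚ *_) (h (e _))
  ... | false | _ = trans (ℚₚ.*-zeroˡ x) (sym (ℚₚ.*-zeroˡ y))

  δ-idem : ∀ a b → δ a b * δ a b ≡ δ a b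
  δ-idem a b with a ≡ᵇ b
  ... | true  = refl
  ... | false = refl

  -- The level is selected by a weight on the whole cube rather than by a filter, so that sums can
  -- be split at any coordinate without regard to the level. There is no normalisation.
  S : ∀ {n} → ℕ → (Cube n → ℚ) → ℚ
  S {n} k F = ∑ (points n) (λ x → δ (minuses x) k * F x)

  infix 4 _≈[_]_
  -- Functions are total on the cube, but harmonicity, eigenvalue equations and degree are
  -- statements about a single level.
  _≈[_]_ : ∀ {n} → (Cube n → ℚ) → ℕ → (Cube n → ℚ) → Set
  f ≈[ k ] g = ∀ x → minuses x ≡ k → f x ≡ g x

  module _ {n : ℕ} (k : ℕ) where

    S-cong : {F G : Cube n → ℚ} → F ≈[ k ] G → S k F ≡ S k G
    S-cong F≈G = ∑-cong (points n) (λ x → δ-cong (minuses x) k (F≈G x))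

    S-mono : {F G : Cube n → ℚ} → (∀ x → F x ≤ G x) → S k F ≤ S k G
    S-mono F≤G = ∑-mono (points n) (λ x → *-monoˡ _ (δ-nonneg (minuses x) k) (F≤G x))

    S-nonneg : {F : Cube n → ℚ} → (∀ x → 0ℚ ≤ F x) → 0ℚ ≤ S k F
    S-nonneg 0≤F = ∑-nonneg (points n) (λ x → *-nonneg (δ-nonneg (minuses x) k) (0≤F x))

    S-+ : (F G : Cube n → ℚ) → S k (λ x → F x + G x) ≡ S k F + S k G
    S-+ F G = trans (∑-cong (points n) (λ x → ℚₚ.*-distribˡ-+ (δ (minuses x) k) (F x) (G x)))
      (∑-+ (points n) _ _)

    S-*ˡ : ∀ c (F : Cube n → ℚ) → S k (λ x → c * F x) ≡ c * S k F
    S-*ˡ c F = trans (∑-cong (points n) (λ x → swap (δ (minuses x) k) c (F x))) (∑-*ˡ (points n) c _)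
      where
      swap : ∀ a b c → a * (b * c) ≡ b * (a * c)
      swap = solve-∀ ℚ-ring

    S-cauchy-schwarz : (u v : Cube n → ℚ) →
      S k (λ x → u x * v x) * S k (λ x → u x * v x) ≤ S k (λ x → u x * u x) * S k (λ x → v x * v x)
    S-cauchy-schwarz u v = subst₂ _≤_
        (cong₂ _*_ (absorb u v) (absorb u v)) (cong₂ _*_ (absorb u u) (absorb v v))
        (cauchy-schwarz (points n) (λ x → δ (minuses x) k * u x) (λ x → δ (minuses x) k * v x))
      where
      regroup : ∀ d u v → (d * u) * (d * v) ≡ (d * d) * (u * v)
      regroup = solve-∀ ℚ-ring
      absorb : ∀ u v → ∑ (points n) (λ x → (δ (minuses x) k * u x) * (δ (minuses x) k * v x)) ≡ S k (λ x →
          u x * v x)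
      absorb u v = ∑-cong (points n) λ x → trans (regroup (δ (minuses x) k) (u x) (v x))
        (cong (_* (u x * v x)) (δ-idem (minuses x) k))

  -- The raising and lowering operators

  U D : ∀ {n} → (Cube n → ℚ) → Cube n → ℚ
  U f []       = 0ℚ
  U f (+∷ x) = U (λ y → f (+∷ y)) x
  U f (-∷ x) = f (+∷ x) + U (λ y → f (-∷ y)) x
  D f []       = 0ℚ
  D f (+∷ x) = f (-∷ x) + D (λ y → f (+∷ y)) x
  D f (-∷ x) = D (λ y → f (-∷ y)) x

  U^ : ∀ {n} → ℕ → (Cube n → ℚ) → Cube n → ℚ
  U^ zero    f = f
  U^ (suc j) f = U (U^ j f)

  U-cong : ∀ {n} {f g : Cube n → ℚ} → (∀ x → f x ≡ g x) → ∀ x → U f x ≡ U g x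
  U-cong f≡g []       = refl
  U-cong f≡g (+∷ x) = U-cong (λ y → f≡g (+∷ y)) x
  U-cong f≡g (-∷ x) = cong₂ _+_ (f≡g (+∷ x)) (U-cong (λ y → f≡g (-∷ y)) x)

  U-none : ∀ {n} {f : Cube n → ℚ} (x : Cube n) → minuses x ≡ 0 → U f x ≡ 0ℚ
  U-none []       e = refl
  U-none (+∷ x) e = U-none x e

  -- The points at which `U f x` evaluates f have one -1 fewer than x.
  U-level : ∀ {n} k {f g : Cube n → ℚ} → f ≈[ k ] g → U f ≈[ suc k ] U g
  U-level k f≈g []       ()
  U-level k f≈g (+∷ x) e = U-level k (λ y → f≈g (+∷ y)) x e
  -- The head is the only -1, so the sums over the tail are empty and no level below 0 is consulted.
  U-level zero f≈g (-∷ x) e = cong₂ _+_ (f≈g (+∷ x) (ℕₚ.suc-injective e))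
    (trans (U-none x (ℕₚ.suc-injective e)) (sym (U-none x (ℕₚ.suc-injective e))))
  U-level (suc k) f≈g (-∷ x) e = cong₂ _+_ (f≈g (+∷ x) (ℕₚ.suc-injective e))
    (U-level k (λ y e → f≈g (-∷ y) (cong suc e)) x (ℕₚ.suc-injective e))

  D-cong : ∀ {n} {f g : Cube n → ℚ} → (∀ x → f x ≡ g x) → ∀ x → D f x ≡ D g x
  D-cong f≡g []       = refl
  D-cong f≡g (+∷ x) = cong₂ _+_ (f≡g (-∷ x)) (D-cong (λ y → f≡g (+∷ y)) x)
  D-cong f≡g (-∷ x) = D-cong (λ y → f≡g (-∷ y)) x

  U-linear : ∀ {n} a b (f g : Cube n → ℚ) x → U (λ y → a * f y + b * g y) x ≡ a * U f x + b * U g x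
  U-linear a b f g []       = sym (zero-linear a b)
    where
    zero-linear : ∀ a b → a * 0ℚ + b * 0ℚ ≡ 0ℚ
    zero-linear = solve-∀ ℚ-ring
  U-linear a b f g (+∷ x) = U-linear a b _ _ x
  U-linear a b f g (-∷ x) = trans (cong (a * f (+∷ x) + b * g (+∷ x) +_) (U-linear a b _ _ x))
    (regroup a b (f (+∷ x)) (g (+∷ x)) _ _)
    where
    regroup : ∀ a b s t u v → (a * s + b * t) + (a * u + b * v) ≡ a * (s + u) + b * (t + v)
    regroup = solve-∀ ℚ-ring

  D-linear : ∀ {n} a b (f g : Cube n → ℚ) x → D (λ y → a * f y + b * g y) x ≡ a * D f x + b * D g x
  D-linear a b f g []       = sym (zero-linear a b)
    where
    zero-linear : ∀ a b → a * 0ℚ + b * 0ℚ ≡ 0ℚ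
    zero-linear = solve-∀ ℚ-ring
  D-linear a b f g (-∷ x) = D-linear a b _ _ x
  D-linear a b f g (+∷ x) = trans (cong (a * f (-∷ x) + b * g (-∷ x) +_) (D-linear a b _ _ x))
    (regroup a b (f (-∷ x)) (g (-∷ x)) _ _)
    where
    regroup : ∀ a b s t u v → (a * s + b * t) + (a * u + b * v) ≡ a * (s + u) + b * (t + v)
    regroup = solve-∀ ℚ-ring

  U-*ˡ : ∀ {n} a (f : Cube n → ℚ) x → U (λ y → a * f y) x ≡ a * U f x
  U-*ˡ a f []       = sym (ℚₚ.*-zeroʳ a)
  U-*ˡ a f (+∷ x) = U-*ˡ a _ x
  U-*ˡ a f (-∷ x) = trans (cong (a * f (+∷ x) +_) (U-*ˡ a _ x)) (sym (ℚₚ.*-distribˡ-+ a _ _))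

  U^-linear : ∀ {n} j a b (f g : Cube n → ℚ) x → U^ j (λ y → a * f y + b * g y) x ≡ a * U^ j f x + b * U^ j g x
  U^-linear zero    a b f g x = refl
  U^-linear (suc j) a b f g x = trans (U-cong (U^-linear j a b f g) x) (U-linear a b (U^ j f) (U^ j g) x)

  U^-U : ∀ {n} j (f : Cube n → ℚ) x → U^ j (U f) x ≡ U^ (suc j) f x
  U^-U zero    f x = refl
  U^-U (suc j) f x = U-cong (U^-U j f) x

  -- All points that `D` reaches from x lie one level above x, so a weight depending on the level is
  -- constant along the sum.
  D-weight : ∀ {n} (ω : ℕ → ℚ) (f : Cube n → ℚ) x →
    D (λ y → ω (minuses y) * f y) x ≡ ω (suc (minuses x)) * D f x
  D-weight ω f []       = sym (ℚₚ.*-zeroʳ (ω 1))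
  D-weight ω f (-∷ x) = D-weight (ω ∘ suc) _ x
  D-weight ω f (+∷ x) = trans (cong (ω (suc (minuses x)) * f (-∷ x) +_) (D-weight ω _ x))
    (sym (ℚₚ.*-distribˡ-+ (ω (suc (minuses x))) _ _))

  -- Moves at distinct coordinates commute and cancel in the difference. A move undone at its own
  -- coordinate gives back f x, once for each +1 of x in `D U` and once for each -1 in `U D`.
  DU : ∀ {n} (f : Cube n → ℚ) x → D (U f) x ≡ U (D f) x + (ι n - (ι (minuses x) + ι (minuses x))) * f x
  DU f []       = sym (base (f []))
    where
    base : ∀ a → 0ℚ + (0ℚ - (0ℚ + 0ℚ)) * a ≡ 0ℚ
    base = solve-∀ ℚ-ring
  DU {suc n} f (+∷ x) = begin
    (f (+∷ x) + U f- x) + D (U f+) x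
      ≡⟨ cong ((f (+∷ x) + U f- x) +_) (DU f+ x) ⟩
    (f (+∷ x) + U f- x) + (U (D f+) x + (ι n - (ι c + ι c)) * f (+∷ x))
      ≡⟨ regroup (f (+∷ x)) (U f- x) (U (D f+) x) (ι n) (ι c) ⟩
    (1ℚ * U f- x + 1ℚ * U (D f+) x) + (ι (suc n) - (ι c + ι c)) * f (+∷ x)
      ≡⟨ cong (_+ (ι (suc n) - (ι c + ι c)) * f (+∷ x))
           (trans (U-cong (λ y → sym (1-1 (f- y) (D f+ y))) x) (U-linear 1ℚ 1ℚ f- (D f+) x)) ⟨
    U (D f ∘ (Sign.+ ∷_)) x + (ι (suc n) - (ι c + ι c)) * f (+∷ x) ∎
    where
    open ≡-Reasoning
    f+ f- : Cube n → ℚ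
    f+ y = f (+∷ y)
    f- y = f (-∷ y)
    c = minuses x
    1-1 : ∀ a b → 1ℚ * a + 1ℚ * b ≡ a + b
    1-1 = solve-∀ ℚ-ring
    regroup : ∀ a b d n c → (a + b) + (d + (n - (c + c)) * a) ≡ (1ℚ * b + 1ℚ * d) + ((1ℚ + n) - (c + c)) * a
    regroup = solve-∀ ℚ-ring
  DU {suc n} f (-∷ x) = begin
    D (λ y → f+ y + U f- y) x
      ≡⟨ trans (D-cong (λ y → sym (1-1 (f+ y) (U f- y))) x) (D-linear 1ℚ 1ℚ f+ (U f-) x) ⟩
    1ℚ * D f+ x + 1ℚ * D (U f-) x
      ≡⟨ cong (λ t → 1ℚ * D f+ x + 1ℚ * t) (DU f- x) ⟩
    1ℚ * D f+ x + 1ℚ * (U (D f-) x + (ι n - (ι c + ι c)) * f (-∷ x))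
      ≡⟨ regroup (f (-∷ x)) (D f+ x) (U (D f-) x) (ι n) (ι c) ⟩
    ((f (-∷ x) + D f+ x) + U (D f-) x) + (ι (suc n) - (ι (suc c) + ι (suc c))) * f (-∷ x) ∎
    where
    open ≡-Reasoning
    f+ f- : Cube n → ℚ
    f+ y = f (+∷ y)
    f- y = f (-∷ y)
    c = minuses x
    1-1 : ∀ a b → 1ℚ * a + 1ℚ * b ≡ a + b
    1-1 = solve-∀ ℚ-ring
    regroup : ∀ a b d n c → 1ℚ * b + 1ℚ * (d + (n - (c + c)) * a) ≡ ((a + b) + d) + ((1ℚ + n) - ((1ℚ + c) +
        (1ℚ + c))) * a
    regroup = solve-∀ ℚ-ring

  -- Both sides sum f y * g x over the pairs in which y arises from x by turning one -1 into +1.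
  adjoint-cube : ∀ {n} (f g : Cube n → ℚ) → ∑ (points n) (λ x → U f x * g x) ≡ ∑ (points n) (λ x → f x * D g x)
  adjoint-cube {zero}  f g = trans (∑-cube₀ _)
    (trans (cong (_+ 0ℚ) (trans (ℚₚ.*-zeroˡ (g [])) (sym (ℚₚ.*-zeroʳ (f []))))) (sym (∑-cube₀ _)))
  adjoint-cube {suc n} f g = begin
    ∑ (points (suc n)) (λ x → U f x * g x)
      ≡⟨ ∑-cube n _ ⟩
    ∑ (points n) (λ x → U f+ x * g+ x) + ∑ (points n) (λ x → (f+ x + U f- x) * g- x)
      ≡⟨ cong (∑ (points n) (λ x → U f+ x * g+ x) +_)
           (trans (∑-cong (points n) (λ x → ℚₚ.*-distribʳ-+ (g- x) (f+ x) (U f- x))) (∑-+ (points n) _ _)) ⟩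
    ∑ (points n) (λ x → U f+ x * g+ x) + (∑ (points n) (λ x → f+ x * g- x) + ∑ (points n) (λ x → U f- x * g- x))
      ≡⟨ cong₂ (λ s t → s + (∑ (points n) (λ x → f+ x * g- x) + t)) (adjoint-cube f+ g+) (adjoint-cube f- g-) ⟩
    ∑ (points n) (λ x → f+ x * D g+ x) + (∑ (points n) (λ x → f+ x * g- x) + ∑ (points n) (λ x → f- x * D g- x))
      ≡⟨ regroup (∑ (points n) (λ x → f+ x * D g+ x)) (∑ (points n) (λ x → f+ x * g- x)) (∑ (points n) (λ x →
          f- x * D g- x)) ⟩
    (∑ (points n) (λ x → f+ x * g- x) + ∑ (points n) (λ x → f+ x * D g+ x)) + ∑ (points n) (λ x → f- x * D g- x)
      ≡⟨ cong (_+ ∑ (points n) (λ x → f- x * D g- x))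
           (trans (∑-cong (points n) (λ x → ℚₚ.*-distribˡ-+ (f+ x) (g- x) (D g+ x))) (∑-+ (points n) _ _)) ⟨
    ∑ (points n) (λ x → f+ x * (g- x + D g+ x)) + ∑ (points n) (λ x → f- x * D g- x)
      ≡⟨ ∑-cube n _ ⟨
    ∑ (points (suc n)) (λ x → f x * D g x) ∎
    where
    open ≡-Reasoning
    f+ f- g+ g- : Cube n → ℚ
    f+ y = f (+∷ y)
    f- y = f (-∷ y)
    g+ y = g (+∷ y)
    g- y = g (-∷ y)
    regroup : ∀ a b c → a + (b + c) ≡ (b + a) + c
    regroup = solve-∀ ℚ-ring

  -- The indicator of level k + 1 is attached to g and comes out of `D` as the indicator of level k.
  adjoint : ∀ {n} k (f g : Cube n → ℚ) → S (suc k) (λ x → U f x * g x) ≡ S k (λ x → f x * D g x)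
  adjoint {n} k f g = begin
    S (suc k) (λ x → U f x * g x)
      ≡⟨ ∑-cong (points n) (λ x → swap (δ (minuses x) (suc k)) (U f x) (g x)) ⟩
    ∑ (points n) (λ x → U f x * (δ (minuses x) (suc k) * g x))
      ≡⟨ adjoint-cube f (λ x → δ (minuses x) (suc k) * g x) ⟩
    ∑ (points n) (λ x → f x * D (λ x → δ (minuses x) (suc k) * g x) x)
      ≡⟨ ∑-cong (points n) (λ x → trans (cong (f x *_) (D-weight (λ a → δ a (suc k)) g x)) (swap (f x)
          (δ (minuses x) k) (D g x))) ⟩
    S k (λ x → f x * D g x) ∎
    where
    open ≡-Reasoning
    swap : ∀ a b c → a * (b * c) ≡ b * (a * c)
    swap = solve-∀ ℚ-ring

  -- Points with one sign inserted

  abstract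

    fins : ∀ n → List (Fin n)
    fins zero    = []
    fins (suc n) = Fin.zero ∷ List.map Fin.suc (fins n)

    ∑-fins₀ : ∀ F → ∑ (fins 0) F ≡ 0ℚ
    ∑-fins₀ F = refl

    ∑-fins : ∀ n F → ∑ (fins (suc n)) F ≡ F Fin.zero + ∑ (fins n) (F ∘ Fin.suc)
    ∑-fins n F = cong (F Fin.zero +_) (∑-map Fin.suc (fins n) F)

  ∑-fins-const : ∀ n c → ∑ (fins n) (λ _ → c) ≡ ι n * c
  ∑-fins-const zero    c = trans (∑-fins₀ (λ _ → c)) (sym (ℚₚ.*-zeroˡ c))
  ∑-fins-const (suc n) c = trans (∑-fins n (λ _ → c)) (trans (cong (c +_) (∑-fins-const n c)) (distrib (ι n) c))
    where
    distrib : ∀ a c → c + a * c ≡ (1ℚ + a) * c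
    distrib = solve-∀ ℚ-ring

  ins : ∀ {n} → Fin (suc n) → Sign → Cube n → Cube (suc n)
  ins i s x = insertAt x i s

  minuses-ins+ : ∀ {n} i (x : Cube n) → minuses (ins i Sign.+ x) ≡ minuses x
  minuses-ins+ Fin.zero    x        = refl
  minuses-ins+ (Fin.suc i) (+∷ x) = minuses-ins+ i x
  minuses-ins+ (Fin.suc i) (-∷ x) = cong suc (minuses-ins+ i x)

  minuses-ins- : ∀ {n} i (x : Cube n) → minuses (ins i Sign.- x) ≡ suc (minuses x)
  minuses-ins- Fin.zero    x        = refl
  minuses-ins- (Fin.suc i) (+∷ x) = minuses-ins- i x
  minuses-ins- (Fin.suc i) (-∷ x) = cong suc (minuses-ins- i x)

  -- The inserted +1 is itself one of the signs that `D` turns; this is the first term.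
  D-ins+ : ∀ {n} i (f : Cube (suc n) → ℚ) x → D f (ins i Sign.+ x) ≡ f (ins i Sign.- x) + D (f ∘ ins i Sign.+) x
  D-ins+ Fin.zero    f x        = refl
  D-ins+ (Fin.suc i) f (-∷ x) = D-ins+ i _ x
  D-ins+ (Fin.suc i) f (+∷ x) = trans (cong (f (-∷ ins i Sign.+ x) +_) (D-ins+ i _ x))
    (swap (f (-∷ ins i Sign.+ x)) (f (+∷ ins i Sign.- x)) (D (λ y → f (+∷ ins i Sign.+ y)) x))
    where
    swap : ∀ a b c → a + (b + c) ≡ b + (a + c)
    swap = solve-∀ ℚ-ring

  U-ins+ : ∀ {n} i (f : Cube (suc n) → ℚ) x → U f (ins i Sign.+ x) ≡ U (f ∘ ins i Sign.+) x
  U-ins+ Fin.zero    f x        = refl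
  U-ins+ (Fin.suc i) f (+∷ x) = U-ins+ i _ x
  U-ins+ (Fin.suc i) f (-∷ x) = cong (f (+∷ ins i Sign.+ x) +_) (U-ins+ i _ x)

  U-ins- : ∀ {n} i (f : Cube (suc n) → ℚ) x → U f (ins i Sign.- x) ≡ f (ins i Sign.+ x) + U (f ∘ ins i Sign.-) x
  U-ins- Fin.zero    f x        = refl
  U-ins- (Fin.suc i) f (+∷ x) = U-ins- i _ x
  U-ins- (Fin.suc i) f (-∷ x) = trans (cong (f (+∷ ins i Sign.- x) +_) (U-ins- i _ x))
    (swap (f (+∷ ins i Sign.- x)) (f (-∷ ins i Sign.+ x)) (U (λ y → f (-∷ ins i Sign.- y)) x))
    where
    swap : ∀ a b c → a + (b + c) ≡ b + (a + c)
    swap = solve-∀ ℚ-ring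

  ∑-ins : ∀ {n} i F → ∑ (points (suc n)) F ≡ ∑ (points n) (F ∘ ins i Sign.+) + ∑ (points n) (F ∘ ins i Sign.-)
  ∑-ins {n}     Fin.zero    F = ∑-cube n F
  ∑-ins {suc n} (Fin.suc i) F = begin
    ∑ (points (suc (suc n))) F
      ≡⟨ ∑-cube (suc n) F ⟩
    ∑ (points (suc n)) (λ x → F (+∷ x)) + ∑ (points (suc n)) (λ x → F (-∷ x))
      ≡⟨ cong₂ _+_ (∑-ins i _) (∑-ins i _) ⟩
    (∑₊₊ + ∑₊₋) + (∑₋₊ + ∑₋₋)
      ≡⟨ interchange ∑₊₊ ∑₊₋ ∑₋₊ ∑₋₋ ⟩
    (∑₊₊ + ∑₋₊) + (∑₊₋ + ∑₋₋)
      ≡⟨ cong₂ _+_ (∑-cube n _) (∑-cube n _) ⟨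
    ∑ (points (suc n)) (F ∘ ins (Fin.suc i) Sign.+) + ∑ (points (suc n)) (F ∘ ins (Fin.suc i) Sign.-) ∎
    where
    open ≡-Reasoning
    ∑₊₊ = ∑ (points n) (λ x → F (+∷ ins i Sign.+ x))
    ∑₊₋ = ∑ (points n) (λ x → F (+∷ ins i Sign.- x))
    ∑₋₊ = ∑ (points n) (λ x → F (-∷ ins i Sign.+ x))
    ∑₋₋ = ∑ (points n) (λ x → F (-∷ ins i Sign.- x))
    interchange : ∀ a b c d → (a + b) + (c + d) ≡ (a + c) + (b + d)
    interchange = solve-∀ ℚ-ring

  -- The summand at i collects the moves of `D` at coordinate i: the remaining signs x stay, and the
  -- i-th goes from +1 to -1.
  ∑-lowering : ∀ {n} (f h : Cube (suc n) → ℚ) → ∑ (points (suc n)) (λ x → D f x * h x) ≡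
    ∑ (fins (suc n)) (λ i → ∑ (points n) (λ x → f (ins i Sign.- x) * h (ins i Sign.+ x)))
  ∑-lowering {zero}  f h = trans (trans (∑-cube 0 _) (cong₂ _+_ (∑-cube₀ _) (∑-cube₀ _)))
    (trans (base (f (-∷ [])) (h (+∷ [])) (h (-∷ [])))
      (sym (trans (∑-fins 0 _) (cong₂ _+_ (∑-cube₀ _) (∑-fins₀ _)))))
    where
    base : ∀ a b c → ((a + 0ℚ) * b + 0ℚ) + (0ℚ * c + 0ℚ) ≡ (a * b + 0ℚ) + 0ℚ
    base = solve-∀ ℚ-ring
  ∑-lowering {suc n} f h = begin
    ∑ (points (suc (suc n))) (λ x → D f x * h x)
      ≡⟨ ∑-cube (suc n) _ ⟩
    ∑ (points (suc n)) (λ x → (f- x + D f+ x) * h+ x) + ∑ (points (suc n)) (λ x → D f- x * h- x)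
      ≡⟨ cong (_+ ∑ (points (suc n)) (λ x → D f- x * h- x))
           (trans (∑-cong (points (suc n)) (λ x → ℚₚ.*-distribʳ-+ (h+ x) (f- x) (D f+ x))) (∑-+ (points
               (suc n)) _ _)) ⟩
    (head + ∑ (points (suc n)) (λ x → D f+ x * h+ x)) + ∑ (points (suc n)) (λ x → D f- x * h- x)
      ≡⟨ cong₂ (λ s t → (head + s) + t) (∑-lowering f+ h+) (∑-lowering f- h-) ⟩
    (head + ∑ (fins (suc n)) A) + ∑ (fins (suc n)) B
      ≡⟨ ℚₚ.+-assoc head _ _ ⟩
    head + (∑ (fins (suc n)) A + ∑ (fins (suc n)) B)
      ≡⟨ cong (head +_) (∑-+ (fins (suc n)) A B) ⟨
    head + ∑ (fins (suc n)) (λ i → A i + B i)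
      ≡⟨ cong (head +_) (∑-cong (fins (suc n)) (λ i → ∑-cube n _)) ⟨
    head + ∑ (fins (suc n)) (G ∘ Fin.suc)
      ≡⟨ ∑-fins (suc n) G ⟨
    ∑ (fins (suc (suc n))) G ∎
    where
    open ≡-Reasoning
    f+ f- h+ h- : Cube (suc n) → ℚ
    f+ y = f (+∷ y)
    f- y = f (-∷ y)
    h+ y = h (+∷ y)
    h- y = h (-∷ y)
    head = ∑ (points (suc n)) (λ x → f- x * h+ x)
    A B : Fin (suc n) → ℚ
    A i = ∑ (points n) (λ x → f+ (ins i Sign.- x) * h+ (ins i Sign.+ x))
    B i = ∑ (points n) (λ x → f- (ins i Sign.- x) * h- (ins i Sign.+ x))
    G : Fin (suc (suc n)) → ℚ
    G i = ∑ (points (suc n)) (λ x → f (ins i Sign.- x) * h (ins i Sign.+ x))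

  S-lowering : ∀ {n} k (f h : Cube (suc n) → ℚ) → S k (λ x → D f x * h x) ≡
    ∑ (fins (suc n)) (λ i → S k (λ x → f (ins i Sign.- x) * h (ins i Sign.+ x)))
  S-lowering {n} k f h = begin
    S k (λ x → D f x * h x)
      ≡⟨ ∑-cong (points (suc n)) (λ x → swap (δ (minuses x) k) (D f x) (h x)) ⟩
    ∑ (points (suc n)) (λ x → D f x * (δ (minuses x) k * h x))
      ≡⟨ ∑-lowering f (λ x → δ (minuses x) k * h x) ⟩
    ∑ (fins (suc n)) (λ i → ∑ (points n) (λ x → f (ins i Sign.- x) * (δ (minuses (ins i Sign.+ x)) k * h
        (ins i Sign.+ x))))
      ≡⟨ ∑-cong (fins (suc n)) (λ i → ∑-cong (points n) (λ x →
           trans (swap (f (ins i Sign.- x)) (δ (minuses (ins i Sign.+ x)) k) (h (ins i Sign.+ x)))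
                 (cong (λ c → δ c k * (f (ins i Sign.- x) * h (ins i Sign.+ x))) (minuses-ins+ i x)))) ⟩
    ∑ (fins (suc n)) (λ i → S k (λ x → f (ins i Sign.- x) * h (ins i Sign.+ x))) ∎
    where
    open ≡-Reasoning
    swap : ∀ a b c → a * (b * c) ≡ b * (a * c)
    swap = solve-∀ ℚ-ring

  S-ins-suc : ∀ {n} k i (F : Cube (suc n) → ℚ) →
    S (suc k) F ≡ S (suc k) (F ∘ ins i Sign.+) + S k (F ∘ ins i Sign.-)
  S-ins-suc {n} k i F = trans (∑-ins i _) (cong₂ _+_
    (∑-cong (points n) (λ x → cong (λ c → δ c (suc k) * F (ins i Sign.+ x)) (minuses-ins+ i x)))
    (∑-cong (points n) (λ x → cong (λ c → δ c (suc k) * F (ins i Sign.- x)) (minuses-ins- i x))))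

  S-ins-zero : ∀ {n} i (F : Cube (suc n) → ℚ) → S 0 F ≡ S 0 (F ∘ ins i Sign.+)
  S-ins-zero {n} i F = trans (∑-ins i _) (trans (cong₂ _+_
    (∑-cong (points n) (λ x → cong (λ c → δ c 0 * F (ins i Sign.+ x)) (minuses-ins+ i x)))
    (trans (∑-cong (points n) (λ x → trans (cong (λ c → δ c 0 * F (ins i Sign.- x)) (minuses-ins- i x))
                                         (trans (ℚₚ.*-zeroˡ (F (ins i Sign.- x))) (sym (ℚₚ.*-zeroˡ 0ℚ)))))
           (trans (∑-*ˡ (points n) 0ℚ (λ _ → 0ℚ)) (ℚₚ.*-zeroˡ (∑ (points n) (λ _ → 0ℚ))))))
    (ℚₚ.+-identityʳ _))

  U-1 : ∀ {n} (x : Cube n) → U (λ _ → 1ℚ) x ≡ ι (minuses x)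
  U-1 []       = refl
  U-1 (+∷ x) = U-1 x
  U-1 (-∷ x) = cong (1ℚ +_) (U-1 x)

  -- A double count: a point on level k + 1 occurs once for each of its k + 1 minus signs. The count
  -- enters as `U` of the constant 1, carried over by adjointness.
  ∑-S-ins- : ∀ {n} k (F : Cube (suc n) → ℚ) →
    ∑ (fins (suc n)) (λ i → S k (F ∘ ins i Sign.-)) ≡ ι (suc k) * S (suc k) F
  ∑-S-ins- {n} k F = begin
    ∑ (fins (suc n)) (λ i → S k (F ∘ ins i Sign.-))
      ≡⟨ ∑-cong (fins (suc n)) (λ i → S-cong k (λ x _ → ℚₚ.*-identityʳ (F (ins i Sign.- x)))) ⟨
    ∑ (fins (suc n)) (λ i → S k (λ x → F (ins i Sign.- x) * 1ℚ))
      ≡⟨ S-lowering k F (λ _ → 1ℚ) ⟨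
    S k (λ x → D F x * 1ℚ)
      ≡⟨ S-cong k (λ x _ → ℚₚ.*-comm (D F x) 1ℚ) ⟩
    S k (λ x → 1ℚ * D F x)
      ≡⟨ adjoint k (λ _ → 1ℚ) F ⟨
    S (suc k) (λ x → U (λ _ → 1ℚ) x * F x)
      ≡⟨ S-cong (suc k) (λ x e → cong (_* F x) (trans (U-1 x) (cong ι e))) ⟩
    S (suc k) (λ x → ι (suc k) * F x)
      ≡⟨ S-*ˡ (suc k) (ι (suc k)) F ⟩
    ι (suc k) * S (suc k) F ∎
    where open ≡-Reasoning

  -- Every coordinate carries +1 or -1, so this count is the complement of `∑-S-ins-`. Level 0 is
  -- treated apart, having no level below it.
  ∑-S-ins+ : ∀ {n} k (F : Cube (suc n) → ℚ) →
    ∑ (fins (suc n)) (λ i → S k (F ∘ ins i Sign.+)) ≡ (ι (suc n) - ι k) * S k F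
  ∑-S-ins+ {n} zero F = begin
    ∑ (fins (suc n)) (λ i → S 0 (F ∘ ins i Sign.+))
      ≡⟨ ∑-cong (fins (suc n)) (λ i → S-ins-zero i F) ⟨
    ∑ (fins (suc n)) (λ i → S 0 F)
      ≡⟨ ∑-fins-const (suc n) (S 0 F) ⟩
    ι (suc n) * S 0 F
      ≡⟨ cong (_* S 0 F) (ℚₚ.+-identityʳ (ι (suc n))) ⟨
    (ι (suc n) - 0ℚ) * S 0 F ∎
    where open ≡-Reasoning
  ∑-S-ins+ {n} (suc k) F = begin
    T
      ≡⟨ cancel T T' ⟩
    (T + T') - T'
      ≡⟨ cong₂ _-_ (sym (∑-+ (fins (suc n)) _ _)) (∑-S-ins- k F) ⟩
    ∑ (fins (suc n)) (λ i → S (suc k) (F ∘ ins i Sign.+) + S k (F ∘ ins i Sign.-)) - ι (suc k) * S (suc k) F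
      ≡⟨ cong (_- ι (suc k) * S (suc k) F) (∑-cong (fins (suc n)) (λ i → S-ins-suc k i F)) ⟨
    ∑ (fins (suc n)) (λ i → S (suc k) F) - ι (suc k) * S (suc k) F
      ≡⟨ cong (_- ι (suc k) * S (suc k) F) (∑-fins-const (suc n) (S (suc k) F)) ⟩
    ι (suc n) * S (suc k) F - ι (suc k) * S (suc k) F
      ≡⟨ factor (ι (suc n)) (ι (suc k)) (S (suc k) F) ⟩
    (ι (suc n) - ι (suc k)) * S (suc k) F ∎
    where
    open ≡-Reasoning
    T  = ∑ (fins (suc n)) (λ i → S (suc k) (F ∘ ins i Sign.+))
    T' = ∑ (fins (suc n)) (λ i → S k (F ∘ ins i Sign.-))
    cancel : ∀ a b → a ≡ (a + b) - b
    cancel = solve-∀ ℚ-ring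
    factor : ∀ a b s → a * s - b * s ≡ (a - b) * s
    factor = solve-∀ ℚ-ring

  -- The energy of the transposition walk

  -- The pair (i , j) encodes two distinct coordinates: j is a position among those left after i is
  -- removed. Each transposition occurs twice, with opposite signs of `Δ`.
  ∑∑ : ∀ n → (Fin (suc (suc n)) × Fin (suc n) → ℚ) → ℚ
  ∑∑ n F = ∑ (fins (suc (suc n))) (λ i → ∑ (fins (suc n)) (λ j → F (i , j)))

  at-+ at+- : ∀ {n} → Fin (suc (suc n)) × Fin (suc n) → Cube n → Cube (suc (suc n))
  at-+ (i , j) x = ins i Sign.- (ins j Sign.+ x)
  at+- (i , j) x = ins i Sign.+ (ins j Sign.- x)

  Δ : ∀ {n} → Fin (suc (suc n)) × Fin (suc n) → (Cube (suc (suc n)) → ℚ) → Cube n → ℚ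
  Δ p f x = f (at-+ p x) - f (at+- p x)

  -- A point on level k + 1 is hit once for each choice of one of its k + 1 minus signs and one of
  -- its n + 1 - k plus signs.
  ∑∑-at-+ : ∀ {n} k (F : Cube (suc (suc n)) → ℚ) →
    ∑∑ n (λ p → S k (F ∘ at-+ p)) ≡ ι (suc k) * (ι (suc n) - ι k) * S (suc k) F
  ∑∑-at-+ {n} k F = begin
    ∑∑ n (λ p → S k (F ∘ at-+ p))
      ≡⟨ ∑-cong (fins (suc (suc n))) (λ i → ∑-S-ins+ k (F ∘ ins i Sign.-)) ⟩
    ∑ (fins (suc (suc n))) (λ i → (ι (suc n) - ι k) * S k (F ∘ ins i Sign.-))
      ≡⟨ ∑-*ˡ (fins (suc (suc n))) (ι (suc n) - ι k) _ ⟩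
    (ι (suc n) - ι k) * ∑ (fins (suc (suc n))) (λ i → S k (F ∘ ins i Sign.-))
      ≡⟨ cong ((ι (suc n) - ι k) *_) (∑-S-ins- k F) ⟩
    (ι (suc n) - ι k) * (ι (suc k) * S (suc k) F)
      ≡⟨ swap (ι (suc n) - ι k) (ι (suc k)) (S (suc k) F) ⟩
    ι (suc k) * (ι (suc n) - ι k) * S (suc k) F ∎
    where
    open ≡-Reasoning
    swap : ∀ a b c → a * (b * c) ≡ b * a * c
    swap = solve-∀ ℚ-ring

  ∑∑-at+- : ∀ {n} k (F : Cube (suc (suc n)) → ℚ) →
    ∑∑ n (λ p → S k (F ∘ at+- p)) ≡ ι (suc k) * (ι (suc n) - ι k) * S (suc k) F
  ∑∑-at+- {n} k F = begin
    ∑∑ n (λ p → S k (F ∘ at+- p))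
      ≡⟨ ∑-cong (fins (suc (suc n))) (λ i → ∑-S-ins- k (F ∘ ins i Sign.+)) ⟩
    ∑ (fins (suc (suc n))) (λ i → ι (suc k) * S (suc k) (F ∘ ins i Sign.+))
      ≡⟨ ∑-*ˡ (fins (suc (suc n))) (ι (suc k)) _ ⟩
    ι (suc k) * ∑ (fins (suc (suc n))) (λ i → S (suc k) (F ∘ ins i Sign.+))
      ≡⟨ cong (ι (suc k) *_) (∑-S-ins+ (suc k) F) ⟩
    ι (suc k) * ((ι (suc (suc n)) - ι (suc k)) * S (suc k) F)
      ≡⟨ regroup (ι (suc n)) (ι k) (S (suc k) F) ⟩
    ι (suc k) * (ι (suc n) - ι k) * S (suc k) F ∎
    where
    open ≡-Reasoning
    regroup : ∀ a b c → (1ℚ + b) * (((1ℚ + a) - (1ℚ + b)) * c) ≡ (1ℚ + b) * (a - b) * c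
    regroup = solve-∀ ℚ-ring

  -- In `D f x * D g x` two plus signs of x are turned independently. Distinct choices yield two
  -- points that differ by a transposition; equal choices yield f * g on level k + 1, counted by
  -- `∑-S-ins-`.
  ∑∑-cross : ∀ {n} k (f g : Cube (suc (suc n)) → ℚ) →
    ∑∑ n (λ p → S k (λ x → f (at-+ p x) * g (at+- p x))) ≡
    S k (λ x → D f x * D g x) - ι (suc k) * S (suc k) (λ x → f x * g x)
  ∑∑-cross {n} k f g = trans (cancel X Y) (cong (_- Y) (sym expand))
    where
    open ≡-Reasoning
    X = ∑∑ n (λ p → S k (λ x → f (at-+ p x) * g (at+- p x)))
    Y = ι (suc k) * S (suc k) (λ x → f x * g x)
    cancel : ∀ a b → a ≡ (a + b) - b
    cancel = solve-∀ ℚ-ring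
    distrib : ∀ a b c → a * (b + c) ≡ c * a + a * b
    distrib = solve-∀ ℚ-ring
    inner : ∀ i → S k (λ x → D (g ∘ ins i Sign.+) x * f (ins i Sign.- x)) ≡
      ∑ (fins (suc n)) (λ j → S k (λ x → f (at-+ (i , j) x) * g (at+- (i , j) x)))
    inner i = trans (S-lowering k (g ∘ ins i Sign.+) (f ∘ ins i Sign.-))
      (∑-cong (fins (suc n)) (λ j → S-cong k (λ x _ → ℚₚ.*-comm (g (at+- (i , j) x)) (f (at-+ (i , j) x)))))
    expand : S k (λ x → D f x * D g x) ≡ X + Y
    expand = begin
      S k (λ x → D f x * D g x)
        ≡⟨ S-lowering k f (D g) ⟩
      ∑ (fins (suc (suc n))) (λ i → S k (λ x → f (ins i Sign.- x) * D g (ins i Sign.+ x)))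
        ≡⟨ ∑-cong (fins (suc (suc n))) (λ i → trans
             (S-cong k (λ x _ → trans (cong (f (ins i Sign.- x) *_) (D-ins+ i g x))
               (distrib (f (ins i Sign.- x)) (g (ins i Sign.- x)) (D (g ∘ ins i Sign.+) x))))
             (S-+ k _ _)) ⟩
      ∑ (fins (suc (suc n))) (λ i → S k (λ x → D (g ∘ ins i Sign.+) x * f (ins i Sign.- x)) + S k ((λ x →
          f x * g x) ∘ ins i Sign.-))
        ≡⟨ ∑-+ (fins (suc (suc n))) _ _ ⟩
      ∑ (fins (suc (suc n))) (λ i → S k (λ x → D (g ∘ ins i Sign.+) x * f (ins i Sign.- x)))
        + ∑ (fins (suc (suc n))) (λ i → S k ((λ x → f x * g x) ∘ ins i Sign.-))
        ≡⟨ cong₂ _+_ (∑-cong (fins (suc (suc n))) inner) (∑-S-ins- k (λ x → f x * g x)) ⟩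
      X + Y ∎

  ∑∑-cong : ∀ n {F G} → (∀ p → F p ≡ G p) → ∑∑ n F ≡ ∑∑ n G
  ∑∑-cong n F≡G = ∑-cong (fins (suc (suc n))) (λ i → ∑-cong (fins (suc n)) (λ j → F≡G (i , j)))

  ∑∑-+ : ∀ n F G → ∑∑ n (λ p → F p + G p) ≡ ∑∑ n F + ∑∑ n G
  ∑∑-+ n F G = trans (∑-cong (fins (suc (suc n))) (λ i → ∑-+ (fins (suc n)) _ _)) (∑-+ (fins (suc (suc n))) _ _)

  ∑∑-*ˡ : ∀ n c F → ∑∑ n (λ p → c * F p) ≡ c * ∑∑ n F
  ∑∑-*ˡ n c F = trans (∑-cong (fins (suc (suc n))) (λ i → ∑-*ˡ (fins (suc n)) c _)) (∑-*ˡ (fins (suc (suc n)))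
      c _)

  -- The product of differences is multiplied out: the two diagonal sums are counts of level k + 1,
  -- the two mixed ones come from `∑∑-cross`. This expresses the Dirichlet form of the transposition
  -- walk through `D`.
  energy : ∀ {n} k (f g : Cube (suc (suc n)) → ℚ) →
    ∑∑ n (λ p → S k (λ x → Δ p f x * Δ p g x)) ≡
    ι 2 * ((ι (suc k) * (ι (suc n) - ι k) + ι (suc k)) * S (suc k) (λ x → f x * g x) - S k (λ x →
        D f x * D g x))
  energy {n} k f g = begin
    ∑∑ n (λ p → S k (λ x → Δ p f x * Δ p g x))
      ≡⟨ ∑∑-cong n split ⟩
    ∑∑ n (λ p → (A p + B p) + - 1ℚ * (C f g p + C g f p))
      ≡⟨ ∑∑-+ n (λ p → A p + B p) _ ⟩
    ∑∑ n (λ p → A p + B p) + ∑∑ n (λ p → - 1ℚ * (C f g p + C g f p))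
      ≡⟨ cong₂ _+_ (∑∑-+ n A B) (trans (∑∑-*ˡ n (- 1ℚ) _) (cong (- 1ℚ *_) (∑∑-+ n (C f g) (C g f)))) ⟩
    (∑∑ n A + ∑∑ n B) + - 1ℚ * (∑∑ n (C f g) + ∑∑ n (C g f))
      ≡⟨ cong₂ (λ s t → s + - 1ℚ * t) (cong₂ _+_ (∑∑-at-+ k fg) (∑∑-at+- k fg))
           (cong₂ _+_ (∑∑-cross k f g) (trans (∑∑-cross k g f) (cong₂ (λ s t → s - ι (suc k) * t)
             (S-cong k (λ x _ → ℚₚ.*-comm (D g x) (D f x)))
             (S-cong (suc k) (λ x _ → ℚₚ.*-comm (g x) (f x)))))) ⟩
    (M * s + M * s) + - 1ℚ * ((d - ι (suc k) * s) + (d - ι (suc k) * s))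
      ≡⟨ regroup M (ι (suc k)) s d ⟩
    ι 2 * ((M + ι (suc k)) * s - d) ∎
    where
    open ≡-Reasoning
    fg : Cube (suc (suc n)) → ℚ
    fg x = f x * g x
    A B : Fin (suc (suc n)) × Fin (suc n) → ℚ
    A p = S k (fg ∘ at-+ p)
    B p = S k (fg ∘ at+- p)
    C : (f g : Cube (suc (suc n)) → ℚ) → Fin (suc (suc n)) × Fin (suc n) → ℚ
    C f g p = S k (λ x → f (at-+ p x) * g (at+- p x))
    M = ι (suc k) * (ι (suc n) - ι k)
    s = S (suc k) fg
    d = S k (λ x → D f x * D g x)
    regroup : ∀ M t s d → (M * s + M * s) + - 1ℚ * ((d - t * s) + (d - t * s)) ≡
        (1ℚ + (1ℚ + 0ℚ)) * ((M + t) * s - d)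
    regroup = solve-∀ ℚ-ring
    expand : ∀ a b a' b' → (a - b) * (a' - b') ≡ (a * a' + b * b') + - 1ℚ * (a * b' + a' * b)
    expand = solve-∀ ℚ-ring
    split : ∀ p → S k (λ x → Δ p f x * Δ p g x) ≡ (A p + B p) + - 1ℚ * (C f g p + C g f p)
    split p = trans (S-cong k (λ x _ → expand (f (at-+ p x)) (f (at+- p x)) (g (at-+ p x)) (g (at+- p x))))
      (trans (S-+ k _ _) (cong₂ _+_ (S-+ k _ _) (trans (S-*ˡ k (- 1ℚ) _) (cong (- 1ℚ *_) (S-+ k _ _)))))

  -- At both points `U` can turn the single -1 among the two chosen coordinates, and both times the
  -- result has +1 at both, so that this term cancels. All other moves leave the two coordinates
  -- alone.
  Δ-U : ∀ {n} p (f : Cube (suc (suc n)) → ℚ) x → Δ p (U f) x ≡ U (Δ p f) x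
  Δ-U {n} p@(i , j) f x = begin
    U f (at-+ p x) - U f (at+- p x)
      ≡⟨ cong₂ _-_ (trans (U-ins- i f (ins j Sign.+ x)) (cong (f++ +_) (U-ins+ j (f ∘ ins i Sign.-) x)))
                   (trans (U-ins+ i f (ins j Sign.- x)) (U-ins- j (f ∘ ins i Sign.+) x)) ⟩
    (f++ + U (f ∘ at-+ p) x) - (f++ + U (f ∘ at+- p) x)
      ≡⟨ cancel f++ (U (f ∘ at-+ p) x) (U (f ∘ at+- p) x) ⟩
    1ℚ * U (f ∘ at-+ p) x + - 1ℚ * U (f ∘ at+- p) x
      ≡⟨ U-linear 1ℚ (- 1ℚ) (f ∘ at-+ p) (f ∘ at+- p) x ⟨
    U (λ y → 1ℚ * f (at-+ p y) + - 1ℚ * f (at+- p y)) x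
      ≡⟨ U-cong (λ y → minus (f (at-+ p y)) (f (at+- p y))) x ⟩
    U (Δ p f) x ∎
    where
    open ≡-Reasoning
    f++ = f (ins i Sign.+ (ins j Sign.+ x))
    cancel : ∀ c a b → (c + a) - (c + b) ≡ 1ℚ * a + - 1ℚ * b
    cancel = solve-∀ ℚ-ring
    minus : ∀ a b → 1ℚ * a + - 1ℚ * b ≡ a - b
    minus = solve-∀ ℚ-ring

  Δ-U^ : ∀ {n} j p (f : Cube (suc (suc n)) → ℚ) x → Δ p (U^ j f) x ≡ U^ j (Δ p f) x
  Δ-U^ zero    p f x = refl
  Δ-U^ (suc j) p f x = trans (Δ-U p (U^ j f) x) (U-cong (Δ-U^ j p f) x)

  -- Harmonic decomposition

  -- One level below, b = D c satisfies an equation of the same kind with a larger t, since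
  -- DU = UD + (n − 2l); then c = (e − U b) / t.

  invert-UD+t : ∀ {n} l → l ℕ.+ l ℕ.≤ n → ∀ t → 0ℚ < t → (e : Cube n → ℚ) →
    ∃ λ c → (λ x → U (D c) x + t * c x) ≈[ l ] e
  invert-UD+t zero _ t 0<t e with inverse 0<t
  ... | s , ts≡1 = (λ x → s * e x) , λ x none → begin
    U (D (λ x → s * e x)) x + t * (s * e x)   ≡⟨ cong (_+ t * (s * e x)) (U-none x none) ⟩
    0ℚ + t * (s * e x)                        ≡⟨ regroup t s (e x) ⟩
    t * s * e x                               ≡⟨ cong (_* e x) ts≡1 ⟩
    1ℚ * e x                                  ≡⟨ ℚₚ.*-identityˡ (e x) ⟩
    e x                                       ∎
    where
    open ≡-Reasoning
    regroup : ∀ t s a → 0ℚ + t * (s * a) ≡ t * s * a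
    regroup = solve-∀ ℚ-ring
  invert-UD+t {n} (suc l) 2l+2≤n t 0<t e
    -- As 2 (l + 1) ≤ n, the number n - 2l is nonnegative and the enlarged t stays positive.
    with inverse 0<t | invert-UD+t l 2l≤n (t + (ι n - (ι l + ι l))) (ℚₚ.+-mono-<-≤ 0<t 0≤gap) (D e)
    where
    2l≤n : l ℕ.+ l ℕ.≤ n
    2l≤n = ℕₚ.≤-trans (ℕₚ.+-mono-≤ (ℕₚ.n≤1+n l) (ℕₚ.n≤1+n l)) 2l+2≤n
    0≤gap : 0ℚ ≤ ι n - (ι l + ι l)
    0≤gap = ≤⇒0≤- (subst (_≤ ι n) (ι-+ l l) (ι-mono 2l≤n))
  ... | s , ts≡1 | b , b-solves = c , λ x level → begin
    U (D c) x + t * c x                             ≡⟨ cong (_+ t * c x) (U-level l Dc x level) ⟩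
    U b x + t * (s * e x + - s * U b x)             ≡⟨ regroup t s (e x) (U b x) ⟩
    U b x + t * s * (e x - U b x)                   ≡⟨ cong (λ r → U b x + r * (e x - U b x)) ts≡1 ⟩
    U b x + 1ℚ * (e x - U b x)                      ≡⟨ cancel (U b x) (e x) ⟩
    e x                                             ∎
    where
    open ≡-Reasoning
    c : Cube n → ℚ
    c x = s * e x + - s * U b x
    regroup : ∀ t s e u → u + t * (s * e + - s * u) ≡ u + t * s * (e - u)
    regroup = solve-∀ ℚ-ring
    cancel : ∀ u e → u + 1ℚ * (e - u) ≡ e
    cancel = solve-∀ ℚ-ring
    collect : ∀ s v t w b → s * (v + (t + w) * b) + - s * (v + w * b) ≡ t * s * b
    collect = solve-∀ ℚ-ring
    Dc : D c ≈[ l ] b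
    Dc y level = begin
      D c y
        ≡⟨ D-linear s (- s) e (U b) y ⟩
      s * D e y + - s * D (U b) y
        ≡⟨ cong₂ (λ p q → s * p + - s * q) (sym (b-solves y level))
             (trans (DU b y) (cong (λ m → U (D b) y + (ι n - (ι m + ι m)) * b y) level)) ⟩
      s * (U (D b) y + (t + (ι n - (ι l + ι l))) * b y) + - s * (U (D b) y + (ι n - (ι l + ι l)) * b y)
        ≡⟨ collect s (U (D b) y) t (ι n - (ι l + ι l)) (b y) ⟩
      t * s * b y
        ≡⟨ cong (_* b y) ts≡1 ⟩
      1ℚ * b y
        ≡⟨ ℚₚ.*-identityˡ (b y) ⟩
      b y ∎

  -- On level d, `D (U b)` is `U (D b)` plus (n - 2d) b. Solving `invert-UD+t` with t = n - 2d and
  -- right side `D c` therefore gives `D (U b)` = `D c`. The coefficients 1 and -1 are written out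
  -- to fit the linearity lemmas.
  harmonic-part : ∀ {n} d → suc d ℕ.+ suc d ℕ.≤ n → (c : Cube n → ℚ) →
    ∃ λ b → D (λ x → 1ℚ * c x + - 1ℚ * U b x) ≈[ d ] λ _ → 0ℚ
  harmonic-part {n} d 2d+2≤n c with invert-UD+t d 2d≤n (ι n - (ι d + ι d)) 0<gap (D c)
    where
    2d+1≤n : suc (d ℕ.+ d) ℕ.≤ n
    2d+1≤n = ℕₚ.≤-trans (ℕ.s≤s (ℕₚ.+-monoʳ-≤ d (ℕₚ.n≤1+n d))) 2d+2≤n
    2d≤n : d ℕ.+ d ℕ.≤ n
    2d≤n = ℕₚ.≤-trans (ℕₚ.n≤1+n (d ℕ.+ d)) 2d+1≤n
    0<gap : 0ℚ < ι n - (ι d + ι d)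
    0<gap = subst (_< ι n - (ι d + ι d)) (ℚₚ.+-inverseʳ (ι d + ι d))
      (ℚₚ.+-monoˡ-< (- (ι d + ι d)) (ℚₚ.<-≤-trans
        (subst₂ _<_ (ℚₚ.+-identityˡ (ι d + ι d)) (cong (1ℚ +_) (sym (ι-+ d d))) (ℚₚ.+-monoˡ-< (ι d + ι d) 0<1ℚ))
        (ι-mono 2d+1≤n)))
  ... | b , b-solves = b , λ x level → begin
    D (λ x → 1ℚ * c x + - 1ℚ * U b x) x
      ≡⟨ D-linear 1ℚ (- 1ℚ) c (U b) x ⟩
    1ℚ * D c x + - 1ℚ * D (U b) x
      ≡⟨ cong₂ (λ p q → 1ℚ * p + - 1ℚ * q) (sym (b-solves x level))
           (trans (DU b x) (cong (λ m → U (D b) x + (ι n - (ι m + ι m)) * b x) level)) ⟩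
    1ℚ * (U (D b) x + (ι n - (ι d + ι d)) * b x) + - 1ℚ * (U (D b) x + (ι n - (ι d + ι d)) * b x)
      ≡⟨ cancel (U (D b) x + (ι n - (ι d + ι d)) * b x) ⟩
    0ℚ ∎
    where
    open ≡-Reasoning
    cancel : ∀ a → 1ℚ * a + - 1ℚ * a ≡ 0ℚ
    cancel = solve-∀ ℚ-ring

  -- The sum of the commutators n - 2 (d + i) over i < j, which are collected when `D` passes j
  -- copies of `U` above level d.
  eigenvalue : ℕ → ℕ → ℕ → ℚ
  eigenvalue n d j = ι j * ((ι n + 1ℚ) - (ι j + (ι d + ι d)))

  module Harmonic {n : ℕ} (d : ℕ) (c : Cube n → ℚ) (harmonic : D c ≈[ d ] λ _ → 0ℚ) where

    -- A mutual induction: `UD-eigen` at j + 1 is `U` applied to `DU-eigen` at j, and `DU-eigen`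
    -- adds the commutator of its level to `UD-eigen`.
    UD-eigen : ∀ j → U (D (U^ j c)) ≈[ j ℕ.+ suc d ] λ x → eigenvalue n (suc d) j * U^ j c x
    DU-eigen : ∀ j → D (U (U^ j c)) ≈[ j ℕ.+ suc d ] λ x → eigenvalue n (suc d) (suc j) * U^ j c x
    UD-eigen zero x level = trans (U-level d harmonic x level) (trans (U-*ˡ 0ℚ (λ _ → 0ℚ) x)
      (0*≡0* (U (λ _ → 0ℚ) x) (c x) ((ι n + 1ℚ) - (0ℚ + (ι (suc d) + ι (suc d))))))
      where
      0*≡0* : ∀ a b e → 0ℚ * a ≡ 0ℚ * e * b
      0*≡0* = solve-∀ ℚ-ring
    UD-eigen (suc j) x level = trans (U-level (j ℕ.+ suc d) (DU-eigen j) x level)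
      (U-*ˡ (eigenvalue n (suc d) (suc j)) (U^ j c) x)
    DU-eigen j x level = begin
      D (U (U^ j c)) x
        ≡⟨ DU (U^ j c) x ⟩
      U (D (U^ j c)) x + (ι n - (ι (minuses x) + ι (minuses x))) * U^ j c x
        ≡⟨ cong₂ (λ s r → s + (ι n - (r + r)) * U^ j c x) (UD-eigen j x level)
             (trans (cong ι level) (ι-+ j (suc d))) ⟩
      eigenvalue n (suc d) j * U^ j c x + (ι n - ((ι j + ι (suc d)) + (ι j + ι (suc d)))) * U^ j c x
        ≡⟨ next (ι j) (ι n) (ι (suc d)) (U^ j c x) ⟩
      eigenvalue n (suc d) (suc j) * U^ j c x ∎
      where
      open ≡-Reasoning
      next : ∀ j n d a → j * ((n + 1ℚ) - (j + (d + d))) * a + (n - ((j + d) + (j + d))) * a ≡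
        (1ℚ + j) * ((n + 1ℚ) - ((1ℚ + j) + (d + d))) * a
      next = solve-∀ ℚ-ring

    -- Adjointness moves one `U` to the other factor as `D`, where `D U` acts as a scalar. After j
    -- rounds `D c` is left, which vanishes on level d.
    orthogonal : ∀ j (b : Cube n → ℚ) → S (j ℕ.+ suc d) (λ x → U^ (suc j) b x * U^ j c x) ≡ 0ℚ
    orthogonal zero b = begin
      S (suc d) (λ x → U b x * c x)   ≡⟨ adjoint d b c ⟩
      S d (λ x → b x * D c x)         ≡⟨ S-cong d (λ x level → trans (cong (b x *_) (harmonic x level))
                                           (trans (ℚₚ.*-zeroʳ (b x)) (sym (ℚₚ.*-zeroˡ 0ℚ)))) ⟩
      S d (λ x → 0ℚ * 0ℚ)             ≡⟨ S-*ˡ d 0ℚ (λ _ → 0ℚ) ⟩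
      0ℚ * S {n} d (λ x → 0ℚ)         ≡⟨ ℚₚ.*-zeroˡ (S {n} d (λ _ → 0ℚ)) ⟩
      0ℚ                              ∎
      where open ≡-Reasoning
    orthogonal (suc j) b = begin
      S (suc j ℕ.+ suc d) (λ x → U (U^ (suc j) b) x * U^ (suc j) c x)
        ≡⟨ adjoint (j ℕ.+ suc d) (U^ (suc j) b) (U^ (suc j) c) ⟩
      S (j ℕ.+ suc d) (λ x → U^ (suc j) b x * D (U (U^ j c)) x)
        ≡⟨ S-cong (j ℕ.+ suc d) (λ x level → trans (cong (U^ (suc j) b x *_) (DU-eigen j x level))
             (swap (U^ (suc j) b x) (eigenvalue n (suc d) (suc j)) (U^ j c x))) ⟩
      S (j ℕ.+ suc d) (λ x → eigenvalue n (suc d) (suc j) * (U^ (suc j) b x * U^ j c x))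
        ≡⟨ S-*ˡ (j ℕ.+ suc d) (eigenvalue n (suc d) (suc j)) _ ⟩
      eigenvalue n (suc d) (suc j) * S (j ℕ.+ suc d) (λ x → U^ (suc j) b x * U^ j c x)
        ≡⟨ cong (eigenvalue n (suc d) (suc j) *_) (orthogonal j b) ⟩
      eigenvalue n (suc d) (suc j) * 0ℚ
        ≡⟨ ℚₚ.*-zeroʳ (eigenvalue n (suc d) (suc j)) ⟩
      0ℚ ∎
      where
      open ≡-Reasoning
      swap : ∀ a b c → a * (b * c) ≡ b * (a * c)
      swap = solve-∀ ℚ-ring

  -- Fourth moments of eigenfunctions

  -- The two families of points are disjoint, since they carry opposite signs at i; together they
  -- are the part of level k + 1 where the two chosen signs differ.
  S-at-≤ : ∀ {n} k p (F : Cube (suc (suc n)) → ℚ) → (∀ x → 0ℚ ≤ F x) →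
    S k (F ∘ at-+ p) + S k (F ∘ at+- p) ≤ S (suc k) F
  S-at-≤ {n} k p@(i , j) F 0≤F = begin
    S k (F ∘ at-+ p) + S k (F ∘ at+- p)
      ≤⟨ ℚₚ.+-mono-≤ (left k) (≤-by _ (S-nonneg (suc k) (λ x → 0≤F _))
           (trans (S-ins-suc k j (F ∘ ins i Sign.+)) (ℚₚ.+-comm (S (suc k) (F ∘ ins i Sign.+ ∘ ins j Sign.+))
               _))) ⟩
    S k (F ∘ ins i Sign.-) + S (suc k) (F ∘ ins i Sign.+)
      ≡⟨ trans (ℚₚ.+-comm (S k (F ∘ ins i Sign.-)) _) (sym (S-ins-suc k i F)) ⟩
    S (suc k) F ∎
    where
    open ℚₚ.≤-Reasoning
    left : ∀ k → S k (F ∘ at-+ p) ≤ S k (F ∘ ins i Sign.-)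
    left zero    = ℚₚ.≤-reflexive (sym (S-ins-zero j (F ∘ ins i Sign.-)))
    left (suc k) = ≤-by _ (S-nonneg k (λ x → 0≤F _)) (S-ins-suc k j (F ∘ ins i Sign.-))

  *-cancelʳ-nonneg : ∀ {a b} c → 0ℚ ≤ c → (c ≡ 0ℚ → a ≤ b) → a * c ≤ b * c → a ≤ b
  *-cancelʳ-nonneg {a} {b} c 0≤c at-0 ac≤bc with c ℚₚ.≤? 0ℚ
  ... | yes c≤0 = at-0 (ℚₚ.≤-antisym c≤0 0≤c)
  ... | no  c≰0 = ℚₚ.*-cancelʳ-≤-pos c {{ℚ.positive (ℚₚ.≰⇒> c≰0)}} ac≤bc

  2nd 4th : ∀ {n} → ℕ → (Cube n → ℚ) → ℚ
  2nd k f = S k (λ x → f x * f x)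
  4th k f = S k (λ x → (f x * f x) * (f x * f x))

  2nd-nonneg : ∀ {n} k (f : Cube n → ℚ) → 0ℚ ≤ 2nd k f
  2nd-nonneg k f = S-nonneg k (λ x → sq-nonneg (f x))

  4th-nonneg : ∀ {n} k (f : Cube n → ℚ) → 0ℚ ≤ 4th k f
  4th-nonneg k f = S-nonneg k (λ x → sq-nonneg (f x * f x))

  module Eigenfunction {n : ℕ} (k : ℕ) (f : Cube (suc (suc n)) → ℚ) (μ : ℚ)
    (eigen : U (D f) ≈[ suc k ] λ x → μ * f x) where

    private
      -- The first two terms add up to the eigenvalue of `U D` on constants, so this is the distance
      -- of μ from it.
      gap : ℚ
      gap = ι (suc k) * (ι (suc n) - ι k) + ι (suc k) - μ

    -- By adjointness the term with `D f` and `D g` in `energy` pairs `U (D f)`, that is μ f, with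
    -- g.
    energy-eigen : ∀ g → ∑∑ n (λ p → S k (λ x → Δ p f x * Δ p g x)) ≡
      ι 2 * (gap * S (suc k) (λ x → f x * g x))
    energy-eigen g = begin
      ∑∑ n (λ p → S k (λ x → Δ p f x * Δ p g x))
        ≡⟨ energy k f g ⟩
      ι 2 * (K * s - S k (λ x → D f x * D g x))
        ≡⟨ cong (λ t → ι 2 * (K * s - t)) (begin
             S k (λ x → D f x * D g x)             ≡⟨ adjoint k (D f) g ⟨
             S (suc k) (λ x → U (D f) x * g x)     ≡⟨ S-cong (suc k) (λ x level → trans (cong (_* g x)
                 (eigen x level)) (ℚₚ.*-assoc μ (f x) (g x))) ⟩
             S (suc k) (λ x → μ * (f x * g x))     ≡⟨ S-*ˡ (suc k) μ _ ⟩
             μ * s                                 ∎) ⟩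
      ι 2 * (K * s - μ * s)
        ≡⟨ factor (ι 2) K μ s ⟩
      ι 2 * (gap * s) ∎
      where
      open ≡-Reasoning
      K = ι (suc k) * (ι (suc n) - ι k) + ι (suc k)
      s = S (suc k) (λ x → f x * g x)
      factor : ∀ t K μ s → t * (K * s - μ * s) ≡ t * ((K - μ) * s)
      factor = solve-∀ ℚ-ring

    module _ (0<gap : 0ℚ < gap) (A B : ℚ) (0≤A : 0ℚ ≤ A) (0≤B : 0ℚ ≤ B)
      (IH : ∀ p → A * 4th k (Δ p f) ≤ B * (2nd k (Δ p f) * 2nd k (Δ p f))) where

      private
        s₂ s₄ : ℚ
        s₂ = 2nd (suc k) f
        s₄ = 4th (suc k) f
        0≤s₄ : 0ℚ ≤ s₄
        0≤s₄ = 4th-nonneg (suc k) f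

        a b : Fin (suc (suc n)) × Fin (suc n) → Cube n → ℚ
        a p x = f (at-+ p x)
        b p x = f (at+- p x)
        q : Fin (suc (suc n)) × Fin (suc n) → Cube n → ℚ
        q p x = a p x * a p x + b p x * b p x

        T E : Fin (suc (suc n)) × Fin (suc n) → ℚ
        T p = S k (λ x → (Δ p f x * Δ p f x) * q p x)
        E p = 2nd k (Δ p f)

        0≤T : ∀ p → 0ℚ ≤ T p
        0≤T p = S-nonneg k (λ x → *-nonneg (sq-nonneg (Δ p f x)) (+-nonneg (sq-nonneg (a p x)) (sq-nonneg
            (b p x))))
        0≤E : ∀ p → 0ℚ ≤ E p
        0≤E p = 2nd-nonneg k (Δ p f)

        q²≤ : ∀ p → S k (λ x → q p x * q p x) ≤ ι 2 * s₄
        q²≤ p = begin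
          S k (λ x → q p x * q p x)
            ≤⟨ S-mono k (λ x → ≤-by _ (sq-nonneg (a p x * a p x - b p x * b p x)) (parallelogram (a p x)
                (b p x))) ⟩
          S k (λ x → ι 2 * (f₄ (at-+ p x) + f₄ (at+- p x)))
            ≡⟨ trans (S-*ˡ k (ι 2) _) (cong (ι 2 *_) (S-+ k _ _)) ⟩
          ι 2 * (S k (f₄ ∘ at-+ p) + S k (f₄ ∘ at+- p))
            ≤⟨ *-monoˡ (ι 2) (ι-nonneg 2) (S-at-≤ k p f₄ (λ x → sq-nonneg (f x * f x))) ⟩
          ι 2 * s₄ ∎
          where
          open ℚₚ.≤-Reasoning
          f₄ : Cube (suc (suc n)) → ℚ
          f₄ x = (f x * f x) * (f x * f x)
          parallelogram : ∀ a b → (1ℚ + (1ℚ + 0ℚ)) * ((a * a) * (a * a) + (b * b) * (b * b)) ≡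
            (a * a + b * b) * (a * a + b * b) + (a * a - b * b) * (a * a - b * b)
          parallelogram = solve-∀ ℚ-ring

        -- Cauchy-Schwarz separates Δ² from q; then `IH` bounds the fourth moment of Δ and `q²≤` the
        -- other factor.
        T²≤E² : ∀ p → A * (T p * T p) ≤ B * (ι 2 * s₄) * (E p * E p)
        T²≤E² p = begin
          A * (T p * T p)
            ≤⟨ *-monoˡ A 0≤A (S-cauchy-schwarz k (λ x → Δ p f x * Δ p f x) (q p)) ⟩
          A * (4th k (Δ p f) * S k (λ x → q p x * q p x))
            ≡⟨ ℚₚ.*-assoc A (4th k (Δ p f)) _ ⟨
          A * 4th k (Δ p f) * S k (λ x → q p x * q p x)
            ≤⟨ *-mono (*-nonneg 0≤A (4th-nonneg k (Δ p f))) (*-nonneg (ι-nonneg 2) 0≤s₄) (IH p) (q²≤ p) ⟩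
          B * (E p * E p) * (ι 2 * s₄)
            ≡⟨ swap B (E p * E p) (ι 2 * s₄) ⟩
          B * (ι 2 * s₄) * (E p * E p) ∎
          where
          open ℚₚ.≤-Reasoning
          swap : ∀ a b c → a * b * c ≡ a * c * b
          swap = solve-∀ ℚ-ring

        ∑T²≤∑E² : A * (∑∑ n T * ∑∑ n T) ≤ B * (ι 2 * s₄) * (∑∑ n E * ∑∑ n E)
        -- The summation without roots is used twice, for the inner and for the outer coordinate of
        -- the pair.
        ∑T²≤∑E² = ∑-square-≤ (fins (suc (suc n))) A c _ _ 0≤A 0≤c
          (λ i → ∑-nonneg (fins (suc n)) (λ j → 0≤T (i , j)))
          (λ i → ∑-nonneg (fins (suc n)) (λ j → 0≤E (i , j)))
          (λ i → ∑-square-≤ (fins (suc n)) A c _ _ 0≤A 0≤c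
            (λ j → 0≤T (i , j)) (λ j → 0≤E (i , j)) (λ j → T²≤E² (i , j)))
          where
          c = B * (ι 2 * s₄)
          0≤c : 0ℚ ≤ c
          0≤c = *-nonneg 0≤B (*-nonneg (ι-nonneg 2) 0≤s₄)

        ∑E : ∑∑ n E ≡ ι 2 * (gap * s₂)
        ∑E = energy-eigen f

        -- 2 (a − b) (a³ − b³) ≤ 3 (a − b)² (a² + b²)
        s₄≤∑T : ι 2 * (ι 2 * (gap * s₄)) ≤ ι 3 * ∑∑ n T
        s₄≤∑T = begin
          ι 2 * (ι 2 * (gap * s₄))
            ≡⟨ cong (λ t → ι 2 * (ι 2 * (gap * t))) (S-cong (suc k) (λ x _ → ℚₚ.*-assoc (f x) (f x)
                (f x * f x))) ⟩
          ι 2 * (ι 2 * (gap * S (suc k) (λ x → f x * f³ x)))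
            ≡⟨ cong (ι 2 *_) (energy-eigen f³) ⟨
          ι 2 * ∑∑ n (λ p → S k (λ x → Δ p f x * Δ p f³ x))
            ≡⟨ ∑∑-*ˡ n (ι 2) _ ⟨
          ∑∑ n (λ p → ι 2 * S k (λ x → Δ p f x * Δ p f³ x))
            ≤⟨ ∑-mono (fins (suc (suc n))) (λ i → ∑-mono (fins (suc n)) (λ j → termwise (i , j))) ⟩
          ∑∑ n (λ p → ι 3 * T p)
            ≡⟨ ∑∑-*ˡ n (ι 3) T ⟩
          ι 3 * ∑∑ n T ∎
          where
          open ℚₚ.≤-Reasoning
          f³ : Cube (suc (suc n)) → ℚ
          f³ x = f x * (f x * f x)
          cubes : ∀ a b → (1ℚ + (1ℚ + (1ℚ + 0ℚ))) * (((a - b) * (a - b)) * (a * a + b * b)) ≡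
            (1ℚ + (1ℚ + 0ℚ)) * ((a - b) * (a * (a * a) - b * (b * b))) + ((a - b) * (a - b)) * ((a - b) *
                (a - b))
          cubes = solve-∀ ℚ-ring
          termwise : ∀ p → ι 2 * S k (λ x → Δ p f x * Δ p f³ x) ≤ ι 3 * T p
          termwise p = subst₂ _≤_ (S-*ˡ k (ι 2) _) (S-*ˡ k (ι 3) _)
            (S-mono k (λ x → ≤-by _ (sq-nonneg (Δ p f x * Δ p f x)) (cubes (a p x) (b p x))))

      -- Squaring `s₄≤∑T` and inserting `∑T²≤∑E²` and `∑E` gives 16 A gap² s₄² ≤ 72 B gap² s₂² s₄.
      -- Division by 8 gap² s₄ leaves the claim.
      fourth-moment : ι 2 * (A * s₄) ≤ ι 9 * (B * (s₂ * s₂))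
      fourth-moment = cancel-s₄ (*-cancelˡ (ι 8 * (gap * gap)) (*-pos (ι-pos 7) (*-pos 0<gap 0<gap)) (begin
        ι 8 * (gap * gap) * (ι 2 * (A * s₄) * s₄)
          ≡⟨ square-left A gap s₄ ⟩
        A * (ι 2 * (ι 2 * (gap * s₄)) * (ι 2 * (ι 2 * (gap * s₄))))
          ≤⟨ *-monoˡ A 0≤A (*-mono 0≤L (*-nonneg (ι-nonneg 3) 0≤∑T) s₄≤∑T s₄≤∑T) ⟩
        A * (ι 3 * ∑∑ n T * (ι 3 * ∑∑ n T))
          ≡⟨ pull A (∑∑ n T) ⟩
        ι 9 * (A * (∑∑ n T * ∑∑ n T))
          ≤⟨ *-monoˡ (ι 9) (ι-nonneg 9) ∑T²≤∑E² ⟩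
        ι 9 * (B * (ι 2 * s₄) * (∑∑ n E * ∑∑ n E))
          ≡⟨ cong (λ e → ι 9 * (B * (ι 2 * s₄) * (e * e))) ∑E ⟩
        ι 9 * (B * (ι 2 * s₄) * (ι 2 * (gap * s₂) * (ι 2 * (gap * s₂))))
          ≡⟨ square-right B gap s₂ s₄ ⟩
        ι 8 * (gap * gap) * (ι 9 * (B * (s₂ * s₂)) * s₄) ∎))
        where
        open ℚₚ.≤-Reasoning
        0≤∑T : 0ℚ ≤ ∑∑ n T
        0≤∑T = ∑-nonneg (fins (suc (suc n))) (λ i → ∑-nonneg (fins (suc n)) (λ j → 0≤T (i , j)))
        0≤L : 0ℚ ≤ ι 2 * (ι 2 * (gap * s₄))
        0≤L = *-nonneg (ι-nonneg 2) (*-nonneg (ι-nonneg 2) (*-nonneg (ℚₚ.<⇒≤ 0<gap) 0≤s₄))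
        square-left : ∀ A g s → ι 8 * (g * g) * (ι 2 * (A * s) * s) ≡ A * (ι 2 * (ι 2 * (g * s)) * (ι 2 *
            (ι 2 * (g * s))))
        square-left = solve-∀ ℚ-ring
        pull : ∀ A t → A * (ι 3 * t * (ι 3 * t)) ≡ ι 9 * (A * (t * t))
        pull = solve-∀ ℚ-ring
        square-right : ∀ B g s₂ s₄ → ι 9 * (B * (ι 2 * s₄) * (ι 2 * (g * s₂) * (ι 2 * (g * s₂)))) ≡
          ι 8 * (g * g) * (ι 9 * (B * (s₂ * s₂)) * s₄)
        square-right = solve-∀ ℚ-ring
        0≤R : 0ℚ ≤ ι 9 * (B * (s₂ * s₂))
        0≤R = *-nonneg (ι-nonneg 9) (*-nonneg 0≤B (sq-nonneg s₂))
        -- If `s₄` is 0 it cannot be divided out, but then the left side is 0.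
        cancel-s₄ : ι 2 * (A * s₄) * s₄ ≤ ι 9 * (B * (s₂ * s₂)) * s₄ → ι 2 * (A * s₄) ≤ ι 9 * (B * (s₂ * s₂))
        cancel-s₄ = *-cancelʳ-nonneg s₄ 0≤s₄ λ s₄≡0 →
          ℚₚ.≤-trans (ℚₚ.≤-reflexive (trans (cong (λ s → ι 2 * (A * s)) s₄≡0) (vanish A))) 0≤R
          where
          vanish : ∀ A → ι 2 * (A * 0ℚ) ≡ 0ℚ
          vanish = solve-∀ ℚ-ring

  -- Numerals, powers and the sizes of levels

  ℕ→ℚ-suc : ∀ n → ℕ→ℚ (suc n) ≡ 1ℚ + ℕ→ℚ n
  ℕ→ℚ-suc n = ℚₚ.toℚᵘ-injective (ℚᵘₚ.≃-trans (ℚₚ.toℚᵘ-fromℚᵘ (ℚᵘ.mkℚᵘ (ℤ.+ suc n) 0))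
      (ℚᵘₚ.≃-trans (ℚᵘ.*≡* (cong (ℤ._* ℤ.+ 1) (cong (λ a → ℤ.+ 1 ℤ.+ a) (sym (ℤₚ.*-identityʳ (ℤ.+ n))))))
      (ℚᵘₚ.≃-sym (ℚᵘₚ.≃-trans (ℚₚ.toℚᵘ-homo-+ 1ℚ (ℕ→ℚ n))
        (ℚᵘₚ.+-congʳ (ℚ.toℚᵘ 1ℚ) (ℚₚ.toℚᵘ-fromℚᵘ (ℚᵘ.mkℚᵘ (ℤ.+ n) 0)))))))

  ℕ→ℚ≡ι : ∀ n → ℕ→ℚ n ≡ ι n
  ℕ→ℚ≡ι zero    = refl
  ℕ→ℚ≡ι (suc n) = trans (ℕ→ℚ-suc n) (cong (1ℚ +_) (ℕ→ℚ≡ι n))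

  numeral-≤ : ∀ {m n} → m ℕ.≤ n → ℕ→ℚ m ≤ ℕ→ℚ n
  numeral-≤ {m} {n} m≤n = subst₂ _≤_ (sym (ℕ→ℚ≡ι m)) (sym (ℕ→ℚ≡ι n)) (ι-mono m≤n)

  numeral-nonneg : ∀ n → 0ℚ ≤ ℕ→ℚ n
  numeral-nonneg n = subst (0ℚ ≤_) (sym (ℕ→ℚ≡ι n)) (ι-nonneg n)

  infixr 8 _^_
  _^_ : ℚ → ℕ → ℚ
  x ^ zero  = 1ℚ
  x ^ suc d = x * x ^ d

  ^-nonneg : ∀ {x} d → 0ℚ ≤ x → 0ℚ ≤ x ^ d
  ^-nonneg zero    0≤x = ℚₚ.<⇒≤ 0<1ℚ
  ^-nonneg (suc d) 0≤x = *-nonneg 0≤x (^-nonneg d 0≤x)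

  ^-mono : ∀ {x y} d → 0ℚ ≤ x → x ≤ y → x ^ d ≤ y ^ d
  ^-mono zero    0≤x x≤y = ℚₚ.≤-refl
  ^-mono (suc d) 0≤x x≤y = *-mono 0≤x (^-nonneg d (ℚₚ.≤-trans 0≤x x≤y)) x≤y (^-mono d 0≤x x≤y)

  ^-distrib-* : ∀ x y d → (x * y) ^ d ≡ x ^ d * y ^ d
  ^-distrib-* x y zero    = refl
  ^-distrib-* x y (suc d) = trans (cong (x * y *_) (^-distrib-* x y d)) (interchange x y (x ^ d) (y ^ d))
    where
    interchange : ∀ a b c d → (a * b) * (c * d) ≡ (a * c) * (b * d)
    interchange = solve-∀ ℚ-ring

  ^-+ : ∀ x d e → x ^ (d ℕ.+ e) ≡ x ^ d * x ^ e
  ^-+ x zero    e = sym (ℚₚ.*-identityˡ (x ^ e))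
  ^-+ x (suc d) e = trans (cong (x *_) (^-+ x d e)) (sym (ℚₚ.*-assoc x (x ^ d) (x ^ e)))

  -- (1 + 1/k)^d ≤ 1 + d/k + (d/k)² for d ≤ k, with denominators cleared
  suc^-quadratic : ∀ k d → d ℕ.≤ k → ι (suc k) ^ d * (ι k * ι k) ≤ ι k ^ d * (ι k * ι k + ι d * ι k + ι d * ι d)
  suc^-quadratic k zero    _ = ℚₚ.≤-reflexive (base (ι k))
    where
    base : ∀ x → 1ℚ * (x * x) ≡ 1ℚ * (x * x + 0ℚ * x + 0ℚ * 0ℚ)
    base = solve-∀ ℚ-ring
  suc^-quadratic k (suc d) d<k = begin
    (1ℚ + x) * (1ℚ + x) ^ d * (x * x)
      ≡⟨ ℚₚ.*-assoc (1ℚ + x) _ _ ⟩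
    (1ℚ + x) * ((1ℚ + x) ^ d * (x * x))
      ≤⟨ *-monoˡ (1ℚ + x) (ι-nonneg (suc k)) (suc^-quadratic k d (ℕₚ.<⇒≤ d<k)) ⟩
    (1ℚ + x) * (x ^ d * (x * x + i * x + i * i))
      ≤⟨ ≤-by _ (*-nonneg (^-nonneg d (ι-nonneg k)) (+-nonneg (*-nonneg (ι-nonneg d) (≤⇒0≤- (ι-mono
          (ℕₚ.<⇒≤ d<k)))) (ι-nonneg k)))
           (next (x ^ d) x i) ⟩
    x * x ^ d * (x * x + (1ℚ + i) * x + (1ℚ + i) * (1ℚ + i)) ∎
    where
    open ℚₚ.≤-Reasoning
    x = ι k
    i = ι d
    next : ∀ p x i → x * p * (x * x + (1ℚ + i) * x + (1ℚ + i) * (1ℚ + i)) ≡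
      (1ℚ + x) * (p * (x * x + i * x + i * i)) + p * (i * (x - i) + x)
    next = solve-∀ ℚ-ring

  -- Since d ≤ k, each of the three terms of the quadratic bound is at most 1.
  suc^≤3*^ : ∀ k d → d ℕ.≤ k → ι (suc k) ^ d ≤ ι 3 * ι k ^ d
  suc^≤3*^ zero    zero ℕ.z≤n = ι-mono {1} {3} (ℕ.s≤s ℕ.z≤n)
  suc^≤3*^ k@(suc k') d d≤k = *-cancelˡ (x * x) (*-pos (ι-pos k') (ι-pos k')) (begin
    x * x * (1ℚ + x) ^ d
      ≡⟨ ℚₚ.*-comm (x * x) _ ⟩
    (1ℚ + x) ^ d * (x * x)
      ≤⟨ suc^-quadratic k d d≤k ⟩
    x ^ d * (x * x + i * x + i * i)
      ≤⟨ *-monoˡ (x ^ d) (^-nonneg d (ι-nonneg k)) (ℚₚ.+-mono-≤ (ℚₚ.+-monoʳ-≤ (x * x) (*-monoʳ x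
          (ι-nonneg k) i≤x))
           (*-mono (ι-nonneg d) (ι-nonneg k) i≤x i≤x)) ⟩
    x ^ d * (x * x + x * x + x * x)
      ≡⟨ collect (x ^ d) x ⟩
    x * x * (ι 3 * x ^ d) ∎)
    where
    open ℚₚ.≤-Reasoning
    x = ι k
    i = ι d
    i≤x : i ≤ x
    i≤x = ι-mono d≤k
    collect : ∀ p x → p * (x * x + x * x + x * x) ≡ x * x * (ι 3 * p)
    collect = solve-∀ ℚ-ring

  size : ℕ → ℕ → ℚ
  size n k = S {n} k (λ _ → 1ℚ)

  size-nonneg : ∀ n k → 0ℚ ≤ size n k
  size-nonneg n k = S-nonneg {n} k (λ _ → ℚₚ.<⇒≤ 0<1ℚ)

  -- Both sides count the pairs of a choice of two coordinates and a point on level k of the smaller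
  -- cube: directly on the left, by the resulting point on the right.
  size-step : ∀ n k → ι (suc (suc n)) * (ι (suc n) * size n k) ≡
    ι (suc k) * (ι (suc n) - ι k) * size (suc (suc n)) (suc k)
  size-step n k = trans (sym (trans (∑-cong (fins (suc (suc n))) (λ i → ∑-fins-const (suc n) (size n k)))
      (∑-fins-const (suc (suc n)) _)))
    (∑∑-at-+ k (λ _ → 1ℚ))

  -- For k = p n, spread n k / square n is p (1 − p).
  spread : ℕ → ℕ → ℚ
  spread n k = ι k * (ι n - ι k)

  square : ℕ → ℚ
  square n = ι n * ι n

  square-nonneg : ∀ n → 0ℚ ≤ square n
  square-nonneg n = sq-nonneg (ι n)

  256n² : ℕ → ℚ
  256n² n = ℕ→ℚ 256 * square n

  256n²-nonneg : ∀ n → 0ℚ ≤ 256n² n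
  256n²-nonneg n = *-nonneg (numeral-nonneg 256) (square-nonneg n)

  256n²-mono : ∀ {m n} → m ℕ.≤ n → 256n² m ≤ 256n² n
  256n²-mono {m} {n} m≤n = *-monoˡ (ℕ→ℚ 256) (numeral-nonneg 256) (*-mono (ι-nonneg m) (ι-nonneg n)
      (ι-mono m≤n) (ι-mono m≤n))

  module _ {n k : ℕ} (k≤n : k ℕ.≤ n) where

    spread-nonneg : 0ℚ ≤ spread n k
    spread-nonneg = *-nonneg (ι-nonneg k) (≤⇒0≤- (ι-mono k≤n))

    spread≤square : spread n k ≤ square n
    spread≤square = ≤-by _ (+-nonneg (sq-nonneg (ι n - ι k)) (*-nonneg (ι-nonneg k) (ι-nonneg n))) (expand
        (ι n) (ι k))
      where
      expand : ∀ n k → n * n ≡ k * (n - k) + ((n - k) * (n - k) + k * n)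
      expand = solve-∀ ℚ-ring

  -- The factors k and n - k both grow by one. As d is at most either of them, each growth costs a
  -- factor of at most 3 in the d-th power.
  spread-suc^ : ∀ {n k} d → d ℕ.≤ k → d ℕ.+ k ℕ.≤ n → spread (suc (suc n)) (suc k) ^ d ≤ ℕ→ℚ 9 * spread n k ^ d
  spread-suc^ {n} {k} d d≤k d+k≤n = begin
    (ι (suc k) * (ι (suc (suc n)) - ι (suc k))) ^ d
      ≡⟨ cong (λ t → (ι (suc k) * t) ^ d) n-k ⟩
    (ι (suc k) * ι (suc m)) ^ d
      ≡⟨ ^-distrib-* (ι (suc k)) (ι (suc m)) d ⟩
    ι (suc k) ^ d * ι (suc m) ^ d
      ≤⟨ *-mono (^-nonneg d (ι-nonneg (suc k))) (*-nonneg (ι-nonneg 3) (^-nonneg d (ι-nonneg m)))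
           (suc^≤3*^ k d d≤k) (suc^≤3*^ m d d≤m) ⟩
    ι 3 * ι k ^ d * (ι 3 * ι m ^ d)
      ≡⟨ collect (ι k ^ d) (ι m ^ d) ⟩
    ℕ→ℚ 9 * (ι k ^ d * ι m ^ d)
      ≡⟨ cong (ℕ→ℚ 9 *_) (^-distrib-* (ι k) (ι m) d) ⟨
    ℕ→ℚ 9 * (ι k * ι m) ^ d
      ≡⟨ cong (λ t → ℕ→ℚ 9 * (ι k * t) ^ d) m≡ ⟩
    ℕ→ℚ 9 * spread n k ^ d ∎
    where
    open ℚₚ.≤-Reasoning
    m = n ℕ.∸ k
    d≤m : d ℕ.≤ m
    d≤m = subst (ℕ._≤ m) (ℕₚ.m+n∸n≡m d k) (ℕₚ.∸-monoˡ-≤ k d+k≤n)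
    n≡ : ι n ≡ ι m + ι k
    n≡ = trans (cong ι (sym (ℕₚ.m∸n+n≡m (ℕₚ.≤-trans (ℕₚ.m≤n+m k d) d+k≤n)))) (ι-+ m k)
    cancel : ∀ a b → a ≡ (a + b) - b
    cancel = solve-∀ ℚ-ring
    m≡ : ι m ≡ ι n - ι k
    m≡ = trans (cancel (ι m) (ι k)) (cong (_- ι k) (sym n≡))
    shift : ∀ n k → (1ℚ + (1ℚ + n)) - (1ℚ + k) ≡ 1ℚ + (n - k)
    shift = solve-∀ ℚ-ring
    n-k : ι (suc (suc n)) - ι (suc k) ≡ ι (suc m)
    n-k = trans (shift (ι n) (ι k)) (cong (1ℚ +_) (sym m≡))
    collect : ∀ a b → ι 3 * a * (ι 3 * b) ≡ ℕ→ℚ 9 * (a * b)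
    collect = solve-∀ ℚ-ring

  spread-suc : ∀ n k → spread (suc (suc n)) (suc k) ≡ ι (suc k) * (ι (suc n) - ι k)
  spread-suc n k = shift (ι n) (ι k)
    where
    shift : ∀ n k → (1ℚ + k) * ((1ℚ + (1ℚ + n)) - (1ℚ + k)) ≡ (1ℚ + k) * ((1ℚ + n) - k)
    shift = solve-∀ ℚ-ring

  size-spread : ∀ n k → size (suc (suc n)) (suc k) * spread (suc (suc n)) (suc k) ≤ square (suc (suc n)) * size
      n k
  size-spread n k = begin
    size (suc (suc n)) (suc k) * spread (suc (suc n)) (suc k)
      ≡⟨ ℚₚ.*-comm (size (suc (suc n)) (suc k)) _ ⟩
    spread (suc (suc n)) (suc k) * size (suc (suc n)) (suc k)
      ≡⟨ trans (cong (_* size (suc (suc n)) (suc k)) (spread-suc n k)) (sym (size-step n k)) ⟩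
    ι (suc (suc n)) * (ι (suc n) * size n k)
      ≤⟨ *-monoˡ (ι (suc (suc n))) (ι-nonneg (suc (suc n))) (*-monoʳ (size n k) (size-nonneg n k) (ι-mono
          (ℕₚ.n≤1+n (suc n)))) ⟩
    ι (suc (suc n)) * (ι (suc (suc n)) * size n k)
      ≡⟨ ℚₚ.*-assoc (ι (suc (suc n))) _ _ ⟨
    square (suc (suc n)) * size n k ∎
    where open ℚₚ.≤-Reasoning

  -- Functions of low degree

  constant-on-0 : ∀ {n} (c : Cube n → ℚ) → ∃ λ v → c ≈[ 0 ] λ _ → v
  constant-on-0 {n} c = c (Vec.replicate n Sign.+) , λ x none → cong c (all-plus x none)
    where
    all-plus : ∀ {n} (x : Cube n) → minuses x ≡ 0 → x ≡ Vec.replicate n Sign.+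
    all-plus []       _    = refl
    all-plus (+∷ x) none = cong (Sign.+ ∷_) (all-plus x none)

  -- This is degree 0: level 0 is a single point, and raising a constant multiplies it by the number
  -- of minus signs.
  U^-constant : ∀ {n} j (c : Cube n → ℚ) → ∃ λ v → U^ j c ≈[ j ] λ _ → v
  U^-constant zero    c = constant-on-0 c
  U^-constant (suc j) c with U^-constant j c
  ... | v , U^≈v = v * ι (suc j) , λ x level → begin
    U (U^ j c) x        ≡⟨ U-level j (λ y e → trans (U^≈v y e) (sym (ℚₚ.*-identityʳ v))) x level ⟩
    U (λ _ → v * 1ℚ) x  ≡⟨ U-*ˡ v (λ _ → 1ℚ) x ⟩
    v * U (λ _ → 1ℚ) x  ≡⟨ cong (v *_) (trans (U-1 x) (cong ι level)) ⟩
    v * ι (suc j)       ∎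
    where open ≡-Reasoning

  S-constant : ∀ {n} k (f : Cube n → ℚ) v → f ≈[ k ] (λ _ → v) → S k f ≡ v * size n k
  S-constant k f v f≈v = trans (S-cong k (λ x level → trans (f≈v x level) (sym (ℚₚ.*-identityʳ v))))
      (S-*ˡ k v _)

  -- The inequality E f⁴ ≤ (256 n² / (k (n - k)))^d (E f²)² in terms of unnormalised sums, with
  -- denominators cleared. The two hypotheses on k say d ≤ min(k, n - k).
  low-degree : ∀ d j {n} k → k ≡ j ℕ.+ d → d ℕ.+ k ℕ.≤ n → (c : Cube n → ℚ) →
    size n k * 4th k (U^ j c) * spread n k ^ d ≤ 256n² n ^ d * (2nd k (U^ j c) * 2nd k (U^ j c))
  low-degree zero j {n} k k≡j _ c = ℚₚ.≤-reflexive (trans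
    (cong (λ t → size n k * t * 1ℚ) (S-constant k _ ((v * v) * (v * v)) (λ x e → cong (λ t → (t * t) * (t * t))
        (U^≈v x e))))
    (trans (regroup-const (size n k) v)
      (cong (λ t → 1ℚ * (t * t)) (sym (S-constant k _ (v * v) (λ x e → cong (λ t → t * t) (U^≈v x e)))))))
    where
    constant : ∃ λ v → U^ j c ≈[ k ] λ _ → v
    constant = subst (λ k → ∃ λ v → U^ j c ≈[ k ] λ _ → v) (sym (trans k≡j (ℕₚ.+-identityʳ j)))
        (U^-constant j c)
    v = proj₁ constant
    U^≈v = proj₂ constant
    regroup-const : ∀ s v → s * ((v * v) * (v * v) * s) * 1ℚ ≡ 1ℚ * ((v * v * s) * (v * v * s))
    regroup-const = solve-∀ ℚ-ring
  low-degree (suc d) j zero k≡ _ _ = contradiction (trans k≡ (ℕₚ.+-suc j d)) λ ()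
  low-degree (suc d) j {suc zero} (suc k) k≡ (ℕ.s≤s d+k≤0) _ =
    contradiction (trans (sym (ℕₚ.+-suc d k)) (ℕₚ.n≤0⇒n≡0 d+k≤0)) λ ()
  low-degree (suc d) j {suc (suc n)} (suc k) k≡ d+k≤n c = begin
    s * 4th (suc k) f * (M * Q)
      ≤⟨ *-monoʳ (M * Q) 0≤MQ (*-monoˡ s 0≤s f₄≤) ⟩
    s * (ℕ→ℚ 5 * g₄ + ℕ→ℚ 20 * h₄) * (M * Q)
      ≡⟨ split s g₄ h₄ M Q ⟩
    ℕ→ℚ 5 * (Q * (s * M) * g₄) + ℕ→ℚ 20 * (M * (s * h₄ * Q))
      ≤⟨ ℚₚ.+-mono-≤ g-bound h-bound ⟩
    256n² N * R * (g₂ * g₂) + 256n² N * R * (h₂ * h₂)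
      -- The term 2 g₂ h₂ is added to complete the square; by orthogonality g₂ + h₂ is exactly the
      -- second moment of f.
      ≤⟨ ≤-by _ (*-nonneg (*-nonneg (256n²-nonneg N) (^-nonneg d (256n²-nonneg N)))
           (+-nonneg (*-nonneg (2nd-nonneg (suc k) g) (2nd-nonneg (suc k) h))
                     (*-nonneg (2nd-nonneg (suc k) g) (2nd-nonneg (suc k) h)))) (square-sum (256n² N * R) g₂
                         h₂) ⟩
    256n² N * R * ((g₂ + h₂) * (g₂ + h₂))
      ≡⟨ cong (λ t → 256n² N * R * (t * t)) f₂≡ ⟨
    256n² N * R * (2nd (suc k) f * 2nd (suc k) f) ∎
    where
    decomposition = harmonic-part d (ℕₚ.≤-trans (ℕₚ.+-monoʳ-≤ (suc d) (subst (suc d ℕ.≤_) (sym k≡) (ℕₚ.m≤n+m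
        (suc d) j))) d+k≤n) c
    b = proj₁ decomposition
    harmonic = proj₂ decomposition
    open ℚₚ.≤-Reasoning
    N = suc (suc n)
    c' : Cube N → ℚ
    c' x = 1ℚ * c x + - 1ℚ * U b x
    f g h : Cube N → ℚ
    f = U^ j c
    g = U^ j c'
    h = U^ (suc j) b
    k≡j+d : k ≡ j ℕ.+ d
    k≡j+d = ℕₚ.suc-injective (trans k≡ (ℕₚ.+-suc j d))
    d≤k : d ℕ.≤ k
    d≤k = subst (d ℕ.≤_) (sym k≡j+d) (ℕₚ.m≤n+m d j)
    d+k≤n' : d ℕ.+ k ℕ.≤ n
    d+k≤n' = ℕₚ.≤-pred (subst (ℕ._≤ suc n) (ℕₚ.+-suc d k) (ℕₚ.≤-pred d+k≤n))
    k≤n : k ℕ.≤ n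
    k≤n = ℕₚ.≤-trans (ℕₚ.m≤n+m k d) d+k≤n'
    k≤N : suc k ℕ.≤ N
    k≤N = ℕₚ.≤-trans (ℕₚ.m≤n+m (suc k) (suc d)) d+k≤n
    s = size N (suc k)
    s' = size n k
    M = spread N (suc k)
    Q = M ^ d
    Q' = spread n k ^ d
    R = 256n² N ^ d
    R' = 256n² n ^ d
    g₂ = 2nd (suc k) g
    g₄ = 4th (suc k) g
    h₂ = 2nd (suc k) h
    h₄ = 4th (suc k) h
    0≤s : 0ℚ ≤ s
    0≤s = size-nonneg N (suc k)
    0≤M : 0ℚ ≤ M
    0≤M = spread-nonneg k≤N
    0≤MQ : 0ℚ ≤ M * Q
    0≤MQ = *-nonneg 0≤M (^-nonneg d 0≤M)
    split : ∀ s a b M Q → s * (ℕ→ℚ 5 * a + ℕ→ℚ 20 * b) * (M * Q) ≡ ℕ→ℚ 5 * (Q * (s * M) * a) + ℕ→ℚ 20 *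
        (M * (s * b * Q))
    split = solve-∀ ℚ-ring
    square-sum : ∀ r a b → r * ((a + b) * (a + b)) ≡ (r * (a * a) + r * (b * b)) + r * (a * b + a * b)
    square-sum = solve-∀ ℚ-ring

    f≡g+h : ∀ x → f x ≡ g x + h x
    f≡g+h x = sym (trans (cong₂ _+_ (U^-linear j 1ℚ (- 1ℚ) c (U b) x) (sym (U^-U j b x))) (cancel (f x) (U^ j
        (U b) x)))
      where
      cancel : ∀ a b → (1ℚ * a + - 1ℚ * b) + b ≡ a
      cancel = solve-∀ ℚ-ring

    h⊥g : S (suc k) (λ x → h x * g x) ≡ 0ℚ
    h⊥g = subst (λ k → S k (λ x → h x * g x) ≡ 0ℚ) (sym k≡) (Harmonic.orthogonal d c' harmonic j b)

    f₂≡ : 2nd (suc k) f ≡ g₂ + h₂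
    f₂≡ = trans (S-cong (suc k) (λ x _ → trans (cong (λ t → t * t) (f≡g+h x)) (expand (g x) (h x))))
      (trans (S-+ (suc k) _ _) (trans (cong₂ _+_ (S-+ (suc k) _ _) (trans (S-*ˡ (suc k) (ι 2) _) (cong
          (ι 2 *_) h⊥g)))
        (drop g₂ h₂)))
      where
      expand : ∀ g h → (g + h) * (g + h) ≡ (g * g + h * h) + ι 2 * (h * g)
      expand = solve-∀ ℚ-ring
      drop : ∀ a b → (a + b) + ι 2 * 0ℚ ≡ a + b
      drop = solve-∀ ℚ-ring

    -- The weights are uneven because g has to pay a further factor 81/2 in `g-bound`, whereas h is
    -- far from using up its 256.
    f₄≤ : 4th (suc k) f ≤ ℕ→ℚ 5 * g₄ + ℕ→ℚ 20 * h₄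
    f₄≤ = begin
      4th (suc k) f
        ≡⟨ S-cong (suc k) (λ x _ → cong (λ t → (t * t) * (t * t)) (f≡g+h x)) ⟩
      4th (suc k) (λ x → g x + h x)
        ≤⟨ S-mono (suc k) (λ x → ≤-by _ (+-nonneg (sq-nonneg (g x * g x - ι 4 * (h x * h x)))
             (*-nonneg (sq-nonneg (g x - h x)) (+-nonneg (*-nonneg (ι-nonneg 2) (+-nonneg (sq-nonneg (g x))
                 (sq-nonneg (h x))))
               (sq-nonneg (g x + h x))))) (quartic (g x) (h x))) ⟩
        S (suc k) (λ x → ℕ→ℚ 5 * ((g x * g x) * (g x * g x)) + ℕ→ℚ 20 * ((h x * h x) * (h x * h x)))
        ≡⟨ trans (S-+ (suc k) _ _) (cong₂ _+_ (S-*ˡ (suc k) (ℕ→ℚ 5) _) (S-*ˡ (suc k) (ℕ→ℚ 20) _)) ⟩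
      ℕ→ℚ 5 * g₄ + ℕ→ℚ 20 * h₄ ∎
      where
      quartic : ∀ g h → ℕ→ℚ 5 * ((g * g) * (g * g)) + ℕ→ℚ 20 * ((h * h) * (h * h)) ≡
        ((g + h) * (g + h)) * ((g + h) * (g + h)) +
        ((g * g - ι 4 * (h * h)) * (g * g - ι 4 * (h * h)) + ((g - h) * (g - h)) * (ι 2 * (g * g + h * h) +
            (g + h) * (g + h)))
      quartic = solve-∀ ℚ-ring

    -- The degree of h is one less than that of f, so the induction hypothesis leaves over one
    -- factor `M`, and this is at most the square of `N`.
    h-bound : ℕ→ℚ 20 * (M * (s * h₄ * Q)) ≤ 256n² N * R * (h₂ * h₂)
    h-bound = begin
      ℕ→ℚ 20 * (M * (s * h₄ * Q))
        ≤⟨ *-monoˡ (ℕ→ℚ 20) (numeral-nonneg 20) (*-mono 0≤M (*-nonneg (^-nonneg d (256n²-nonneg N))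
            (sq-nonneg h₂))
             (spread≤square k≤N) (low-degree d (suc j) (suc k) (cong suc k≡j+d) (ℕₚ.<⇒≤ d+k≤n) b)) ⟩
      ℕ→ℚ 20 * (square N * (R * (h₂ * h₂)))
        ≤⟨ *-monoʳ (square N * (R * (h₂ * h₂))) (*-nonneg (square-nonneg N) (*-nonneg (^-nonneg d
            (256n²-nonneg N)) (sq-nonneg h₂)))
             (numeral-≤ (ℕₚ.m≤m+n 20 236)) ⟩
      ℕ→ℚ 256 * (square N * (R * (h₂ * h₂)))
        ≡⟨ regroup-h (ℕ→ℚ 256) (square N) R (h₂ * h₂) ⟩
      256n² N * R * (h₂ * h₂) ∎
      where
      regroup-h : ∀ a b c d → a * (b * (c * d)) ≡ a * b * c * d
      regroup-h = solve-∀ ℚ-ring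

    -- `Δ p g` is `U^ j (Δ p c')`, and `Δ` takes level d + 1 of the large cube to level d of the
    -- small one: the number j of raisings is unchanged and the degree falls by one.
    IH-Δ : ∀ p → s' * Q' * 4th k (Δ p g) ≤ R' * (2nd k (Δ p g) * 2nd k (Δ p g))
    IH-Δ p = subst₂ _≤_
      (trans (swap s' (4th k (U^ j (Δ p c'))) Q') (cong (s' * Q' *_) (S-cong k (λ x _ → cong (λ t →
          (t * t) * (t * t)) (sym (Δ-U^ j p c' x))))))
      (cong (λ t → R' * (t * t)) (S-cong k (λ x _ → cong (λ t → t * t) (sym (Δ-U^ j p c' x)))))
      (low-degree d j k k≡j+d d+k≤n' (Δ p c'))
      where
      swap : ∀ a b c → a * b * c ≡ a * c * b
      swap = solve-∀ ℚ-ring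

    μ = eigenvalue N (suc d) j

    -- In closed form the gap is (d + 1) (N - d), where d + 1 is the degree of g.
    0<gap : 0ℚ < ι (suc k) * (ι (suc n) - ι k) + ι (suc k) - μ
    0<gap = subst (0ℚ <_) gap≡ (*-pos (ι-pos d) (ℚₚ.+-mono-<-≤ 0<1ℚ (≤⇒0≤- (ι-mono (ℕₚ.≤-trans (ℕₚ.m≤m+n
        (suc d) (suc k)) d+k≤n)))))
      where
      factor : ∀ d j n → d * (1ℚ + ((1ℚ + n) - d)) ≡
        (j + d) * ((1ℚ + n) - (j + d)) + (j + d) - j * (((1ℚ + n) + 1ℚ) - (j + (d + d)))
      factor = solve-∀ ℚ-ring
      gap≡ : ι (suc d) * (1ℚ + (ι N - ι (suc d))) ≡ ι (suc k) * (ι (suc n) - ι k) + ι (suc k) - μ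
      gap≡ = trans (factor (ι (suc d)) (ι j) (ι (suc n)))
        (cong₂ (λ a b → a + b - μ)
          (trans (cong (λ t → t * (ι N - t)) (sym K≡)) (spread-suc n k)) (sym K≡))
        where
        K≡ : ι (suc k) ≡ ι j + ι (suc d)
        K≡ = trans (cong ι k≡) (ι-+ j (suc d))

    fourth-moment-g : ι 2 * (s' * Q' * g₄) ≤ ℕ→ℚ 9 * (R' * (g₂ * g₂))
    fourth-moment-g = Eigenfunction.fourth-moment k g μ
      (subst (λ k → U (D g) ≈[ k ] λ x → μ * g x) (sym k≡) (Harmonic.UD-eigen d c' harmonic j)) 0<gap
      (s' * Q') R' (*-nonneg (size-nonneg n k) (^-nonneg d (spread-nonneg k≤n))) (^-nonneg d (256n²-nonneg n))
          IH-Δ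

    -- The 5 of `f₄≤` is multiplied by 9 from `spread-suc^` and by 9/2 from `fourth-moment-g`, and
    -- 405/2 ≤ 256. Both sides are doubled to keep the numerals integral.
    g-bound : ℕ→ℚ 5 * (Q * (s * M) * g₄) ≤ 256n² N * R * (g₂ * g₂)
    g-bound = *-cancelˡ (ι 2) (ι-pos 1) (begin
      ι 2 * (ℕ→ℚ 5 * (Q * (s * M) * g₄))
        ≤⟨ *-monoˡ (ι 2) (ι-nonneg 2) (*-monoˡ (ℕ→ℚ 5) (numeral-nonneg 5) (*-monoʳ g₄ (4th-nonneg (suc k) g)
             (*-mono (^-nonneg d 0≤M) (*-nonneg (square-nonneg N) (size-nonneg n k)) (spread-suc^ d d≤k d+k≤n')
                 (size-spread n k)))) ⟩
      ι 2 * (ℕ→ℚ 5 * (ℕ→ℚ 9 * Q' * (square N * s') * g₄))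
        ≡⟨ regroup-g Q' (square N) s' g₄ ⟩
      ℕ→ℚ 45 * square N * (ι 2 * (s' * Q' * g₄))
        ≤⟨ *-monoˡ (ℕ→ℚ 45 * square N) (*-nonneg (numeral-nonneg 45) (square-nonneg N)) fourth-moment-g ⟩
      ℕ→ℚ 45 * square N * (ℕ→ℚ 9 * (R' * (g₂ * g₂)))
        ≡⟨ regroup-g′ (square N) R' (g₂ * g₂) ⟩
      ℕ→ℚ 405 * (square N * (R' * (g₂ * g₂)))
        ≤⟨ *-mono (numeral-nonneg 405) (*-nonneg (square-nonneg N) (*-nonneg (^-nonneg d (256n²-nonneg N))
            (sq-nonneg g₂)))
             (numeral-≤ (ℕₚ.m≤m+n 405 107))
             (*-monoˡ (square N) (square-nonneg N) (*-monoʳ (g₂ * g₂) (sq-nonneg g₂)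
               (^-mono d (256n²-nonneg n) (256n²-mono (ℕₚ.≤-trans (ℕₚ.n≤1+n n) (ℕₚ.n≤1+n (suc n))))))) ⟩
      ℕ→ℚ 512 * (square N * (R * (g₂ * g₂)))
        ≡⟨ regroup-g″ (square N) R (g₂ * g₂) ⟩
      ι 2 * (256n² N * R * (g₂ * g₂)) ∎)
      where
      regroup-g : ∀ q m s g → ι 2 * (ℕ→ℚ 5 * (ℕ→ℚ 9 * q * (m * s) * g)) ≡ ℕ→ℚ 45 * m * (ι 2 * (s * q * g))
      regroup-g = solve-∀ ℚ-ring
      regroup-g′ : ∀ m r g → ℕ→ℚ 45 * m * (ℕ→ℚ 9 * (r * g)) ≡ ℕ→ℚ 405 * (m * (r * g))
      regroup-g′ = solve-∀ ℚ-ring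
      regroup-g″ : ∀ m r g → ℕ→ℚ 512 * (m * (r * g)) ≡ ι 2 * (ℕ→ℚ 256 * m * r * g)
      regroup-g″ = solve-∀ ℚ-ring

  -- Functions of large degree

  ∑-squares-≤ : ∀ {A : Set} (xs : List A) (u : A → ℚ) → (∀ x → 0ℚ ≤ u x) → ∑ xs (λ x → u x * u x) ≤ ∑ xs u * ∑
      xs u
  ∑-squares-≤ []       u 0≤u = ℚₚ.≤-refl
  ∑-squares-≤ (x ∷ xs) u 0≤u = ≤-by _
    (+-nonneg (≤⇒0≤- (∑-squares-≤ xs u 0≤u)) (+-nonneg 0≤uv 0≤uv))
    (expand (u x) (∑ xs u) (∑ xs (λ x → u x * u x)))
    where
    0≤uv : 0ℚ ≤ u x * ∑ xs u
    0≤uv = *-nonneg (0≤u x) (∑-nonneg xs 0≤u)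
    expand : ∀ a s t → (a + s) * (a + s) ≡ (a * a + t) + ((s * s - t) + (a * s + a * s))
    expand = solve-∀ ℚ-ring

  4th≤2nd² : ∀ {n} k (f : Cube n → ℚ) → 4th k f ≤ 2nd k f * 2nd k f
  4th≤2nd² {n} k f = subst (_≤ 2nd k f * 2nd k f)
    (∑-cong (points n) (λ x → trans (regroup (δ (minuses x) k) (f x * f x)) (cong (_* ((f x * f x) *
        (f x * f x))) (δ-idem (minuses x) k))))
    (∑-squares-≤ (points n) (λ x → δ (minuses x) k * (f x * f x)) (λ x → *-nonneg (δ-nonneg (minuses x) k)
        (sq-nonneg (f x))))
    where
    regroup : ∀ d a → (d * a) * (d * a) ≡ (d * d) * (a * a)
    regroup = solve-∀ ℚ-ring

  size-0 : ∀ n → size n 0 ≡ 1ℚ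
  size-0 zero    = ∑-cube₀ _
  size-0 (suc n) = trans (S-ins-zero Fin.zero (λ _ → 1ℚ)) (size-0 n)

  size-n≤1 : ∀ n → size n n ≤ 1ℚ
  size-n≤1 zero    = ℚₚ.≤-reflexive (size-0 0)
  size-n≤1 (suc n) = ℚₚ.≤-trans
    -- Inserting a -1 at any of the n + 1 positions gives the same sum, so both sizes are equal
    -- after division by n + 1.
    (*-cancelˡ (ι (suc n)) (ι-pos n) (ℚₚ.≤-reflexive (trans (sym (∑-S-ins- n (λ _ → 1ℚ))) (∑-fins-const (suc n)
        (size n n)))))
    (size-n≤1 n)

  -- The hypotheses force l = min(k, n - k). Each step removes one sign of either kind, at the price
  -- 9 ≤ 256, until one kind is exhausted and the level is a single point.
  size-bound : ∀ l {n} k → l ℕ.≤ k → l ℕ.+ k ℕ.≤ n → l ≡ k ⊎ l ℕ.+ k ≡ n →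
    size n k * spread n k ^ l ≤ 256n² n ^ l
  size-bound zero {n} .0 _ _ (inj₁ refl) = ℚₚ.≤-reflexive (trans (ℚₚ.*-identityʳ (size n 0)) (size-0 n))
  size-bound zero k _ _ (inj₂ refl) = subst (_≤ 1ℚ) (sym (ℚₚ.*-identityʳ (size k k))) (size-n≤1 k)
  size-bound (suc l) {suc zero} (suc k) _ (ℕ.s≤s l+k≤0) _ =
    contradiction (trans (sym (ℕₚ.+-suc l k)) (ℕₚ.n≤0⇒n≡0 l+k≤0)) λ ()
  size-bound (suc l) {suc (suc n)} (suc k) (ℕ.s≤s l≤k) l+k≤n extreme = begin
    size N (suc k) * (M * M ^ l)
      ≡⟨ ℚₚ.*-assoc (size N (suc k)) M (M ^ l) ⟨
    size N (suc k) * M * M ^ l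
      ≤⟨ *-mono (*-nonneg (size-nonneg N (suc k)) 0≤M) (*-nonneg (ι-nonneg 9) (^-nonneg l (spread-nonneg k≤n)))
           (size-spread n k) (spread-suc^ l l≤k l+k≤n') ⟩
    square N * size n k * (ι 9 * spread n k ^ l)
      ≡⟨ regroup (square N) (size n k) (spread n k ^ l) ⟩
    ι 9 * (square N * (size n k * spread n k ^ l))
      ≤⟨ *-mono (ι-nonneg 9) (*-nonneg (square-nonneg N) (^-nonneg l (256n²-nonneg N))) 9≤256
           (*-monoˡ (square N) (square-nonneg N) (ℚₚ.≤-trans (size-bound l k l≤k l+k≤n' (extreme' extreme))
             (^-mono l (256n²-nonneg n) (256n²-mono (ℕₚ.≤-trans (ℕₚ.n≤1+n n) (ℕₚ.n≤1+n (suc n))))))) ⟩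
    ℕ→ℚ 256 * (square N * 256n² N ^ l)
      ≡⟨ ℚₚ.*-assoc (ℕ→ℚ 256) (square N) (256n² N ^ l) ⟨
    256n² N * 256n² N ^ l ∎
    where
    open ℚₚ.≤-Reasoning
    N = suc (suc n)
    M = spread N (suc k)
    9≤256 : ι 9 ≤ ℕ→ℚ 256
    9≤256 = numeral-≤ (ℕₚ.m≤m+n 9 247)
    l+k≤n' : l ℕ.+ k ℕ.≤ n
    l+k≤n' = ℕₚ.≤-pred (subst (ℕ._≤ suc n) (ℕₚ.+-suc l k) (ℕₚ.≤-pred l+k≤n))
    k≤n : k ℕ.≤ n
    k≤n = ℕₚ.≤-trans (ℕₚ.m≤n+m k l) l+k≤n'
    0≤M : 0ℚ ≤ M
    0≤M = spread-nonneg (ℕₚ.≤-trans (ℕₚ.m≤n+m (suc k) (suc l)) l+k≤n)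
    extreme' : suc l ≡ suc k ⊎ suc l ℕ.+ suc k ≡ N → l ≡ k ⊎ l ℕ.+ k ≡ n
    extreme' (inj₁ e) = inj₁ (ℕₚ.suc-injective e)
    extreme' (inj₂ e) = inj₂ (ℕₚ.suc-injective (trans (sym (ℕₚ.+-suc l k)) (ℕₚ.suc-injective e)))
    regroup : ∀ q s p → q * s * (ι 9 * p) ≡ ι 9 * (q * (s * p))
    regroup = solve-∀ ℚ-ring

  -- For an arbitrary function the fourth moment sum is at most the square of the second, so only
  -- the size must be absorbed. The first l factors do this by `size-bound`; the other e satisfy
  -- `M≤256n²`.
  large-degree : ∀ l e {n} k → l ℕ.≤ k → l ℕ.+ k ℕ.≤ n → l ≡ k ⊎ l ℕ.+ k ≡ n → (f : Cube n → ℚ) →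
    size n k * 4th k f * spread n k ^ (l ℕ.+ e) ≤ 256n² n ^ (l ℕ.+ e) * (2nd k f * 2nd k f)
  large-degree l e {n} k l≤k l+k≤n extreme f = begin
    size n k * 4th k f * M ^ (l ℕ.+ e)
      ≡⟨ trans (cong (size n k * 4th k f *_) (^-+ M l e)) (regroup (size n k) (4th k f) (M ^ l) (M ^ e)) ⟩
    (size n k * M ^ l) * M ^ e * 4th k f
      ≤⟨ *-mono (*-nonneg (*-nonneg (size-nonneg n k) (^-nonneg l 0≤M)) (^-nonneg e 0≤M)) (sq-nonneg (2nd k f))
           (*-mono (*-nonneg (size-nonneg n k) (^-nonneg l 0≤M)) (^-nonneg e (256n²-nonneg n))
             (size-bound l k l≤k l+k≤n extreme) (^-mono e 0≤M M≤256n²))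
           (4th≤2nd² k f) ⟩
    256n² n ^ l * 256n² n ^ e * (2nd k f * 2nd k f)
      ≡⟨ cong (_* (2nd k f * 2nd k f)) (^-+ (256n² n) l e) ⟨
    256n² n ^ (l ℕ.+ e) * (2nd k f * 2nd k f) ∎
    where
    open ℚₚ.≤-Reasoning
    M = spread n k
    k≤n : k ℕ.≤ n
    k≤n = ℕₚ.≤-trans (ℕₚ.m≤n+m k l) l+k≤n
    0≤M : 0ℚ ≤ M
    0≤M = spread-nonneg k≤n
    M≤256n² : M ≤ 256n² n
    M≤256n² = ℚₚ.≤-trans (spread≤square k≤n) (ℚₚ.≤-trans (ℚₚ.≤-reflexive (sym (ℚₚ.*-identityˡ (square n))))
      (*-monoʳ (square n) (square-nonneg n) (numeral-≤ {1} {256} (ℕ.s≤s ℕ.z≤n))))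
    regroup : ∀ s a p q → s * a * (p * q) ≡ (s * p) * q * a
    regroup = solve-∀ ℚ-ring

  -- Polynomials on the slice

  -- On level k = j + d this encodes degree at most d; the witness matters only on level d.
  Raised : ∀ {n} → ℕ → ℕ → (Cube n → ℚ) → Set
  Raised {n} j k f = ∃ λ (c : Cube n → ℚ) → f ≈[ k ] U^ j c

  -- If d ≤ min(k, m) there is a j with k = j + d and `low-degree` applies. Otherwise l = min(k, m)
  -- is at most d, and `large-degree` needs nothing about f.
  hypercontractive : ∀ {n} d k → k ℕ.≤ n → (f : Cube n → ℚ) → (∀ j → k ≡ j ℕ.+ d → Raised j k f) →
    size n k * 4th k f * spread n k ^ d ≤ 256n² n ^ d * (2nd k f * 2nd k f)
  hypercontractive {n} d k k≤n f raised = by-degree (ℕₚ.≤-total k m) (d ℕₚ.≤? k) (d ℕₚ.≤? m)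
    where
    m = n ℕ.∸ k
    m+k≡n : m ℕ.+ k ≡ n
    m+k≡n = ℕₚ.m∸n+n≡m k≤n
    Bound : ℕ → Set
    Bound d = size n k * 4th k f * spread n k ^ d ≤ 256n² n ^ d * (2nd k f * 2nd k f)
    small : d ℕ.≤ k → d ℕ.≤ m → Bound d
    small d≤k d≤m = subst₂ _≤_
      (cong (λ t → size n k * t * spread n k ^ d) (S-cong k (λ x e → cong (λ t → (t * t) * (t * t))
          (sym (f≈ x e)))))
      (cong (λ t → 256n² n ^ d * (t * t)) (S-cong k (λ x e → cong (λ t → t * t) (sym (f≈ x e)))))
      (low-degree d (k ℕ.∸ d) k k≡ (subst (d ℕ.+ k ℕ.≤_) m+k≡n (ℕₚ.+-monoˡ-≤ k d≤m)) (proj₁ r))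
      where
      k≡ : k ≡ k ℕ.∸ d ℕ.+ d
      k≡ = sym (ℕₚ.m∸n+n≡m d≤k)
      r = raised (k ℕ.∸ d) k≡
      f≈ = proj₂ r
    large : ∀ l → l ℕ.≤ k → l ℕ.≤ m → l ≡ k ⊎ l ℕ.+ k ≡ n → l ℕ.≤ d → Bound d
    large l l≤k l≤m extreme l≤d = subst Bound (ℕₚ.m+[n∸m]≡n l≤d)
      (large-degree l (d ℕ.∸ l) k l≤k (subst (l ℕ.+ k ℕ.≤_) m+k≡n (ℕₚ.+-monoˡ-≤ k l≤m)) extreme f)
    by-degree : k ℕ.≤ m ⊎ m ℕ.≤ k → _ → _ → Bound d
    by-degree _          (yes d≤k) (yes d≤m) = small d≤k d≤m
    by-degree (inj₁ k≤m) (no  d≰k) _         = large k ℕₚ.≤-refl k≤m (inj₁ refl) (ℕₚ.≰⇒≥ d≰k)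
    by-degree (inj₁ k≤m) (yes d≤k) (no  d≰m) = contradiction (ℕₚ.≤-trans d≤k k≤m) d≰m
    by-degree (inj₂ m≤k) _         (no  d≰m) = large m m≤k ℕₚ.≤-refl (inj₂ m+k≡n) (ℕₚ.≰⇒≥ d≰m)
    by-degree (inj₂ m≤k) (no  d≰k) (yes d≤m) = contradiction (ℕₚ.≤-trans d≤m m≤k) d≰k

  bit : Sign → ℚ
  bit Sign.+ = 0ℚ
  bit Sign.- = 1ℚ

  X : ∀ {n} → Fin n → Cube n → ℚ
  X i x = bit (Vec.lookup x i)

  -- The summand of `U` at coordinate i.
  V : ∀ {n} → Fin n → (Cube n → ℚ) → Cube n → ℚ
  V Fin.zero    c (+∷ x)  = 0ℚ
  V Fin.zero    c (-∷ x)  = c (+∷ x)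
  V (Fin.suc i) c (s ∷ x) = V i (λ y → c (s ∷ y)) x

  V-+ : ∀ {n} i (f g : Cube n → ℚ) x → V i (λ y → f y + g y) x ≡ V i f x + V i g x
  V-+ Fin.zero    f g (+∷ x)  = refl
  V-+ Fin.zero    f g (-∷ x)  = refl
  V-+ (Fin.suc i) f g (s ∷ x) = V-+ i _ _ x

  -- A move of `U` changes `X i` only at coordinate i itself, where it goes from 1 to 0. That move
  -- is missing from the first term on the right and is restored by `V i`.
  X-U : ∀ {n} i (c : Cube n → ℚ) x → X i x * U c x ≡ U (λ y → X i y * c y) x + V i c x
  X-U Fin.zero c (+∷ x) = trans (ring (U (λ y → c (+∷ y)) x)) (cong (_+ 0ℚ) (sym (U-*ˡ 0ℚ _ x)))
    where
    ring : ∀ a → 0ℚ * a ≡ 0ℚ * a + 0ℚ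
    ring = solve-∀ ℚ-ring
  X-U Fin.zero c (-∷ x) = trans (ring (c (+∷ x)) (U (λ y → c (-∷ y)) x))
    (cong (λ t → (0ℚ * c (+∷ x) + t) + c (+∷ x)) (sym (U-*ˡ 1ℚ _ x)))
    where
    ring : ∀ a b → 1ℚ * (a + b) ≡ (0ℚ * a + 1ℚ * b) + a
    ring = solve-∀ ℚ-ring
  X-U (Fin.suc i) c (+∷ x) = X-U i _ x
  X-U (Fin.suc i) c (-∷ x) = trans (ℚₚ.*-distribˡ-+ (X i x) (c (+∷ x)) _)
    (trans (cong (X i x * c (+∷ x) +_) (X-U i _ x)) (sym (ℚₚ.+-assoc (X i x * c (+∷ x)) _ _)))

  -- Moves at different coordinates commute, and a sign already turned to +1 cannot be turned again.
  V-U : ∀ {n} i (c : Cube n → ℚ) x → V i (U c) x ≡ U (V i c) x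
  V-U Fin.zero c (+∷ x) = sym (trans (U-*ˡ 0ℚ (λ _ → 0ℚ) x) (ℚₚ.*-zeroˡ (U (λ _ → 0ℚ) x)))
  V-U Fin.zero c (-∷ x) = sym (ℚₚ.+-identityˡ _)
  V-U (Fin.suc i) c (+∷ x) = V-U i _ x
  V-U (Fin.suc i) c (-∷ x) = trans (V-+ i _ _ x) (cong (V i (λ y → c (+∷ y)) x +_) (V-U i _ x))

  V-U^ : ∀ {n} j i (c : Cube n → ℚ) x → V i (U^ j c) x ≡ U^ j (V i c) x
  V-U^ zero    i c x = refl
  V-U^ (suc j) i c x = trans (V-U i (U^ j c) x) (U-cong (V-U^ j i c) x)

  -- As in the derivative of a power, passing `X i` through j + 1 copies of `U` leaves j + 1 equal
  -- terms, because the commutator `V i` commutes with `U`.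
  X-U^ : ∀ {n} j i (c : Cube n → ℚ) x →
    X i x * U^ (suc j) c x ≡ 1ℚ * U^ (suc j) (λ y → X i y * c y) x + ι (suc j) * U^ j (V i c) x
  X-U^ zero    i c x = trans (X-U i c x) (ring (U (λ y → X i y * c y) x) (V i c x))
    where
    ring : ∀ a b → a + b ≡ 1ℚ * a + (1ℚ + 0ℚ) * b
    ring = solve-∀ ℚ-ring
  X-U^ (suc j) i c x = begin
    X i x * U (U^ (suc j) c) x
      ≡⟨ X-U i (U^ (suc j) c) x ⟩
    U (λ y → X i y * U^ (suc j) c y) x + V i (U^ (suc j) c) x
      ≡⟨ cong₂ _+_ (trans (U-cong (X-U^ j i c) x) (U-linear 1ℚ (ι (suc j)) _ _ x)) (V-U^ (suc j) i c x) ⟩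
    (1ℚ * P + ι (suc j) * Q) + Q
      ≡⟨ collect P Q (ι (suc j)) ⟩
    1ℚ * P + ι (suc (suc j)) * Q ∎
    where
    open ≡-Reasoning
    P = U^ (suc (suc j)) (λ y → X i y * c y) x
    Q = U^ (suc j) (V i c) x
    collect : ∀ p q a → (1ℚ * p + a * q) + q ≡ 1ℚ * p + (1ℚ + a) * q
    collect = solve-∀ ℚ-ring

  raised-1 : ∀ {n} k → Raised {n} k k (λ _ → 1ℚ)
  raised-1 zero    = (λ _ → 1ℚ) , λ _ _ → refl
  -- The scalar s is 1 / (k + 1), as `U` of the constant 1 is k + 1 on this level. The term with
  -- coefficient 0 only gives the witness the shape of `U^-linear`.
  raised-1 {n} (suc k) = (λ x → s * c x + 0ℚ * c x) , λ x level → begin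
    1ℚ
      ≡⟨ s-inverse ⟨
    ι (suc k) * s
      ≡⟨ cong (_* s) (trans (cong ι (sym level)) (sym (U-1 x))) ⟩
    U (λ _ → 1ℚ) x * s
      ≡⟨ ring (U (λ _ → 1ℚ) x) s ⟩
    s * U (λ _ → 1ℚ) x + 0ℚ * U (λ _ → 1ℚ) x
      ≡⟨ cong (λ t → s * t + 0ℚ * t) (U-level k 1≈ x level) ⟩
    s * U^ (suc k) c x + 0ℚ * U^ (suc k) c x
      ≡⟨ U^-linear (suc k) s 0ℚ c c x ⟨
    U^ (suc k) (λ x → s * c x + 0ℚ * c x) x ∎
    where
    open ≡-Reasoning
    c = proj₁ (raised-1 {n} k)
    1≈ = proj₂ (raised-1 {n} k)
    s = proj₁ (inverse (ι-pos k))
    s-inverse = proj₂ (inverse (ι-pos k))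
    ring : ∀ a s → a * s ≡ s * a + 0ℚ * a
    ring = solve-∀ ℚ-ring

  raised-linear : ∀ {n} j k a b {f g : Cube n → ℚ} → Raised j k f → Raised j k g → Raised j k (λ x →
      a * f x + b * g x)
  raised-linear j k a b (c , f≈) (e , g≈) = (λ x → a * c x + b * e x) , λ x level →
    trans (cong₂ (λ s t → a * s + b * t) (f≈ x level) (g≈ x level)) (sym (U^-linear j a b c e x))

  raised-pred : ∀ {n} j k {f : Cube n → ℚ} → Raised (suc j) k f → Raised j k f
  raised-pred j k (c , f≈) = U c , λ x level → trans (f≈ x level) (sym (U^-U j c x))

  raised-drop : ∀ {n} i j k {f : Cube n → ℚ} → Raised (i ℕ.+ j) k f → Raised j k f
  raised-drop zero    j k r = r
  raised-drop (suc i) j k r = raised-drop i j k (raised-pred (i ℕ.+ j) k r)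

  -- Multiplication by a coordinate function raises the degree by at most one: both terms of `X-U^`
  -- lie in the image of `U^ j`.
  raised-X : ∀ {n} j k i {f : Cube n → ℚ} → Raised (suc j) k f → Raised j k (λ x → X i x * f x)
  raised-X j k i (c , f≈) = (λ x → 1ℚ * U (λ y → X i y * c y) x + ι (suc j) * V i c x) , λ x level → begin
    X i x * _
      ≡⟨ cong (X i x *_) (f≈ x level) ⟩
    X i x * U^ (suc j) c x
      ≡⟨ X-U^ j i c x ⟩
    1ℚ * U^ (suc j) (λ y → X i y * c y) x + ι (suc j) * U^ j (V i c) x
      ≡⟨ cong (λ t → 1ℚ * t + ι (suc j) * U^ j (V i c) x) (U^-U j (λ y → X i y * c y) x) ⟨
    1ℚ * U^ j (U (λ y → X i y * c y)) x + ι (suc j) * U^ j (V i c) x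
      ≡⟨ U^-linear j 1ℚ (ι (suc j)) _ _ x ⟨
    U^ j (λ x → 1ℚ * U (λ y → X i y * c y) x + ι (suc j) * V i c x) x ∎
    where open ≡-Reasoning

  module Polynomial {n : ℕ} (y : Sign → ℚ) where

    -- The recursion consumes the coordinates of the subset while ρ keeps track of their positions
    -- in the full point x, so that every intermediate monomial is a function on the same cube.
    monomialℚ : ∀ {m} → Subset m → (Fin m → Fin n) → Cube n → ℚ
    monomialℚ []          ρ x = 1ℚ
    monomialℚ (true  ∷ T) ρ x = y (Vec.lookup x (ρ Fin.zero)) * monomialℚ T (ρ ∘ Fin.suc) x
    monomialℚ (false ∷ T) ρ x = monomialℚ T (ρ ∘ Fin.suc) x

    evalℚ : (Subset n → ℚ) → Cube n → ℚ
    evalℚ f x = ∑ (subsets n) (λ T → f T * monomialℚ T (λ i → i) x)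

    -- A function of one sign is affine in its indicator: y(s) = y(+) + (y(-) - y(+)) `bit` s. Each
    -- factor thus adds one to the degree, whatever the two values of y are.
    raised-monomial : ∀ {m} (T : Subset m) ρ j k → k ≡ j ℕ.+ ∣ T ∣ → Raised j k (monomialℚ T ρ)
    raised-monomial []          ρ j k k≡ = subst (λ j → Raised j k (λ _ → 1ℚ)) (trans k≡ (ℕₚ.+-identityʳ j))
        (raised-1 k)
    raised-monomial (false ∷ T) ρ j k k≡ = raised-monomial T (ρ ∘ Fin.suc) j k k≡
    raised-monomial (true ∷ T)  ρ j k k≡ = c , λ x level → trans (split (Vec.lookup x i) (monomialℚ T
        (ρ ∘ Fin.suc) x)) (c≈ x level)
      where
      i = ρ Fin.zero
      IH = raised-monomial T (ρ ∘ Fin.suc) (suc j) k (trans k≡ (ℕₚ.+-suc j ∣ T ∣))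
      product = raised-linear j k (y Sign.+) (y Sign.- - y Sign.+) (raised-pred j k IH) (raised-X j k i IH)
      c = proj₁ product
      c≈ = proj₂ product
      at+ : ∀ a b m → a * m ≡ a * m + (b - a) * (0ℚ * m)
      at+ = solve-∀ ℚ-ring
      at- : ∀ a b m → b * m ≡ a * m + (b - a) * (1ℚ * m)
      at- = solve-∀ ℚ-ring
      split : ∀ s m → y s * m ≡ y Sign.+ * m + (y Sign.- - y Sign.+) * (bit s * m)
      split Sign.+ m = at+ (y Sign.+) (y Sign.-) m
      split Sign.- m = at- (y Sign.+) (y Sign.-) m

    raised-eval : ∀ d (f : Subset n → ℚ) → (∀ T → d ℕ.< ∣ T ∣ → f T ≡ 0ℚ) → ∀ j k → k ≡ j ℕ.+ d → Raised j k
        (evalℚ f)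
    raised-eval d f degree j k k≡ = raised-∑ (subsets n)
      where
      zero-term : Raised {n} j k (λ _ → 0ℚ)
      zero-term = (λ x → 0ℚ * 0ℚ + 0ℚ * 0ℚ) , λ x level →
        sym (trans (U^-linear j 0ℚ 0ℚ (λ _ → 0ℚ) (λ _ → 0ℚ) x) (ring (U^ {n} j (λ _ → 0ℚ) x)))
        where
        ring : ∀ a → 0ℚ * a + 0ℚ * a ≡ 0ℚ
        ring = solve-∀ ℚ-ring
      term : ∀ T → Raised j k (λ x → f T * monomialℚ T (λ i → i) x)
      term T with ∣ T ∣ ℕₚ.≤? d
      ... | yes T≤d = proj₁ scaled , λ x level → trans (ring (f T) (monomialℚ T (λ i → i) x))
          (proj₂ scaled x level)
        where
        k≡′ : k ≡ (d ℕ.∸ ∣ T ∣ ℕ.+ j) ℕ.+ ∣ T ∣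
        k≡′ = trans k≡ (trans (cong (j ℕ.+_) (sym (ℕₚ.m∸n+n≡m T≤d)))
          (trans (sym (ℕₚ.+-assoc j (d ℕ.∸ ∣ T ∣) ∣ T ∣)) (cong (ℕ._+ ∣ T ∣) (ℕₚ.+-comm j (d ℕ.∸ ∣ T ∣)))))
        -- A monomial of degree below d is raised more than j times; the extra raisings go into the
        -- witness.
        r = raised-drop (d ℕ.∸ ∣ T ∣) j k (raised-monomial T (λ i → i) _ k k≡′)
        scaled = raised-linear j k (f T) 0ℚ r r
        ring : ∀ a m → a * m ≡ a * m + 0ℚ * m
        ring = solve-∀ ℚ-ring
      ... | no T≰d = proj₁ zero-term , λ x level →
        trans (trans (cong (_* monomialℚ T (λ i → i) x) (degree T (ℕₚ.≰⇒> T≰d))) (ℚₚ.*-zeroˡ (monomialℚ T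
            (λ i → i) x))) (proj₂ zero-term x level)
      raised-∑ : ∀ Ts → Raised j k (λ x → ∑ Ts (λ T → f T * monomialℚ T (λ i → i) x))
      raised-∑ []       = zero-term
      raised-∑ (T ∷ Ts) = proj₁ sum , λ x level → trans (ring (f T * monomialℚ T (λ i → i) x) _)
          (proj₂ sum x level)
        where
        sum = raised-linear j k 1ℚ 1ℚ (term T) (raised-∑ Ts)
        ring : ∀ a b → a + b ≡ 1ℚ * a + 1ℚ * b
        ring = solve-∀ ℚ-ring

    eval-hypercontractive : ∀ d k → k ℕ.≤ n → (f : Subset n → ℚ) → (∀ T → d ℕ.< ∣ T ∣ → f T ≡ 0ℚ) →
      size n k * 4th k (evalℚ f) * spread n k ^ d ≤ 256n² n ^ d * (2nd k (evalℚ f) * 2nd k (evalℚ f))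
    eval-hypercontractive d k k≤n f degree = hypercontractive d k k≤n (evalℚ f) (λ j → raised-eval d f degree j
        k)

  -- The slice as a level of the cube, and the size of the constant

  ι-mono-< : ∀ {m n} → m ℕ.< n → ι m < ι n
  ι-mono-< {m} {n} m<n = ℚₚ.<-≤-trans
    (subst (_< 1ℚ + ι m) (ℚₚ.+-identityˡ (ι m)) (ℚₚ.+-monoˡ-< (ι m) 0<1ℚ)) (ι-mono m<n)

  2ι-injective : ∀ {m n} → ι m + ι m ≡ ι n + ι n → m ≡ n
  2ι-injective {m} {n} e with ℕₚ.<-cmp m n
  ... | tri< m<n _ _ = contradiction (ℚₚ.+-mono-< (ι-mono-< m<n) (ι-mono-< m<n)) (ℚₚ.<-irrefl e)
  ... | tri≈ _ m≡n _ = m≡n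
  ... | tri> _ _ m>n = contradiction (ℚₚ.+-mono-< (ι-mono-< m>n) (ι-mono-< m>n)) (ℚₚ.<-irrefl (sym e))

  coordinateSum≡ : ∀ {n} (x : Cube n) → coordinateSum x ≡ ι n - (ι (minuses x) + ι (minuses x))
  coordinateSum≡ []       = refl
  coordinateSum≡ {suc n} (+∷ x) = trans (cong (1ℚ +_) (coordinateSum≡ x)) (ring (ι n) (ι (minuses x)))
    where
    ring : ∀ n m → 1ℚ + (n - (m + m)) ≡ (1ℚ + n) - (m + m)
    ring = solve-∀ ℚ-ring
  coordinateSum≡ {suc n} (-∷ x) = trans (cong (- 1ℚ +_) (coordinateSum≡ x)) (ring (ι n) (ι (minuses x)))
    where
    ring : ∀ n m → - 1ℚ + (n - (m + m)) ≡ (1ℚ + n) - ((1ℚ + m) + (1ℚ + m))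
    ring = solve-∀ ℚ-ring

  δ-≡ : ∀ a → δ a a ≡ 1ℚ
  δ-≡ zero    = refl
  δ-≡ (suc a) = δ-≡ a

  δ-≢ : ∀ {a b} → a ≢ b → δ a b ≡ 0ℚ
  δ-≢ {a} {b} a≢b with a ≡ᵇ b | ℕₚ.≡ᵇ⇒≡ a b
  ... | true  | e = contradiction (e _) a≢b
  ... | false | _ = refl

  ∑-filter : ∀ {n} {P : Cube n → Set} (P? : Decidable P) k → (∀ x → P x → minuses x ≡ k) →
      (∀ x → minuses x ≡ k → P x) →
    (xs : List (Cube n)) → ∀ F → ∑ (List.filter P? xs) F ≡ ∑ xs (λ x → δ (minuses x) k * F x)
  ∑-filter P? k to from []       F = refl
  ∑-filter P? k to from (x ∷ xs) F with P? x
  ... | yes px = cong₂ _+_ (sym (trans (cong (λ m → δ m k * F x) (to x px)) (trans (cong (_* F x) (δ-≡ k))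
      (ℚₚ.*-identityˡ (F x)))))
    (∑-filter P? k to from xs F)
  ... | no ¬px = trans (∑-filter P? k to from xs F) (sym (trans
    (cong (_+ rest) (trans (cong (_* F x) (δ-≢ (λ e → ¬px (from x e)))) (ℚₚ.*-zeroˡ (F x))))
        (ℚₚ.+-identityˡ rest)))
    where rest = ∑ xs (λ x → δ (minuses x) k * F x)

  integer⇒natural : ∀ {q} → 0ℚ ≤ q → IsInteger q → ∃ λ k → ι k ≡ q
  integer⇒natural 0≤q (ℤ.+ k , e) = k , trans (sym (ℕ→ℚ≡ι k)) (sym e)
  integer⇒natural 0≤q (ℤ.-[1+ k ] , e) = contradiction
    (ℚₚ.≤-<-trans (subst (0ℚ ≤_) e 0≤q) (ℚₚ.neg-antimono-< (subst (0ℚ <_) (sym (ℕ→ℚ≡ι (suc k))) (ι-pos k))))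
    (ℚₚ.<-irrefl refl)

  module Slice (p : ℚ) (0<p : 0ℚ < p) (p<1 : p < 1ℚ) (n : ℕ) (1≤n : 1 ℕ.≤ n) (pn∈ℤ : IsInteger (p * ℕ→ℚ n))
      where

    private
      0<n : 0ℚ < ι n
      0<n = ℚₚ.<-≤-trans (ι-pos 0) (ι-mono 1≤n)

      0<pn : 0ℚ < p * ι n
      0<pn = *-pos 0<p 0<n

      natural : ∃ λ k → ι k ≡ p * ι n
      natural = integer⇒natural (ℚₚ.<⇒≤ 0<pn) (subst (λ t → IsInteger (p * t)) (ℕ→ℚ≡ι n) pn∈ℤ)

    k : ℕ
    k = proj₁ natural

    ιk≡pn : ι k ≡ p * ι n
    ιk≡pn = proj₂ natural

    k≤n : k ℕ.≤ n
    k≤n = ℕₚ.≮⇒≥ λ n<k → ℚₚ.<-irrefl refl (ℚₚ.<-trans (ι-mono-< n<k)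
      (subst₂ _<_ (sym ιk≡pn) (ℚₚ.*-identityˡ (ι n)) (ℚₚ.*-monoˡ-<-pos (ι n) {{ℚ.positive 0<n}} p<1)))

    spread≡ : spread n k ≡ p * (1ℚ - p) * square n
    spread≡ = trans (cong (λ t → t * (ι n - t)) ιk≡pn) (ring p (ι n))
      where
      ring : ∀ p n → p * n * (n - p * n) ≡ p * (1ℚ - p) * (n * n)
      ring = solve-∀ ℚ-ring

    0<spread : 0ℚ < spread n k
    0<spread = subst (0ℚ <_) (sym spread≡) (*-pos (*-pos 0<p (subst (_< 1ℚ - p) (ℚₚ.+-inverseʳ p) (ℚₚ.+-monoˡ-<
        (- p) p<1))) (*-pos 0<n 0<n))

    -- The coordinate sum is n minus twice the number of minus signs, so prescribing (1 - 2p) n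
    -- prescribes p n minus signs.
    ∑-slice : ∀ F → ∑ (slice p n) F ≡ S k F
    ∑-slice F = trans (∑-filter (λ x → coordinateSum x ℚₚ.≟ (1ℚ - ℕ→ℚ 2 * p) * ℕ→ℚ n) k to from (cube n) F)
      (cong (λ xs → ∑ xs (λ x → δ (minuses x) k * F x)) (sym (points≡cube n)))
      where
      ring : ∀ p n → (1ℚ - ℕ→ℚ 2 * p) * n ≡ n - (p * n + p * n)
      ring = solve-∀ ℚ-ring
      target : (1ℚ - ℕ→ℚ 2 * p) * ℕ→ℚ n ≡ ι n - (ι k + ι k)
      target = trans (cong ((1ℚ - ℕ→ℚ 2 * p) *_) (ℕ→ℚ≡ι n)) (trans (ring p (ι n)) (cong (λ t → ι n - (t + t))
          (sym ιk≡pn)))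
      cancel : ∀ n a → a ≡ n - (n - a)
      cancel = solve-∀ ℚ-ring
      to : ∀ x → coordinateSum x ≡ (1ℚ - ℕ→ℚ 2 * p) * ℕ→ℚ n → minuses x ≡ k
      to x e = 2ι-injective (trans (cancel (ι n) _) (trans
        (cong (λ t → ι n - t) (trans (sym (coordinateSum≡ x)) (trans e target))) (sym (cancel (ι n)
            (ι k + ι k)))))
      from : ∀ x → minuses x ≡ k → coordinateSum x ≡ (1ℚ - ℕ→ℚ 2 * p) * ℕ→ℚ n
      from x e = trans (coordinateSum≡ x) (trans (cong (λ m → ι n - (ι m + ι m)) e) (sym target))

  -- For a = (1 − p)/p the left side is 1 / (p (1 − p)).
  reciprocal-bound : ∀ {a b} → 0ℚ ≤ a → 0ℚ ≤ b → a * b ≡ 1ℚ →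
    a + b + ι 2 ≤ (a * a + b * b) * (a * a + b * b)
  reciprocal-bound {a} {b} 0≤a 0≤b ab≡1 = begin
    -- With a b = 1 both s and t are at least 2, and t² = s + 2 links the two halves of the chain.
    t + ι 2       ≤⟨ ℚₚ.+-monoʳ-≤ t 2≤t ⟩
    t + t         ≡⟨ double t ⟩
    ι 2 * t       ≤⟨ *-monoʳ t 0≤t 2≤t ⟩
    t * t         ≡⟨ t² ⟩
    s + ι 2       ≤⟨ ℚₚ.+-monoʳ-≤ s 2≤s ⟩
    s + s         ≡⟨ double s ⟩
    ι 2 * s       ≤⟨ *-monoʳ s (ℚₚ.≤-trans (ι-nonneg 2) 2≤s) 2≤s ⟩
    s * s         ∎
    where
    open ℚₚ.≤-Reasoning
    s = a * a + b * b
    t = a + b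
    0≤t : 0ℚ ≤ t
    0≤t = +-nonneg 0≤a 0≤b
    double : ∀ x → x + x ≡ ι 2 * x
    double = solve-∀ ℚ-ring
    t² : t * t ≡ s + ι 2
    t² = trans (expand a b) (trans (cong (λ r → s + ι 2 * r) ab≡1) (cong (s +_) (ℚₚ.*-identityʳ (ι 2))))
      where
      expand : ∀ a b → (a + b) * (a + b) ≡ (a * a + b * b) + ι 2 * (a * b)
      expand = solve-∀ ℚ-ring
    2≤s : ι 2 ≤ s
    2≤s = ≤-by _ (sq-nonneg (a - b)) (trans (expand a b) (cong (λ r → ι 2 * r + (a - b) * (a - b)) ab≡1))
      where
      expand : ∀ a b → a * a + b * b ≡ ι 2 * (a * b) + (a - b) * (a - b)
      expand = solve-∀ ℚ-ring
    2≤t : ι 2 ≤ t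
    2≤t = sq-cancel-≤ 0≤t (subst (ι 2 * ι 2 ≤_) (sym t²) (ℚₚ.+-monoˡ-≤ (ι 2) 2≤s))

  -- Here u = 1/p and v = 1/q, and 1 = (p + q)² = p q (q/p + p/q + 2), to which `reciprocal-bound`
  -- applies.
  variance-bound : ∀ {p q u v} → 0ℚ < p → 0ℚ < q → p + q ≡ 1ℚ → p * u ≡ 1ℚ → q * v ≡ 1ℚ →
    1ℚ ≤ p * q * (((q * u) * (q * u) + (p * v) * (p * v)) * ((q * u) * (q * u) + (p * v) * (p * v)))
  variance-bound {p} {q} {u} {v} 0<p 0<q p+q≡1 pu≡1 qv≡1 = begin
    1ℚ
      ≡⟨ trans (cong (λ t → t * t) p+q≡1) (ℚₚ.*-identityˡ 1ℚ) ⟨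
    (p + q) * (p + q)
      ≡⟨ square-sum p q ⟩
    q * q * 1ℚ + p * p * 1ℚ + ι 2 * (p * q)
      ≡⟨ cong₂ (λ α β → q * q * α + p * p * β + ι 2 * (p * q)) pu≡1 qv≡1 ⟨
    q * q * (p * u) + p * p * (q * v) + ι 2 * (p * q)
      ≡⟨ collect p q u v ⟩
    p * q * (q * u + p * v + ι 2)
      ≤⟨ *-monoˡ (p * q) (ℚₚ.<⇒≤ (*-pos 0<p 0<q)) (reciprocal-bound 0≤a 0≤b ab≡1) ⟩
    p * q * (((q * u) * (q * u) + (p * v) * (p * v)) * ((q * u) * (q * u) + (p * v) * (p * v))) ∎
    where
    open ℚₚ.≤-Reasoning
    square-sum : ∀ p q → (p + q) * (p + q) ≡ q * q * 1ℚ + p * p * 1ℚ + ι 2 * (p * q)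
    square-sum = solve-∀ ℚ-ring
    collect : ∀ p q u v → q * q * (p * u) + p * p * (q * v) + ι 2 * (p * q) ≡ p * q * (q * u + p * v + ι 2)
    collect = solve-∀ ℚ-ring
    reciprocal-nonneg : ∀ {x y} → 0ℚ < x → x * y ≡ 1ℚ → 0ℚ ≤ y
    reciprocal-nonneg {x} {y} 0<x xy≡1 = *-cancelˡ x 0<x
      (subst₂ _≤_ (sym (ℚₚ.*-zeroʳ x)) (sym xy≡1) (ℚₚ.<⇒≤ 0<1ℚ))
    0≤a : 0ℚ ≤ q * u
    0≤a = *-nonneg (ℚₚ.<⇒≤ 0<q) (reciprocal-nonneg 0<p pu≡1)
    0≤b : 0ℚ ≤ p * v
    0≤b = *-nonneg (ℚₚ.<⇒≤ 0<p) (reciprocal-nonneg 0<q qv≡1)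
    interchange : ∀ p q u v → (q * u) * (p * v) ≡ (p * u) * (q * v)
    interchange = solve-∀ ℚ-ring
    ab≡1 : (q * u) * (p * v) ≡ 1ℚ
    ab≡1 = trans (interchange p q u v) (trans (cong₂ _*_ pu≡1 qv≡1) (ℚₚ.*-identityˡ 1ℚ))

  -- The numerator r satisfies q M² < (r + 1)², so q ≥ 1 gives M < r + 1.
  1≤√ : ∀ {q} → 1ℚ ≤ q → ∀ m → 1ℚ ≤ √-approx q m
  1≤√ {q} 1≤q m = ℚₚ.toℚᵘ-cancel-≤ (ℚᵘₚ.≤-respʳ-≃ (ℚᵘₚ.≃-sym (ℚₚ.toℚᵘ-fromℚᵘ (ℚᵘ.mkℚᵘ (ℤ.+ r) m)))
    (ℚᵘ.*≤* (subst₂ ℤ._≤_ (sym (ℤₚ.*-identityˡ (ℤ.+ suc m))) (sym (ℤₚ.*-identityʳ (ℤ.+ r))) (ℤ.+≤+ M≤r))))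
    where
    r = √-numerator q m
    M = suc m
    ↧≤↥ : ℚ.↧ₙ q ℕ.≤ ℤ.∣ ℚ.↥ q ∣
    ↧≤↥ = to-ℕ (ℚ.↥ q) (subst₂ ℤ._≤_ (ℤₚ.*-identityˡ (ℚ.↧ q)) (ℤₚ.*-identityʳ (ℚ.↥ q)) (ℚₚ.drop-*≤* 1≤q))
      where
      to-ℕ : ∀ i {d} → ℤ.+ d ℤ.≤ i → d ℕ.≤ ℤ.∣ i ∣
      to-ℕ (ℤ.+ _) (ℤ.+≤+ d≤i) = d≤i
    M²<[1+r]² : M ℕ.* M ℕ.< suc r ℕ.* suc r
    M²<[1+r]² = ℕₚ.*-cancelʳ-< (ℚ.↧ₙ q) _ _ (ℕₚ.≤-<-trans
      (subst (M ℕ.* M ℕ.* ℚ.↧ₙ q ℕ.≤_) (ℕₚ.*-comm (M ℕ.* M) ℤ.∣ ℚ.↥ q ∣) (ℕₚ.*-monoʳ-≤ (M ℕ.* M) ↧≤↥))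
          (√-upper q m))
    M≤r : M ℕ.≤ r
    M≤r = ℕₚ.≤-pred (ℕₚ.≰⇒> λ 1+r≤M → ℕₚ.<⇒≱ M²<[1+r]² (ℕₚ.*-mono-≤ 1+r≤M 1+r≤M))

  -- w is 1 / s, or 0 if the slice is empty.
  normalise : ∀ d {w s s₂ s₄ P Q G C} → 0ℚ < P → 0ℚ ≤ Q → 0ℚ ≤ G → 1ℚ ≤ C → Q ≤ P * G → w * w * s ≡ w →
    s * s₄ * P ^ d ≤ Q ^ d * (s₂ * s₂) → w * s₄ ≤ C * G ^ d * ((w * s₂) * (w * s₂))
  normalise d {w} {s} {s₂} {s₄} {P} {Q} {G} {C} 0<P 0≤Q 0≤G 1≤C Q≤PG w²s≡w bound = begin
    w * s₄
      ≡⟨ cong (_* s₄) w²s≡w ⟨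
    w * w * s * s₄
      ≡⟨ ℚₚ.*-assoc (w * w) s s₄ ⟩
    w * w * (s * s₄)
      ≤⟨ *-monoˡ (w * w) (sq-nonneg w) (ℚₚ.≤-trans sums (*-monoʳ (s₂ * s₂) (sq-nonneg s₂) Gᵈ≤CGᵈ)) ⟩
    w * w * (C * G ^ d * (s₂ * s₂))
      ≡⟨ regroup w (C * G ^ d) s₂ ⟩
    C * G ^ d * ((w * s₂) * (w * s₂)) ∎
    where
    open ℚₚ.≤-Reasoning
    regroup : ∀ w c s → w * w * (c * (s * s)) ≡ c * ((w * s) * (w * s))
    regroup = solve-∀ ℚ-ring
    ^-pos : ∀ d → 0ℚ < P ^ d
    ^-pos zero    = 0<1ℚ
    ^-pos (suc d) = *-pos 0<P (^-pos d)
    Gᵈ≤CGᵈ : G ^ d ≤ C * G ^ d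
    Gᵈ≤CGᵈ = subst (_≤ C * G ^ d) (ℚₚ.*-identityˡ (G ^ d)) (*-monoʳ (G ^ d) (^-nonneg d 0≤G) 1≤C)
    sums : s * s₄ ≤ G ^ d * (s₂ * s₂)
    -- The quotient Q / P is replaced by its bound G only after multiplying by P^d, so no division
    -- occurs.
    sums = *-cancelˡ (P ^ d) (^-pos d) (begin
      P ^ d * (s * s₄)              ≡⟨ ℚₚ.*-comm (P ^ d) (s * s₄) ⟩
      s * s₄ * P ^ d                ≤⟨ bound ⟩
      Q ^ d * (s₂ * s₂)             ≤⟨ *-monoʳ (s₂ * s₂) (sq-nonneg s₂) (^-mono d 0≤Q Q≤PG) ⟩
      (P * G) ^ d * (s₂ * s₂)       ≡⟨ cong (_* (s₂ * s₂)) (^-distrib-* P G d) ⟩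
      P ^ d * G ^ d * (s₂ * s₂)     ≡⟨ ℚₚ.*-assoc (P ^ d) (G ^ d) (s₂ * s₂) ⟩
      P ^ d * (G ^ d * (s₂ * s₂))   ∎)

open import Defs
open Rational using (inverse-pos; +-nonneg; *-nonneg; sq-nonneg; S; S-cong; size; spread; 256n²; 256n²-nonneg;
    square;
  numeral-≤; numeral-nonneg; 2nd; 4th; module Polynomial; module Slice; variance-bound; 1≤√; normalise)

-- Real numbers

-- `x ≃ y` unfolds to `Null` of the termwise difference.
Null : (ℕ → ℚ) → Set
Null s = ∀ ε → 0ℚ ℚ.< ε → ∃ λ N → ∀ n → N ℕ.≤ n → ℚ.∣ s n ∣ ℚ.< ε

null-cong : ∀ {s t} → (∀ n → s n ≡ t n) → Null s → Null t
null-cong s≡t null ε 0<ε = proj₁ (null ε 0<ε) , λ n N≤n →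
  subst (λ q → ℚ.∣ q ∣ ℚ.< ε) (s≡t n) (proj₂ (null ε 0<ε) n N≤n)

halves : ∀ ε → ε ℚ.* ℚ.½ ℚ.+ ε ℚ.* ℚ.½ ≡ ε
halves ε = trans (sym (ℚₚ.*-distribˡ-+ ε ℚ.½ ℚ.½)) (ℚₚ.*-identityʳ ε)

half-pos : ∀ {ε} → 0ℚ ℚ.< ε → 0ℚ ℚ.< ε ℚ.* ℚ.½
half-pos 0<ε = Rational.*-pos 0<ε (ℚₚ.positive⁻¹ ℚ.½)

null-+ : ∀ {s t} → Null s → Null t → Null (λ n → s n ℚ.+ t n)
null-+ {s} {t} null-s null-t ε 0<ε = N₁ ℕ.⊔ N₂ , λ n N≤n →
  subst (ℚ.∣ s n ℚ.+ t n ∣ ℚ.<_) (halves ε) (ℚₚ.≤-<-trans (ℚₚ.∣p+q∣≤∣p∣+∣q∣ (s n) (t n))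
    (ℚₚ.+-mono-< (proj₂ s-small n (ℕₚ.m⊔n≤o⇒m≤o N₁ N₂ N≤n)) (proj₂ t-small n (ℕₚ.m⊔n≤o⇒n≤o N₁ N₂ N≤n))))
  where
  s-small = null-s (ε ℚ.* ℚ.½) (half-pos 0<ε)
  t-small = null-t (ε ℚ.* ℚ.½) (half-pos 0<ε)
  N₁ = proj₁ s-small
  N₂ = proj₁ t-small

bounded : ∀ x → ∃ λ N → ∃ λ B → 0ℚ ℚ.< B × (∀ n → N ℕ.≤ n → ℚ.∣ seq x n ∣ ℚ.≤ B)
bounded x = N , 1ℚ ℚ.+ ℚ.∣ seq x N ∣ , ℚₚ.+-mono-<-≤ Rational.0<1ℚ (ℚₚ.0≤∣p∣ (seq x N)) , λ n N≤n → begin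
  ℚ.∣ seq x n ∣
    ≡⟨ cong ℚ.∣_∣ (split (seq x n) (seq x N)) ⟩
  ℚ.∣ (seq x n ℚ.- seq x N) ℚ.+ seq x N ∣
    ≤⟨ ℚₚ.∣p+q∣≤∣p∣+∣q∣ (seq x n ℚ.- seq x N) (seq x N) ⟩
  ℚ.∣ seq x n ℚ.- seq x N ∣ ℚ.+ ℚ.∣ seq x N ∣
    ≤⟨ ℚₚ.+-monoˡ-≤ ℚ.∣ seq x N ∣ (ℚₚ.<⇒≤ (proj₂ tail n N N≤n ℕₚ.≤-refl)) ⟩
  1ℚ ℚ.+ ℚ.∣ seq x N ∣ ∎
  where
  open ℚₚ.≤-Reasoning
  tail = cauchy x 1ℚ Rational.0<1ℚ
  N = proj₁ tail
  split : ∀ a b → a ≡ (a ℚ.- b) ℚ.+ b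
  split = solve-∀ ℚ-ring

null-* : ∀ x {s} → Null s → Null (λ n → seq x n ℚ.* s n)
null-* x {s} null ε 0<ε = N₁ ℕ.⊔ N₂ , λ n N≤n → begin-strict
  ℚ.∣ seq x n ℚ.* s n ∣
    ≡⟨ ℚₚ.∣p*q∣≡∣p∣*∣q∣ (seq x n) (s n) ⟩
  ℚ.∣ seq x n ∣ ℚ.* ℚ.∣ s n ∣
    ≤⟨ Rational.*-monoʳ ℚ.∣ s n ∣ (ℚₚ.0≤∣p∣ (s n)) (x≤B n (ℕₚ.m⊔n≤o⇒m≤o N₁ N₂ N≤n)) ⟩
  B ℚ.* ℚ.∣ s n ∣
    <⟨ ℚₚ.*-monoʳ-<-pos B {{ℚ.positive 0<B}} (proj₂ s-small n (ℕₚ.m⊔n≤o⇒n≤o N₁ N₂ N≤n)) ⟩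
  B ℚ.* (ε ℚ.* B⁻¹)
    ≡⟨ trans (swap B ε B⁻¹) (trans (cong (ε ℚ.*_) BB⁻¹≡1) (ℚₚ.*-identityʳ ε)) ⟩
  ε ∎
  where
  open ℚₚ.≤-Reasoning
  bound = bounded x
  N₁ = proj₁ bound
  B = proj₁ (proj₂ bound)
  0<B : 0ℚ ℚ.< B
  0<B = proj₁ (proj₂ (proj₂ bound))
  x≤B = proj₂ (proj₂ (proj₂ bound))
  B⁻¹ = proj₁ (Rational.inverse 0<B)
  BB⁻¹≡1 : B ℚ.* B⁻¹ ≡ 1ℚ
  BB⁻¹≡1 = proj₂ (Rational.inverse 0<B)
  0<B⁻¹ : 0ℚ ℚ.< B⁻¹
  0<B⁻¹ = inverse-pos 0<B BB⁻¹≡1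
  s-small = null (ε ℚ.* B⁻¹) (Rational.*-pos 0<ε 0<B⁻¹)
  N₂ = proj₁ s-small
  swap : ∀ a b c → a ℚ.* (b ℚ.* c) ≡ b ℚ.* (a ℚ.* c)
  swap = solve-∀ ℚ-ring

≃-refl : ∀ {x} → x ≃ x
≃-refl {x} ε 0<ε = 0 , λ n _ → subst (ℚ._< ε) (cong ℚ.∣_∣ (sym (ℚₚ.+-inverseʳ (seq x n)))) 0<ε

+-cong : ∀ {x x′ y y′} → x ≃ x′ → y ≃ y′ → x + y ≃ x′ + y′
+-cong {x} {x′} {y} {y′} x≃ y≃ = null-cong (λ n → regroup (seq x n) (seq x′ n) (seq y n) (seq y′ n))
  (null-+ {λ n → seq x n ℚ.- seq x′ n} {λ n → seq y n ℚ.- seq y′ n} x≃ y≃)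
  where
  regroup : ∀ a a′ b b′ → (a ℚ.- a′) ℚ.+ (b ℚ.- b′) ≡ (a ℚ.+ b) ℚ.- (a′ ℚ.+ b′)
  regroup = solve-∀ ℚ-ring

*-cong : ∀ {x x′ y y′} → x ≃ x′ → y ≃ y′ → x * y ≃ x′ * y′
*-cong {x} {x′} {y} {y′} x≃ y≃ = null-cong (λ n → regroup (seq x n) (seq x′ n) (seq y n) (seq y′ n))
  (null-+ {λ n → seq x n ℚ.* (seq y n ℚ.- seq y′ n)} {λ n → seq y′ n ℚ.* (seq x n ℚ.- seq x′ n)}
    (null-* x {λ n → seq y n ℚ.- seq y′ n} y≃) (null-* y′ {λ n → seq x n ℚ.- seq x′ n} x≃))
  where
  regroup : ∀ a a′ b b′ → a ℚ.* (b ℚ.- b′) ℚ.+ b′ ℚ.* (a ℚ.- a′) ≡ a ℚ.* b ℚ.- a′ ℚ.* b′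
  regroup = solve-∀ ℚ-ring

^-cong : ∀ {x x′} d → x ≃ x′ → x ^ d ≃ x′ ^ d
^-cong         zero    x≃ = ≃-refl {1ℝ}
^-cong {x} {x′} (suc d) x≃ = *-cong {x} {x′} {x ^ d} {x′ ^ d} x≃ (^-cong {x} {x′} d x≃)

∑-cong : ∀ {A : Set} (xs : List A) (F G : A → ℝ) → (∀ x → F x ≃ G x) → ∑ xs F ≃ ∑ xs G
∑-cong []       F G F≃G = ≃-refl {0ℝ}
∑-cong (x ∷ xs) F G F≃G = +-cong {F x} {G x} {∑ xs F} {∑ xs G} (F≃G x) (∑-cong xs F G F≃G)

mean-cong : ∀ {A : Set} (xs : List A) (F G : A → ℝ) → (∀ x → F x ≃ G x) → mean xs F ≃ mean xs G
mean-cong []          F G F≃G = ≃-refl {0ℝ}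
mean-cong xs@(_ ∷ _) F G F≃G = *-cong {w} {w} {∑ xs F} {∑ xs G} (≃-refl {w}) (∑-cong xs F G F≃G)
  where w = fromℚ (ℤ.+ 1 ℚ./ List.length xs)

eval-cong : ∀ {n} {f g : MultilinearPoly n} (ys : Vec ℝ n) → (∀ T → f T ≃ g T) → eval f ys ≃ eval g ys
eval-cong {n} {f} {g} ys f≃g = ∑-cong (subsets n) (λ T → f T * monomial T ys) (λ T → g T * monomial T ys) λ T →
  *-cong {f T} {g T} {monomial T ys} {monomial T ys} (f≃g T) (≃-refl {monomial T ys})

-- Passing from x to x′ and from y′ to y costs ε/2 each.
≤-from-terms : ∀ {x x′ y y′} → x ≃ x′ → y ≃ y′ → (∀ n → seq x′ n ℚ.≤ seq y′ n) → x ≤ y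
≤-from-terms {x} {x′} {y} {y′} x≃ y≃ x′≤y′ ε 0<ε = N₁ ℕ.⊔ N₂ , λ n N≤n → begin
  seq x n
    ≡⟨ split (seq x n) (seq x′ n) ⟩
  seq x′ n ℚ.+ (seq x n ℚ.- seq x′ n)
    ≤⟨ ℚₚ.+-mono-≤ (x′≤y′ n) (ℚₚ.≤-trans (p≤∣p∣ (seq x n ℚ.- seq x′ n)) (ℚₚ.<⇒≤ (proj₂ x-close n
        (ℕₚ.m⊔n≤o⇒m≤o N₁ N₂ N≤n)))) ⟩
  seq y′ n ℚ.+ ε ℚ.* ℚ.½
    ≡⟨ cong (ℚ._+ ε ℚ.* ℚ.½) (split′ (seq y n) (seq y′ n)) ⟩
  seq y n ℚ.+ ℚ.- (seq y n ℚ.- seq y′ n) ℚ.+ ε ℚ.* ℚ.½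
    ≤⟨ ℚₚ.+-monoˡ-≤ (ε ℚ.* ℚ.½) (ℚₚ.+-monoʳ-≤ (seq y n)
         (ℚₚ.≤-trans (p≤∣p∣ (ℚ.- (seq y n ℚ.- seq y′ n)))
           (ℚₚ.≤-trans (ℚₚ.≤-reflexive (ℚₚ.∣-p∣≡∣p∣ (seq y n ℚ.- seq y′ n))) (ℚₚ.<⇒≤ (proj₂ y-close n
               (ℕₚ.m⊔n≤o⇒n≤o N₁ N₂ N≤n)))))) ⟩
  seq y n ℚ.+ ε ℚ.* ℚ.½ ℚ.+ ε ℚ.* ℚ.½
    ≡⟨ trans (ℚₚ.+-assoc (seq y n) _ _) (cong (seq y n ℚ.+_) (halves ε)) ⟩
  seq y n ℚ.+ ε ∎
  where
  open ℚₚ.≤-Reasoning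
  x-close = x≃ (ε ℚ.* ℚ.½) (half-pos 0<ε)
  y-close = y≃ (ε ℚ.* ℚ.½) (half-pos 0<ε)
  N₁ = proj₁ x-close
  N₂ = proj₁ y-close
  p≤∣p∣ : ∀ p → p ℚ.≤ ℚ.∣ p ∣
  p≤∣p∣ p with ℚₚ.≤-total 0ℚ p
  ... | inj₁ 0≤p = ℚₚ.≤-reflexive (sym (ℚₚ.0≤p⇒∣p∣≡p 0≤p))
  ... | inj₂ p≤0 = ℚₚ.≤-trans p≤0 (ℚₚ.0≤∣p∣ p)
  split : ∀ a b → a ≡ b ℚ.+ (a ℚ.- b)
  split = solve-∀ ℚ-ring
  split′ : ∀ a b → b ≡ a ℚ.+ ℚ.- (a ℚ.- b)
  split′ = solve-∀ ℚ-ring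

-- Rational approximations of means and polynomials

seq-^ : ∀ x d t → seq (x ^ d) t ≡ seq x t Rational.^ d
seq-^ x zero    t = refl
seq-^ x (suc d) t = cong (seq x t ℚ.*_) (seq-^ x d t)

seq-∑ : ∀ {A : Set} (xs : List A) (F : A → ℝ) t → seq (∑ xs F) t ≡ Rational.∑ xs (λ x → seq (F x) t)
seq-∑ []       F t = refl
seq-∑ (x ∷ xs) F t = cong (seq (F x) t ℚ.+_) (seq-∑ xs F t)

ℕ→ℚ-length : ∀ {A : Set} (xs : List A) → ℕ→ℚ (List.length xs) ≡ Rational.∑ xs (λ _ → 1ℚ)
ℕ→ℚ-length []       = refl
ℕ→ℚ-length (x ∷ xs) = trans (Rational.ℕ→ℚ-suc (List.length xs)) (cong (1ℚ ℚ.+_) (ℕ→ℚ-length xs))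

-- The factor in front of the sum in `mean`; on the empty list it is 0, matching the convention
-- there.
weight : ∀ {A : Set} → List A → ℚ
weight []         = 0ℚ
weight xs@(_ ∷ _) = ℤ.+ 1 ℚ./ List.length xs

seq-mean : ∀ {A : Set} (xs : List A) (F : A → ℝ) t → seq (mean xs F) t ≡ weight xs ℚ.* Rational.∑ xs (λ x →
    seq (F x) t)
seq-mean []         F t = refl
seq-mean xs@(_ ∷ _) F t = cong (weight xs ℚ.*_) (seq-∑ xs F t)

weight-size : ∀ {A : Set} (xs : List A) → weight xs ℚ.* weight xs ℚ.* Rational.∑ xs (λ _ → 1ℚ) ≡ weight xs
weight-size []         = refl
weight-size xs@(_ ∷ ys) = trans (ℚₚ.*-assoc w w _) (trans (cong (w ℚ.*_) ws≡1) (ℚₚ.*-identityʳ w))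
  where
  w = weight xs
  ws≡1 : w ℚ.* Rational.∑ xs (λ _ → 1ℚ) ≡ 1ℚ
  ws≡1 = trans (cong (w ℚ.*_) (sym (ℕ→ℚ-length xs))) (1/m*m (List.length ys))
    where
    1/m*m : ∀ m → ℤ.+ 1 ℚ./ suc m ℚ.* ℕ→ℚ (suc m) ≡ 1ℚ
    1/m*m m = ℚₚ.toℚᵘ-injective (ℚᵘₚ.≃-trans (ℚₚ.toℚᵘ-homo-* (ℤ.+ 1 ℚ./ suc m) (ℕ→ℚ (suc m)))
      (ℚᵘₚ.≃-trans (ℚᵘₚ.*-cong (ℚₚ.toℚᵘ-fromℚᵘ (ℚᵘ.mkℚᵘ (ℤ.+ 1) m)) (ℚₚ.toℚᵘ-fromℚᵘ (ℚᵘ.mkℚᵘ (ℤ.+ suc m) 0)))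
        (ℚᵘ.*≡* (trans (ℤₚ.*-identityʳ (ℤ.+ 1 ℤ.* ℤ.+ suc m)) (cong (λ a → ℤ.+ 1 ℤ.* ℤ.+ a)
            (sym (ℕₚ.*-identityʳ (suc m))))))))

module _ {n : ℕ} (y : Sign → ℝ) (t : ℕ) where

  open Polynomial {n} (λ s → seq (y s) t)

  seq-monomial : ∀ {m} (T : Subset m) (ρ : Fin m → Fin n) (z : Cube m) (x : Cube n) →
    (∀ i → Vec.lookup z i ≡ Vec.lookup x (ρ i)) → seq (monomial T (Vec.map y z)) t ≡ monomialℚ T ρ x
  seq-monomial []          ρ []      x agree = refl
  seq-monomial (true  ∷ T) ρ (s ∷ z) x agree = cong₂ ℚ._*_ (cong (λ s → seq (y s) t) (agree Fin.zero))
    (seq-monomial T (ρ ∘ Fin.suc) z x (agree ∘ Fin.suc))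
  seq-monomial (false ∷ T) ρ (s ∷ z) x agree = seq-monomial T (ρ ∘ Fin.suc) z x (agree ∘ Fin.suc)

  seq-eval : ∀ (f : MultilinearPoly n) x → seq (eval f (Vec.map y x)) t ≡ evalℚ (λ T → seq (f T) t) x
  seq-eval f x = trans (seq-∑ (subsets n) (λ T → f T * monomial T (Vec.map y x)) t) (Rational.∑-cong
      (subsets n) λ T →
    cong (seq (f T) t ℚ.*_) (seq-monomial T (λ i → i) x x (λ _ → refl)))

truncate : ∀ {n} → ℕ → MultilinearPoly n → MultilinearPoly n
truncate d f T with ∣ T ∣ ℕₚ.≤? d
... | yes _ = f T
... | no  _ = 0ℝ

truncate-≃ : ∀ {n} d (f : MultilinearPoly n) → DegreeAtMost d f → ∀ T → f T ≃ truncate d f T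
truncate-≃ d f degree T with ∣ T ∣ ℕₚ.≤? d
... | yes _   = ≃-refl {f T}
... | no  T≰d = degree T (ℕₚ.≰⇒> T≰d)

truncate-degree : ∀ {n} d (f : MultilinearPoly n) t T → d ℕ.< ∣ T ∣ → seq (truncate d f T) t ≡ 0ℚ
truncate-degree d f t T d<T with ∣ T ∣ ℕₚ.≤? d
... | yes T≤d = contradiction T≤d (ℕₚ.<⇒≱ d<T)
... | no  _   = refl

-- The moment inequality for a given bias

module _ (d n : ℕ) (1≤d : 1 ℕ.≤ d) (1≤n : 1 ℕ.≤ n) (p : ℚ) (0<p : 0ℚ ℚ.< p) (p<1 : p ℚ.< 1ℚ)
  (pn∈ℤ : IsInteger (p ℚ.* ℕ→ℚ n)) where

  open Bias p 0<p p<1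
  open Slice p 0<p p<1 n 1≤n pn∈ℤ

  private
    -- The base of the d-th power in `K d`. Its sequence is constant, so the term at 0 stands for
    -- every term.
    G : ℚ
    G = seq (fromℕ 256 * (fromℚ [1-p]/p ^ 2 + fromℚ p/[1-p] ^ 2) ^ 2) 0

    -- `variance-bound` multiplied by 256 n², as `spread n k` is p (1 - p) n².
    256n²≤spread*G : 256n² n ℚ.≤ spread n k ℚ.* G
    256n²≤spread*G = subst₂ ℚ._≤_ (ℚₚ.*-identityʳ (256n² n)) eq
      (Rational.*-monoˡ (256n² n) (256n²-nonneg n) (variance-bound 0<p (p<1⇒0<1-p p<1) (p+[1-p] p)
        (ℚₚ.*-inverseʳ p {{ℚ.>-nonZero 0<p}}) (ℚₚ.*-inverseʳ (1ℚ ℚ.- p) {{ℚ.>-nonZero (p<1⇒0<1-p p<1)}})))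
      where
      p+[1-p] : ∀ p → p ℚ.+ (1ℚ ℚ.- p) ≡ 1ℚ
      p+[1-p] = solve-∀ ℚ-ring
      ring : ∀ c n² pq a b →
        c ℚ.* n² ℚ.* (pq ℚ.* ((a ℚ.* a ℚ.+ b ℚ.* b) ℚ.* (a ℚ.* a ℚ.+ b ℚ.* b))) ≡
        pq ℚ.* n² ℚ.* (c ℚ.* ((a ℚ.* (a ℚ.* 1ℚ) ℚ.+ b ℚ.* (b ℚ.* 1ℚ)) ℚ.* ((a ℚ.* (a ℚ.* 1ℚ) ℚ.+ b ℚ.*
            (b ℚ.* 1ℚ)) ℚ.* 1ℚ)))
      ring = solve-∀ ℚ-ring
      eq = trans (ring (ℕ→ℚ 256) (square n) (p ℚ.* (1ℚ ℚ.- p)) [1-p]/p p/[1-p])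
        (cong (ℚ._* G) (sym spread≡))

    0≤G : 0ℚ ℚ.≤ G
    0≤G = subst (0ℚ ℚ.≤_) (ring (ℕ→ℚ 256) ([1-p]/p ℚ.* ([1-p]/p ℚ.* 1ℚ) ℚ.+ p/[1-p] ℚ.* (p/[1-p] ℚ.* 1ℚ)))
      (*-nonneg (numeral-nonneg 256) (sq-nonneg ([1-p]/p ℚ.* ([1-p]/p ℚ.* 1ℚ) ℚ.+ p/[1-p] ℚ.*
          (p/[1-p] ℚ.* 1ℚ))))
      where
      ring : ∀ c s → c ℚ.* (s ℚ.* s) ≡ c ℚ.* (s ℚ.* (s ℚ.* 1ℚ))
      ring = solve-∀ ℚ-ring

    C : ℕ → ℚ
    C t = ℕ→ℚ 12 ℚ.* √-approx (ℕ→ℚ (d ℕ.^ 3)) t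

    1≤C : ∀ t → 1ℚ ℚ.≤ C t
    1≤C t = Rational.*-mono (ℚₚ.<⇒≤ Rational.0<1ℚ) (ℚₚ.≤-trans (ℚₚ.<⇒≤ Rational.0<1ℚ) 1≤r) (numeral-≤ {1} {12}
        (ℕ.s≤s ℕ.z≤n)) 1≤r
      where
      1≤r : 1ℚ ℚ.≤ √-approx (ℕ→ℚ (d ℕ.^ 3)) t
      1≤r = 1≤√ (numeral-≤ (ℕₚ.≤-trans (ℕₚ.≤-reflexive (sym (ℕₚ.^-zeroˡ 3))) (ℕₚ.^-monoˡ-≤ 3 1≤d))) t

    seq-K : ∀ t → seq (K d) t ≡ C t ℚ.* G Rational.^ d
    seq-K t = cong (C t ℚ.*_) (seq-^ (fromℕ 256 * (fromℚ [1-p]/p ^ 2 + fromℚ p/[1-p] ^ 2) ^ 2) d t)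

  module _ (y : Sign → ℝ) where

    moment : ℕ → MultilinearPoly n → ℝ
    moment r f = 𝔼 p n (λ x → eval f (Vec.map y x) ^ r)

    moment-cong : ∀ r {f g} → (∀ T → f T ≃ g T) → moment r f ≃ moment r g
    moment-cong r {f} {g} f≃g = mean-cong (slice p n) (λ x → eval f (Vec.map y x) ^ r) (λ x →
        eval g (Vec.map y x) ^ r) λ x →
      ^-cong {eval f (Vec.map y x)} {eval g (Vec.map y x)} r (eval-cong {f = f} {g = g} (Vec.map y x) f≃g)

    module _ (t : ℕ) (f : MultilinearPoly n) where

      open Polynomial {n} (λ s → seq (y s) t)

      private
        fₜ : Cube n → ℚ
        fₜ = evalℚ (λ T → seq (f T) t)
        w : ℚ
        w = weight (slice p n)

      seq-moment : ∀ r → seq (moment r f) t ≡ w ℚ.* S k (λ x → fₜ x Rational.^ r)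
      seq-moment r = trans (seq-mean (slice p n) (λ x → eval f (Vec.map y x) ^ r) t) (cong (w ℚ.*_) (trans
        (Rational.∑-cong (slice p n) (λ x → trans (seq-^ (eval f (Vec.map y x)) r t) (cong (Rational._^ r)
            (seq-eval y t f x))))
        (∑-slice _)))

      seq-hypercontractive : (∀ T → d ℕ.< ∣ T ∣ → seq (f T) t ≡ 0ℚ) →
        seq (moment 4 f) t ℚ.≤ seq (K d * moment 2 f ^ 2) t
      seq-hypercontractive degree = begin
        seq (moment 4 f) t
          ≡⟨ trans (seq-moment 4) (cong (w ℚ.*_) (S-cong k (λ x _ → ring₄ (fₜ x)))) ⟩
        w ℚ.* 4th k fₜ
          ≤⟨ normalise d {w} {size n k} {2nd k fₜ} {4th k fₜ} {spread n k} {256n² n} {G} {C t}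
               0<spread (256n²-nonneg n) 0≤G (1≤C t) 256n²≤spread*G size≡
               (eval-hypercontractive d k k≤n (λ T → seq (f T) t) degree) ⟩
        C t ℚ.* G Rational.^ d ℚ.* ((w ℚ.* 2nd k fₜ) ℚ.* (w ℚ.* 2nd k fₜ))
          ≡⟨ cong (C t ℚ.* G Rational.^ d ℚ.*_) (trans (cong (λ m → m ℚ.* m) (sym second)) (sym (ring₂
              (seq (moment 2 f) t)))) ⟩
        C t ℚ.* G Rational.^ d ℚ.* seq (moment 2 f ^ 2) t
          ≡⟨ cong (ℚ._* seq (moment 2 f ^ 2) t) (seq-K t) ⟨
        seq (K d * moment 2 f ^ 2) t ∎
        where
        open ℚₚ.≤-Reasoning
        ring₂ : ∀ a → a ℚ.* (a ℚ.* 1ℚ) ≡ a ℚ.* a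
        ring₂ = solve-∀ ℚ-ring
        ring₄ : ∀ a → a ℚ.* (a ℚ.* (a ℚ.* (a ℚ.* 1ℚ))) ≡ (a ℚ.* a) ℚ.* (a ℚ.* a)
        ring₄ = solve-∀ ℚ-ring
        second : seq (moment 2 f) t ≡ w ℚ.* 2nd k fₜ
        second = trans (seq-moment 2) (cong (w ℚ.*_) (S-cong k (λ x _ → ring₂ (fₜ x))))
        size≡ : w ℚ.* w ℚ.* size n k ≡ w
        size≡ = trans (cong (w ℚ.* w ℚ.*_) (sym (∑-slice (λ _ → 1ℚ)))) (weight-size (slice p n))

    -- Truncation changes both sides only up to `≃` and makes the degree condition exact in every
    -- approximation. The values y at the two signs are arbitrary, which covers `φ` and ±1 alike.
    moment-bound : (f : MultilinearPoly n) → DegreeAtMost d f →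
      𝔼 p n (λ x → eval f (Vec.map y x) ^ 4) ≤ K d * 𝔼 p n (λ x → eval f (Vec.map y x) ^ 2) ^ 2
    moment-bound f degree = ≤-from-terms
      {moment 4 f} {moment 4 g} {K d * moment 2 f ^ 2} {K d * moment 2 g ^ 2}
      (moment-cong 4 {f} {g} f≃g)
      (*-cong {K d} {K d} {moment 2 f ^ 2} {moment 2 g ^ 2} (≃-refl {K d}) (^-cong {moment 2 f} {moment 2 g} 2
          (moment-cong 2 {f} {g} f≃g)))
      (λ t → seq-hypercontractive t g (truncate-degree d f t))
      where
      g = truncate d f
      f≃g = truncate-≃ d f degree

corollary5p2 : (d n : ℕ) → 1 ℕ.≤ d → 1 ℕ.≤ n →
    (p : ℚ) (0<p : 0ℚ ℚ.< p) (p<1 : p ℚ.< 1ℚ) → IsInteger (p ℚ.* ℕ→ℚ n) →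
    let open Bias p 0<p p<1 in
    ((f : MultilinearPoly n) → DegreeAtMost d f →
    𝔼 p n (λ x → eval f (Vec.map φ x) ^ 4)
    ≤ K d * 𝔼 p n (λ x → eval f (Vec.map φ x) ^ 2) ^ 2)
    ×
    ((g : MultilinearPoly n) → DegreeAtMost d g →
    𝔼 p n (λ x → eval g (Vec.map (λ s → fromℚ (±1 s)) x) ^ 4)
    ≤ K d * 𝔼 p n (λ x → eval g (Vec.map (λ s → fromℚ (±1 s)) x) ^ 2) ^ 2)
-- The arguments φ and λ s → fromℚ (±1 s) are left to unification: written out, φ would refer to
-- another copy of Bias, and comparing the two copies unfolds the arithmetic of ℝ.
corollary5p2 d n 1≤d 1≤n p 0<p p<1 pn∈ℤ =
  moment-bound d n 1≤d 1≤n p 0<p p<1 pn∈ℤ _ ,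
  moment-bound d n 1≤d 1≤n p 0<p p<1 pn∈ℤ _
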